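{- For every $n\ge 1$, $$\Sigma_n=\sum_{\sigma\in\mathfrak S_n}\mathbf{\Psi}^\sigma \;=\; \sum_{I,J\,\vDash\, n} (-1)^{n-l(I)}\, q^{D(I,J)}\,\Lambda_I^{(J)},$$ where the sum runs over all pairs $(I,J)$ of compositions of $n$ and $l(I)$ is the number of parts of $I$.
   Context: Scalars: $q$ is an indeterminate (scalar parameter). Biwords. For $n\ge 0$, a permutation $\tau\in\mathfrak S_n$ (written as a word) and a word $u=u_1\cdots u_n$ of positive integers (a color word), let $\binom{u}{\tau}$ denote a formal basis element (this is $\mathbf G_{\tau,u}$ in the algebra of colored free quasi-symmetric functions; top row = colors, bottom row = permutation). Product: $\binom{u}{\alpha}\binom{v}{\beta}=\sum_{\gamma\in\alpha*\beta}\binom{uv}{\gamma}$, where, for $\alpha\in\mathfrak S_a$, $\beta\in\mathfrak S_b$, $\alpha*\beta$ is the set (formal sum) of all $\gamma\in\mathfrak S_{a+b}$ which, written $\gamma=xy$ with $|x|=a$, $|y|=b$, satisfy $\mathrm{std}(x)=\alpha$, $\mathrm{std}(y)=\beta$; $\mathrm{std}$ denotes standardization (the permutation with the same relative order of letters). In rows of biwords notation is extended bilinearly. The elements $\Psi^u$. For a color word $u=u_1\cdots u_p$, regard $(u_i,i)$ as biletters, set $B_1=(u_1,1)$ and $B_i=[B_{i-1},(u_i,i)]_q$ for $i\ge2$, where $[x,y]_q=xy-q\,yx$ and products of biletters are concatenation of words in biletters. Interpreting each resulting word in biletters as a biword (colors on top, numbers below), put $\Psi^u:=B_p$. E.g.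 $\Psi^{312}=\binom{312}{123}-q\binom{132}{213}-q\binom{231}{312}+q^2\binom{213}{321}$. A word $u=u_1\cdots u_p$ is initially dominated if $u_1>u_i$ for all $i>1$. Each word has a unique factorization $u=u^{(1)}u^{(2)}\cdots u^{(p)}$ into initially dominated words whose first letters satisfy $u^{(1)}_1\le u^{(2)}_1\le\cdots\le u^{(p)}_1$. For $\sigma\in\mathfrak S_n$ with this factorization, $\mathbf\Psi^\sigma:=\Psi^{u^{(1)}}\Psi^{u^{(2)}}\cdots\Psi^{u^{(p)}}$ (product of biwords above), and the saillance composition of $\sigma$ is $S(\sigma):=(|u^{(1)}|,\dots,|u^{(p)}|)$. Compositions. $I\vDash n$ means $I$ is a composition of $n$. For $I=(i_1,\dots,i_s)\vDash n$, $\mathrm{Des}(I)=\{i_1,i_1+i_2,\dots,i_1+\cdots+i_{s-1}\}\subseteq\{1,\dots,n-1\}$. The descent composition $D(\tau)$ of $\tau\in\mathfrak S_n$ is the composition whose parts are the lengths of the maximal increasing factors of $\tau$. For $I,J\vDash n$ let $R_I^{(J)}:=\sum_{\tau,\sigma\in\mathfrak S_n:\ D(\tau)=I,\ S(\sigma)=J}\binom{\sigma}{\tau}$ and $\Lambda_I^{(J)}:=\sum_{I'}R_{I'}^{(J)}$, the sum being over all compositions $I'$ finer than or equal to the conjugate $\overline I^{\sim}$ of the mirror image $\overline I$ of $I$; equivalently over all $I'\vDash n$ with $\mathrm{Des}(I')\supseteq\{1,\dots,n-1\}\setminus\mathrm{Des}(I)$. E.g. $\Lambda_{32}^{(41)}=R_{1121}^{(41)}+R_{11111}^{(41)}$.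 The statistic $D(I,J)$. For compositions, $(a_1,\dots,a_r)\cdot(b_1,\dots,b_s)=(a_1,\dots,a_r,b_1,\dots,b_s)$ and $(a_1,\dots,a_r)\triangleright(b_1,\dots,b_s)=(a_1,\dots,a_r+b_1,\dots,b_s)$. For $I=(i_1,\dots,i_r)$ and $J$ compositions of $n$, $J\downarrow I=(J^{(1)},\dots,J^{(r)})$ is the unique sequence of compositions with $J^{(k)}\vDash i_k$ and $J=J^{(1)}\circ_1J^{(2)}\circ_2\cdots\circ_{r-1}J^{(r)}$ with each $\circ_i\in\{\cdot,\triangleright\}$. Then $D(I,J):=n-\sum_{k=1}^r(\text{last part of }J^{(k)})$. E.g. for $I=(6,2,2,4,1,4)$, $J=(3,2,4,3,2,5)$: $J\downarrow I=((3,2,1),(2),(1,1),(2,2),(1),(4))$ and $D(I,J)=8$. -}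

module Defs where

open import Algebra.Bundles using (CommutativeRing)
open import Data.List.Base as List
  using (List; []; _∷_; [_]; _++_; map; concatMap; filter; foldr; length; take; drop; zip;
         upTo; cartesianProductWith)
import Data.List.Membership.DecPropositional as DecMembership
open import Data.List.Membership.Propositional using (_∈_; find; lose)
open import Data.List.Membership.Propositional.Properties using (∈-concatMap⁺; ∈-concatMap⁻)
open import Data.List.Relation.Unary.Unique.Propositional using (Unique)
import Data.List.Relation.Unary.Unique.Propositional.Properties as Unique
import Data.List.NonEmpty.Base as List⁺
open List⁺ using (List⁺; _∷_)
open import Data.List.Properties using (≡-dec; ++-identityʳ)
open import Data.List.Relation.Binary.Pointwise using (Pointwise; []; _∷_)
import Data.List.Relation.Binary.Subset.DecPropositional as DecSubset
open import Data.List.Relation.Binary.Disjoint.Propositional using (Disjoint)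
open import Data.List.Relation.Unary.All as All using (All; []; _∷_)
import Data.List.Relation.Unary.All.Properties as All
import Data.List.Relation.Unary.AllPairs.Core as AllPairs
open import Data.List.Relation.Unary.Any using (here; there)
open import Data.List.Relation.Unary.Linked using (Linked; []; [-]; _∷_)
import Data.List.Relation.Unary.Unique.DecPropositional as DecUnique
open import Data.Maybe.Base using (fromMaybe)
open import Data.Nat.Base as ℕ using (ℕ; zero; suc; _+_; _∸_; _<_; _≤_; s≤s; z≤n)
open import Data.Nat.ListAction using (sum)
open import Data.Nat.ListAction.Properties using (sum-++)
import Data.Nat.Properties as ℕ
open import Data.Product.Base using (_×_; _,_; proj₁; proj₂)
import Data.Product.Properties as Product
open import Data.Sum.Base as Sum using (_⊎_; inj₁; inj₂)
open import Function.Base using (_∘_)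
open import Level using (Level)
open import Relation.Binary.Definitions using (DecidableEquality; tri<; tri≈; tri>)
open import Relation.Binary.PropositionalEquality.Core
  using (_≡_; refl; sym; trans; cong; subst)
open import Relation.Nullary.Decidable using (yes; no; _×-dec_; ¬?)
open import Relation.Nullary.Negation using (contradiction)

private
  variable
    x : Level
    X : Set x

------------------------------------------------------------------------
-- Words and permutations

Word : Set
Word = List ℕ

_≟ʷ_ : DecidableEquality Word
_≟ʷ_ = ≡-dec ℕ._≟_

[1‥_] : ℕ → List ℕ
[1‥ n ] = map suc (upTo n)

wordsOver : List ℕ → ℕ → List Word
wordsOver alphabet zero    = [ [] ]
wordsOver alphabet (suc n) = cartesianProductWith _∷_ alphabet (wordsOver alphabet n)

𝔖 : ℕ → List Word
𝔖 n = filter (DecUnique.unique? ℕ._≟_) (wordsOver [1‥ n ] n)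

-- Only applied to words without repeated letters, where the letter of
-- std x at a given position is the rank of the letter of x there.
std : Word → Word
std x = map (λ a → length (filter (ℕ._≤? a) x)) x

_∗_ : Word → Word → List Word
α ∗ β = filter (λ γ → (std (take (length α) γ) ≟ʷ α) ×-dec (std (drop (length α) γ) ≟ʷ β))
               (𝔖 (length α + length β))

------------------------------------------------------------------------
-- Compositions

_⊨_ : List ℕ → ℕ → Set
I ⊨ n = All (0 <_) I × sum I ≡ n

refine : List ℕ → List (List ℕ)
refine []      = [ [ 1 ] ]
refine (i ∷ I) = (1 ∷ i ∷ I) ∷ (suc i ∷ I) ∷ []

compositions : ℕ → List (List ℕ)
compositions zero    = [ [] ]
compositions (suc n) = concatMap refine (compositions n)

compositions-sound : ∀ n {I} → I ∈ compositions n → I ⊨ n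
compositions-sound zero    (here refl) = [] , refl
compositions-sound (suc n) I∈
  with find (∈-concatMap⁻ refine {xs = compositions n} I∈)
... | []    , I′∈ , here refl         = let _ , e = compositions-sound n I′∈
                                        in s≤s z≤n ∷ [] , cong suc e
... | i ∷ I , I′∈ , here refl         = let pos , e = compositions-sound n I′∈
                                        in s≤s z≤n ∷ pos , cong suc e
... | i ∷ I , I′∈ , there (here refl) with compositions-sound n I′∈
...   | _ ∷ pos , e = s≤s z≤n ∷ pos , cong suc e

compositions-complete : ∀ n {I} → I ⊨ n → I ∈ compositions n
compositions-complete zero    {[]}              _               = here refl
compositions-complete zero    {zero ∷ I}        (() ∷ _ , _)
compositions-complete zero    {suc i ∷ I}       (_ , ())
compositions-complete (suc n) {zero ∷ I}        (() ∷ _ , _)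
compositions-complete (suc n) {1 ∷ []}          (_ ∷ pos , refl) = here refl
compositions-complete (suc n) {1 ∷ j ∷ I}       (_ ∷ pos , e) =
  ∈-concatMap⁺ refine
    (lose (compositions-complete n (pos , ℕ.suc-injective e)) (here refl))
compositions-complete (suc n) {suc (suc i) ∷ I} (_ ∷ pos , e) =
  ∈-concatMap⁺ refine
    (lose (compositions-complete n (s≤s z≤n ∷ pos , ℕ.suc-injective e)) (there (here refl)))

compositions-unique : ∀ n → Unique (compositions n)
compositions-unique zero    = [] AllPairs.∷ AllPairs.[]
compositions-unique (suc n) = go (compositions n) (compositions-sound n) (compositions-unique n)
  where
  coarsen : List ℕ → List ℕ
  coarsen (1 ∷ I)           = I
  coarsen (suc (suc i) ∷ I) = suc i ∷ I
  coarsen I                 = I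

  coarsen-refine : ∀ {I J} → All (0 <_) I → J ∈ refine I → coarsen J ≡ I
  coarsen-refine []             (here refl)         = refl
  coarsen-refine (_ ∷ _)        (here refl)         = refl
  coarsen-refine (s≤s _ ∷ _)    (there (here refl)) = refl

  refine-unique : ∀ {I} → All (0 <_) I → Unique (refine I)
  refine-unique []          = [] AllPairs.∷ AllPairs.[]
  refine-unique (s≤s _ ∷ _) = ((λ ()) ∷ []) AllPairs.∷ [] AllPairs.∷ AllPairs.[]

  go : ∀ Is → (∀ {I} → I ∈ Is → I ⊨ n) → Unique Is → Unique (concatMap refine Is)
  go []       _     _                    = AllPairs.[]
  go (I ∷ Is) sound (I∉ AllPairs.∷ uniq) =
    Unique.++⁺ (refine-unique I-pos) (go Is (sound ∘ there) uniq) disjoint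
    where
    I-pos = proj₁ (sound (here refl))

    disjoint : Disjoint (refine I) (concatMap refine Is)
    disjoint (J∈ , J∈′) with find (∈-concatMap⁻ refine {xs = Is} J∈′)
    ... | I′ , I′∈ , J∈refine =
      All.lookup I∉ I′∈ (trans (sym (coarsen-refine I-pos J∈))
                               (coarsen-refine (proj₁ (sound (there I′∈))) J∈refine))

_▷_ : List ℕ → List ℕ → List ℕ
[]           ▷ L       = L
(a ∷ [])     ▷ []      = [ a ]
(a ∷ [])     ▷ (b ∷ L) = (a + b) ∷ L
(a ∷ k ∷ K)  ▷ L       = a ∷ ((k ∷ K) ▷ L)

Des : List ℕ → List ℕ
Des []          = []
Des (i ∷ [])    = []
Des (i ∷ j ∷ I) = i ∷ map (i +_) (Des (j ∷ I))

-- cut i J splits J into a composition of i and what is left of J after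
-- it, breaking a part of J in two if need be.
cut : ℕ → List ℕ → List ℕ × List ℕ
cut i []      = [] , []
cut i (j ∷ J) with ℕ.<-cmp i j
... | tri< _ _ _ = [ i ] , (j ∸ i) ∷ J
... | tri≈ _ _ _ = [ i ] , J
... | tri> _ _ _ = let K , L = cut (i ∸ j) J in j ∷ K , L

_↓_ : List ℕ → List ℕ → List (List ℕ)
J ↓ []      = []
J ↓ (i ∷ I) = let K , L = cut i J in K ∷ (L ↓ I)

lastPart : List ℕ → ℕ
lastPart K = fromMaybe 0 (List.last K)

D : List ℕ → List ℕ → ℕ
D I J = sum I ∸ sum (map lastPart (J ↓ I))

-- Ks Joins J means J = K₁ ∘₁ K₂ ∘₂ ⋯ ∘ᵣ₋₁ Kᵣ with each ∘ᵢ either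
-- concatenation or ▷.
data _Joins_ : List (List ℕ) → List ℕ → Set where
  single : ∀ {K} → [ K ] Joins K
  by-++  : ∀ {K Ks J} → Ks Joins J → (K ∷ Ks) Joins (K ++ J)
  by-▷   : ∀ {K Ks J} → Ks Joins J → (K ∷ Ks) Joins (K ▷ J)

sum-zero : ∀ {K} → All (0 <_) K → sum K ≡ 0 → K ≡ []
sum-zero []          _ = refl
sum-zero (s≤s _ ∷ _) ()

▷-identityʳ : ∀ K → K ▷ [] ≡ K
▷-identityʳ []          = refl
▷-identityʳ (a ∷ [])    = refl
▷-identityʳ (a ∷ k ∷ K) = cong (a ∷_) (▷-identityʳ (k ∷ K))

▷-⊨ : ∀ {K L m n} → K ⊨ m → L ⊨ n → (K ▷ L) ⊨ (m + n)
▷-⊨ {[]}                 (_ , refl)          L⊨        = L⊨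
▷-⊨ {a ∷ []}    {[]}     K⊨@(_ , refl)       (_ , refl) =
  proj₁ K⊨ , sym (ℕ.+-identityʳ (a + 0))
▷-⊨ {a ∷ []}    {b ∷ L}  (p ∷ _ , refl)      (_ ∷ ps , refl) =
  ℕ.≤-trans p (ℕ.m≤m+n a b) ∷ ps ,
  trans (ℕ.+-assoc a b (sum L)) (cong (_+ (b + sum L)) (sym (ℕ.+-identityʳ a)))
▷-⊨ {a ∷ k ∷ K} {L} {n = n} (p ∷ ps , refl)  L⊨ =
  let qs , e = ▷-⊨ {k ∷ K} {L} (ps , refl) L⊨
  in p ∷ qs , trans (cong (a +_) e) (sym (ℕ.+-assoc a (k + sum K) n))

Joins-⊨ : ∀ {Ks I J} → Pointwise _⊨_ Ks I → Ks Joins J → J ⊨ sum I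
Joins-⊨ {I = i ∷ []} (K⊨ ∷ []) single = proj₁ K⊨ , trans (proj₂ K⊨) (sym (ℕ.+-identityʳ i))
Joins-⊨ ((ps , refl) ∷ Ks⊨) (by-++ {K} {J = J} js) =
  let qs , e = Joins-⊨ Ks⊨ js
  in All.++⁺ ps qs , trans (sum-++ K J) (cong (sum K +_) e)
Joins-⊨ (K⊨ ∷ Ks⊨) (by-▷ js) = ▷-⊨ K⊨ (Joins-⊨ Ks⊨ js)

cut-++ : ∀ k K L → All (0 <_) (k ∷ K) → cut (k + sum K) ((k ∷ K) ++ L) ≡ (k ∷ K , L)
cut-++ k K L (_ ∷ ps) with ℕ.<-cmp (k + sum K) k
... | tri< lt _ _ = contradiction lt (ℕ.m+n≮m k (sum K))
... | tri≈ _ e _ with refl ← sum-zero ps (ℕ.+-cancelˡ-≡ k _ _ (trans e (sym (ℕ.+-identityʳ k))))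
  = cong (λ i → [ i ] , L) (ℕ.+-identityʳ k)
cut-++ k []       L _        | tri> _ ne _ = contradiction (ℕ.+-identityʳ k) ne
cut-++ k (l ∷ K)  L (_ ∷ ps) | tri> _ _ _
  rewrite ℕ.m+n∸m≡n k (l + sum K) | cut-++ l K L ps = refl

cut-▷ : ∀ k K l L → All (0 <_) (k ∷ K) → 0 < l →
        cut (k + sum K) ((k ∷ K) ▷ (l ∷ L)) ≡ (k ∷ K , l ∷ L)
cut-▷ k [] l L _ 0<l rewrite ℕ.+-identityʳ k with ℕ.<-cmp k (k + l)
... | tri< _ _ _ = cong (λ m → [ k ] , m ∷ L) (ℕ.m+n∸m≡n k l)
... | tri≈ ≮ _ _ = contradiction (ℕ.m<m+n k 0<l) ≮
... | tri> ≮ _ _ = contradiction (ℕ.m<m+n k 0<l) ≮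
cut-▷ k (k′ ∷ K) l L (_ ∷ p@(s≤s _) ∷ ps) 0<l with ℕ.<-cmp (k + (k′ + sum K)) k
... | tri< lt _ _ = contradiction lt (ℕ.m+n≮m k (k′ + sum K))
... | tri≈ _ _ ≯ = contradiction (ℕ.m<m+n k (s≤s z≤n)) ≯
... | tri> _ _ _
  rewrite ℕ.m+n∸m≡n k (k′ + sum K) | cut-▷ k′ K l L (p ∷ ps) 0<l = refl

↓-unique : ∀ {Ks I J} → All (0 <_) I → Pointwise _⊨_ Ks I → Ks Joins J → J ↓ I ≡ Ks
↓-unique [] [] ()
↓-unique (() ∷ _) (_∷_ {x = []} (_ , refl) _) _
↓-unique _ (_∷_ {x = k ∷ K} (ps , refl) []) single
  with e ← cut-++ k K [] ps rewrite ++-identityʳ K | e = refl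
↓-unique (_ ∷ I-pos) (_∷_ {x = k ∷ K} (ps , refl) Ks⊨) (by-++ {J = J} js)
  rewrite cut-++ k K J ps | ↓-unique I-pos Ks⊨ js = refl
↓-unique (_ ∷ I-pos) (_∷_ {x = k ∷ K} (ps , refl) Ks⊨) (by-▷ {J = J} js)
  with J | Joins-⊨ Ks⊨ js | js
↓-unique (_ ∷ []) (_ ∷ []) _ | _ | _ | ()
↓-unique (_ ∷ (s≤s _) ∷ _) (_ ∷ _ ∷ _) _ | [] | _ , () | _
↓-unique (_ ∷ I-pos) (_∷_ {x = k ∷ K} (ps , refl) Ks⊨) _ | l ∷ L | q ∷ _ , _ | js
  rewrite cut-▷ k K l L ps q | ↓-unique I-pos Ks⊨ js = refl

cut-correct : ∀ i J → 0 < i → All (0 <_) J → i ≤ sum J → let K , L = cut i J in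
  K ⊨ i × L ⊨ (sum J ∸ i) × (K ++ L ≡ J ⊎ K ▷ L ≡ J)
cut-correct (suc i) [] _ _ ()
cut-correct i (j ∷ J) 0<i (p ∷ ps) i≤ with ℕ.<-cmp i j
... | tri< i<j _ _ =
  (0<i ∷ [] , ℕ.+-identityʳ i) ,
  (ℕ.m<n⇒0<n∸m i<j ∷ ps , sym (ℕ.+-∸-comm (sum J) (ℕ.<⇒≤ i<j))) ,
  inj₂ (cong (_∷ J) (ℕ.m+[n∸m]≡n (ℕ.<⇒≤ i<j)))
... | tri≈ _ refl _ = (p ∷ [] , ℕ.+-identityʳ i) , (ps , sym (ℕ.m+n∸m≡n i (sum J))) , inj₁ refl
... | tri> _ _ j<i
  with cut (i ∸ j) J
     | cut-correct (i ∸ j) J (ℕ.m<n⇒0<n∸m j<i) ps (ℕ.m≤n+o⇒m∸n≤o i j i≤)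
...   | [] , L | (_ , e) , _ = contradiction e (ℕ.<⇒≢ (ℕ.m<n⇒0<n∸m j<i))
...   | K@(_ ∷ _) , L | (K-pos , eK) , (L-pos , eL) , split =
  (p ∷ K-pos , trans (cong (j +_) eK) (ℕ.m+[n∸m]≡n (ℕ.<⇒≤ j<i))) ,
  (L-pos , trans eL (sum-∸)) ,
  Sum.map (cong (j ∷_)) (cong (j ∷_)) split
  where
  sum-∸ : sum J ∸ (i ∸ j) ≡ j + sum J ∸ i
  sum-∸ = trans (sym (ℕ.[m+n]∸[m+o]≡n∸o j (sum J) (i ∸ j)))
                (cong (j + sum J ∸_) (ℕ.m+[n∸m]≡n (ℕ.<⇒≤ j<i)))

↓-correct : ∀ {n} i I J → (i ∷ I) ⊨ n → J ⊨ n →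
  Pointwise _⊨_ (J ↓ (i ∷ I)) (i ∷ I) × (J ↓ (i ∷ I)) Joins J
↓-correct i I J (i-pos ∷ I-pos , refl) (J-pos , e)
  with cut i J | cut-correct i J i-pos J-pos (subst (i ≤_) (sym e) (ℕ.m≤m+n i (sum I)))
↓-correct i [] J (i-pos ∷ I-pos , refl) (J-pos , e) | K , L | K⊨ , (L-pos , eL) , split
  with refl ← sum-zero L-pos (trans eL (ℕ.m≤n⇒m∸n≡0 (ℕ.≤-reflexive (trans e (ℕ.+-identityʳ i)))))
  with split
... | inj₁ refl rewrite ++-identityʳ K = K⊨ ∷ [] , single
... | inj₂ refl rewrite ▷-identityʳ K = K⊨ ∷ [] , single
↓-correct i (i′ ∷ I) J (i-pos ∷ I-pos , refl) (J-pos , e) | K , L | K⊨ , (L-pos , eL) , split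
  with ↓-correct i′ I L (I-pos , refl)
         (L-pos , trans eL (trans (cong (_∸ i) e) (ℕ.m+n∸m≡n i (i′ + sum I))))
... | Ks⊨ , js with split
...   | inj₁ refl = K⊨ ∷ Ks⊨ , by-++ js
...   | inj₂ refl = K⊨ ∷ Ks⊨ , by-▷ js

------------------------------------------------------------------------
-- Increasing factors and initially dominated factors

increasingFactors : Word → List (List⁺ ℕ)
increasingFactors []      = []
increasingFactors (x ∷ w) with increasingFactors w
... | []             = (x ∷ []) ∷ []
... | (y ∷ v) ∷ fs with x ℕ.<? y
...   | yes _ = (x ∷ y ∷ v) ∷ fs
...   | no  _ = (x ∷ []) ∷ (y ∷ v) ∷ fs

descentComposition : Word → List ℕ
descentComposition τ = map List⁺.length (increasingFactors τ)

InitiallyDominated : List⁺ ℕ → Set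
InitiallyDominated (x ∷ w) = All (_< x) w

IsDominatedFactorization : Word → List (List⁺ ℕ) → Set
IsDominatedFactorization u fs =
  concatMap List⁺.toList fs ≡ u
  × All InitiallyDominated fs
  × Linked _≤_ (map List⁺.head fs)

-- The rest of the factor with first letter h, then the factors after it.
dominatedFrom : ℕ → Word → Word × List (List⁺ ℕ)
dominatedFrom h []      = [] , []
dominatedFrom h (x ∷ w) with x ℕ.<? h
... | yes _ = let v , fs = dominatedFrom h w in x ∷ v , fs
... | no  _ = let v , fs = dominatedFrom x w in [] , (x ∷ v) ∷ fs

dominatedFactors : Word → List (List⁺ ℕ)
dominatedFactors []      = []
dominatedFactors (x ∷ w) = let v , fs = dominatedFrom x w in (x ∷ v) ∷ fs

dominatedFrom-correct : ∀ h w → let v , fs = dominatedFrom h w in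
  v ++ concatMap List⁺.toList fs ≡ w
  × All (_< h) v
  × All InitiallyDominated fs
  × Linked _≤_ (h ∷ map List⁺.head fs)
dominatedFrom-correct h []      = refl , [] , [] , [-]
dominatedFrom-correct h (x ∷ w) with x ℕ.<? h
... | yes x<h = let e , v<h , fs-dom , fs-inc = dominatedFrom-correct h w
                in cong (x ∷_) e , x<h ∷ v<h , fs-dom , fs-inc
... | no  x≮h = let e , v<x , fs-dom , fs-inc = dominatedFrom-correct x w
                in cong (x ∷_) e , [] , v<x ∷ fs-dom , ℕ.≮⇒≥ x≮h ∷ fs-inc

dominatedFactors-correct : ∀ u → IsDominatedFactorization u (dominatedFactors u)
dominatedFactors-correct []      = refl , [] , []
dominatedFactors-correct (x ∷ w) =
  let e , v<x , fs-dom , fs-inc = dominatedFrom-correct x w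
  in cong (x ∷_) e , v<x ∷ fs-dom , fs-inc

dominatedFrom-unique : ∀ h v fs →
  All (_< h) v → All InitiallyDominated fs → Linked _≤_ (h ∷ map List⁺.head fs) →
  dominatedFrom h (v ++ concatMap List⁺.toList fs) ≡ (v , fs)
dominatedFrom-unique h (x ∷ v) fs (x<h ∷ v<h) fs-dom fs-inc with x ℕ.<? h
... | yes _   rewrite dominatedFrom-unique h v fs v<h fs-dom fs-inc = refl
... | no  x≮h = contradiction x<h x≮h
dominatedFrom-unique h [] []             [] []               [-]            = refl
dominatedFrom-unique h [] ((x ∷ v) ∷ fs) [] (v<x ∷ fs-dom) (h≤x ∷ fs-inc) with x ℕ.<? h
... | yes x<h = contradiction x<h (ℕ.≤⇒≯ h≤x)
... | no  _   rewrite dominatedFrom-unique x v fs v<x fs-dom fs-inc = refl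

dominatedFactors-unique : ∀ {u} fs → IsDominatedFactorization u fs → dominatedFactors u ≡ fs
dominatedFactors-unique []             (refl , _ , _) = refl
dominatedFactors-unique ((x ∷ v) ∷ fs) (refl , v<x ∷ fs-dom , fs-inc)
  rewrite dominatedFrom-unique x v fs v<x fs-dom fs-inc = refl

saillance : Word → List ℕ
saillance σ = map List⁺.length (dominatedFactors σ)

------------------------------------------------------------------------
-- Biwords

-- A word in biletters (color , number).  The genuine biwords are those
-- with positive colors and a permutation as bottom row; Ψ, 𝚿, R and Λ
-- below involve no others.  Arbitrary words in biletters are needed for
-- the brackets defining Ψ.
Biword : Set
Biword = List (ℕ × ℕ)

colors numbers : Biword → Word
colors  = map proj₁
numbers = map proj₂

_≟ᵇ_ : DecidableEquality Biword
_≟ᵇ_ = ≡-dec (Product.≡-dec ℕ._≟_ ℕ._≟_)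

-- The scalar parameter q is an arbitrary element of an arbitrary
-- commutative ring; an indeterminate is the case K = k[q].
module Combinations {c ℓ} (K : CommutativeRing c ℓ) (q : CommutativeRing.Carrier K) where

  open CommutativeRing K public using (Carrier; _≈_; 0#; 1#; -_)
    renaming (_+_ to _+ᴷ_; _*_ to _*ᴷ_)
  open import Algebra.Properties.Semiring.Exp (CommutativeRing.semiring K) public using (_^_)

  -- Formal finite linear combinations: lists of terms, identified by _≋_
  -- when all their coefficients agree.
  Combination : Set c
  Combination = List (Carrier × Biword)

  coefficient : Combination → Biword → Carrier
  coefficient x w = foldr _+ᴷ_ 0# (map proj₁ (filter (λ t → proj₂ t ≟ᵇ w) x))

  infix 4 _≋_
  _≋_ : Combination → Combination → Set ℓ
  x ≋ y = ∀ w → coefficient x w ≈ coefficient y w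

  basis : Biword → Combination
  basis w = [ (1# , w) ]

  infixr 8 _•_
  _•_ : Carrier → Combination → Combination
  k • x = map (λ (a , w) → k *ᴷ a , w) x

  infixl 6 _⊕_
  _⊕_ : Combination → Combination → Combination
  _⊕_ = _++_

  infixr 5 ⨁
  ⨁ : List X → (X → Combination) → Combination
  ⨁ xs f = concatMap f xs

  syntax ⨁ xs (λ x → e) = ⨁[ x ∈ xs ] e

  bilinear : (Biword → Biword → Combination) → Combination → Combination → Combination
  bilinear f x y = concatMap (λ (a , u) → concatMap (λ (b , v) → (a *ᴷ b) • f u v) y) x

  -- Concatenation of words in biletters.
  infixl 7 _·_
  _·_ : Combination → Combination → Combination
  _·_ = bilinear λ u v → basis (u ++ v)

  -- Product of colored free quasi-symmetric functions.
  infixr 7 _⊛_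
  _⊛_ : Combination → Combination → Combination
  _⊛_ = bilinear λ u v → ⨁[ γ ∈ numbers u ∗ numbers v ] basis (zip (colors u ++ colors v) γ)

  [_,_]q : Combination → Combination → Combination
  [ x , y ]q = x · y ⊕ (- q) • (y · x)

  -- bracketFrom i B w brackets B successively with the biletters
  -- (w₁ , i), (w₂ , i + 1), …
  bracketFrom : ℕ → Combination → Word → Combination
  bracketFrom i B []      = B
  bracketFrom i B (x ∷ w) = bracketFrom (suc i) [ B , basis [ (x , i) ] ]q w

  Ψ : List⁺ ℕ → Combination
  Ψ (x ∷ w) = bracketFrom 2 (basis [ (x , 1) ]) w

  𝚿 : Word → Combination
  𝚿 σ = foldr (λ u x → Ψ u ⊛ x) (basis []) (dominatedFactors σ)

  R : ℕ → List ℕ → List ℕ → Combination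
  R n I J =
    ⨁[ τ ∈ filter (λ τ → descentComposition τ ≟ʷ I) (𝔖 n) ]
    ⨁[ σ ∈ filter (λ σ → saillance σ ≟ʷ J) (𝔖 n) ]
    basis (zip σ τ)

  -- The conjugate of the mirror image of I has as descent set the
  -- complement of Des I in {1, …, n − 1}; I′ runs over the compositions
  -- finer than or equal to it.
  Λ : ℕ → List ℕ → List ℕ → Combination
  Λ n I J = ⨁[ I′ ∈ filter (λ I′ → nonDescents ⊆? Des I′) (compositions n) ] R n I′ J
    where
    open DecMembership ℕ._≟_ using (_∈?_)
    open DecSubset ℕ._≟_ using (_⊆?_)

    nonDescents : List ℕ
    nonDescents = filter (λ k → ¬? (k ∈? Des I)) [1‥ n ∸ 1 ]

{-# OPTIONS --safe #-}

-- Compare the coefficients of a biword with colors σ and numbers τ; both vanish unless σ and τ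
-- are permutations.  Expanding the q-brackets, Ψ^u is a sum over valleys: the numbers decrease to
-- their minimum and increase after it, each letter before the minimum costs −q, and reading the
-- colors in the order of the numbers gives u.  So the left coefficient is a sum over the
-- compositions I that cut τ into valleys whose minimum sits at the last record (left-to-right
-- maximum) of σ in its block.  On the right, I contributes if τ decreases on every block, with
-- −1 for each pair of neighbours in a block and q for each letter before the last record of its
-- block.  In both sums a letter before the last record of its block costs −q.  After that
-- record, the right side adds up, with signs, all ways to cut into decreasing blocks: each pair
-- of neighbours contributes 1 − [descent] = [ascent], which is the increasing branch of a valley.
module Submission where

open import Algebra.Bundles using (CommutativeRing)
open import Data.Bool.Base using (Bool; true; false; if_then_else_; _∧_; _∨_; not)
open import Data.Bool.Properties using (∨-identityʳ; ∧-zeroʳ)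
open import Data.List.Base
  using (List; []; _∷_; [_]; _++_; _∷ʳ_; _ʳ++_; map; concatMap; filter; foldr;
         length; zip; take; drop)
import Data.List.Membership.DecPropositional as DecMembership
open import Data.List.Membership.Propositional using (_∈_; _∉_)
open import Data.List.Membership.Propositional.Properties
  using (∈-map⁺; ∈-map⁻; ∈-++⁻; ∈-filter⁺; ∈-filter⁻; ∈-upTo⁺; ∈-upTo⁻; ∈-∃++;
         ∈-cartesianProductWith⁺; ∈-cartesianProductWith⁻)
import Data.List.NonEmpty.Base as List⁺
open List⁺ using (List⁺; _∷_)
open import Data.List.Properties
open import Data.List.Relation.Binary.Permutation.Propositional
  using (_↭_; ↭-refl; ↭-reflexive; ↭-sym; ↭-trans; ↭-prep; ↭⇒↭ₛ)
open import Data.List.Relation.Binary.Permutation.Propositional.Properties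
  using (All-resp-↭; ∈-resp-↭; ↭-length; ↭-empty-inv; map⁺; ++⁺; ++↭ʳ++; shift; drop-∷)
import Data.List.Relation.Binary.Permutation.Setoid.Properties as Permutation
open import Data.List.Relation.Binary.Pointwise using (Pointwise; []; _∷_)
import Data.List.Relation.Binary.Subset.DecPropositional as DecSubset
open import Data.List.Relation.Binary.Subset.Propositional using (_⊆_)
open import Data.List.Relation.Unary.All as All using (All; []; _∷_)
import Data.List.Relation.Unary.All.Properties as All
open import Data.List.Relation.Unary.AllPairs as AllPairs using (AllPairs; []; _∷_)
open import Data.List.Relation.Unary.Any using (here; there)
open import Data.List.Relation.Unary.Linked as Linked using (Linked; []; [-]; _∷_; linked?)
open import Data.List.Relation.Unary.Linked.Properties using (Linked⇒AllPairs)
import Data.List.Relation.Unary.Unique.DecPropositional as DecUnique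
open import Data.List.Relation.Unary.Unique.Propositional using (Unique)
import Data.List.Relation.Unary.Unique.Propositional.Properties as Unique
open import Data.Nat.Base as ℕ using (ℕ; zero; suc; _∸_; _⊔_; _<_; _≤_; s≤s; z≤n)
open import Data.Nat.ListAction using (sum)
import Data.Nat.Properties as ℕ
open import Data.Product.Base using (_×_; _,_; proj₁; proj₂; ∃; ∃₂; map₂)
open import Data.Sum.Base using (inj₁; inj₂)
open import Defs
open import Function.Base using (_∘_; const; id)
open import Function.Bundles using (_⇔_; mk⇔; module Equivalence)
import Level
open import Relation.Binary.Definitions using (DecidableEquality; tri<; tri≈; tri>)
open import Relation.Binary.PropositionalEquality as ≡
  using (_≡_; _≢_; refl; sym; trans; cong; cong₂; subst; subst₂; module ≡-Reasoning)
open import Relation.Nullary.Decidable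
  using (Dec; yes; no; does; dec-true; dec-false; ¬?; _×-dec_)
open import Relation.Nullary.Negation using (¬_; contradiction)
open import Relation.Unary using (Decidable)

open DecMembership ℕ._≟_ using (_∈?_)
open DecMembership _≟ʷ_ using () renaming (_∈?_ to _∈ʷ?_)

-- Scanning a composition along a biword

-- On the right, the factor of a letter joined to its successor is not determined by what precedes
-- it: it is `- q` if a record follows in its block and `- 1#` if none does. So the sum over `I` is
-- split by whether the first block has a record, and the sums over all `I` and over either kind are
-- computed together. A valley of the left side has its minimum at a record, so blocks without a
-- record have no partner there; their total turns out to be the increasing branch of a valley
-- without its ascent test, and it is absorbed into that branch.
--
-- On the left, the coefficients of `Ψ u` do not show whether `u` is initially dominated. Domination
-- enters through the range of summation: permutations with saillance `I` correspond to sequences of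
-- initially dominated words of lengths `I` with weakly increasing heads. For a fixed biword and
-- fixed `I`, inverting the q-brackets leaves at most one sequence of words, and it is dominated
-- exactly if the minimum of each block is its last record.

-- Throughout, a composition I of length w is read along a biword w letter by letter, and M is
-- the largest color read before w, with M = 0 at the start.  A letter with color c is a record if
-- c ≮ M; ties do not occur for permutations.
descends : ℕ → Biword → Bool
descends t []             = false
descends t ((_ , t′) ∷ _) = not (does (t ℕ.<? t′))

decreasing : List ℕ → Biword → Bool
decreasing []                []            = true
decreasing (1 ∷ I)           (_ ∷ w)       = decreasing I w
decreasing (suc (suc k) ∷ I) ((_ , t) ∷ w) = descends t w ∧ decreasing (suc k ∷ I) w
decreasing _                 _             = false

-- Whether the first block has a record.
hasRecord : List ℕ → ℕ → Biword → Bool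
hasRecord []                M _             = true
hasRecord (1 ∷ I)           M ((c , _) ∷ w) = not (does (c ℕ.<? M))
hasRecord (suc (suc k) ∷ I) M ((c , _) ∷ w) = not (does (c ℕ.<? M)) ∨ hasRecord (suc k ∷ I) (M ⊔ c) w
hasRecord _                 M _             = false

-- The number of letters before the last record of their block.
exponent : List ℕ → ℕ → Biword → ℕ
exponent (1 ∷ I)           M ((c , _) ∷ w) = exponent I (M ⊔ c) w
exponent (suc (suc k) ∷ I) M ((c , _) ∷ w) =
  (if hasRecord (suc k ∷ I) (M ⊔ c) w then 1 else 0) ℕ.+ exponent (suc k ∷ I) (M ⊔ c) w
exponent _                 M _             = 0

-- The pairs of neighbours in a common block, hence the exponent n - l(I) of the sign, in a form
-- that follows the scan.
joins : List ℕ → ℕ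
joins (1 ∷ I)           = joins I
joins (suc (suc k) ∷ I) = suc (joins (suc k ∷ I))
joins _                 = 0

joins-∸ : ∀ {n I} → I ⊨ n → joins I ≡ n ∸ length I
joins-∸ {I = I} (ps , refl) = trans (sym (ℕ.m+n∸n≡m (joins I) (length I))) (cong (_∸ length I) (go ps))
  where
  go : ∀ {I} → All (0 <_) I → joins I ℕ.+ length I ≡ sum I
  go []                                = refl
  go {1 ∷ I}           (_ ∷ ps)        = trans (ℕ.+-suc (joins I) (length I)) (cong suc (go ps))
  go {suc (suc k) ∷ I} (_ ∷ ps)        = cong suc (go (s≤s z≤n ∷ ps))

-- Saillance

-- A letter put in front either enlarges the first piece or is a piece of its own. Saillance and
-- descent compositions both grow in this way.
extend : Bool → List ℕ → List ℕ
extend b K = if b then [ 1 ] ▷ K else [ 1 ] ++ K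

-- The lengths of the pieces into which the starts of the dominated factors of a word cut its
-- suffix w.
saillanceFrom : ℕ → Biword → List ℕ
saillanceFrom M []                            = []
saillanceFrom M (_ ∷ [])                      = [ 1 ]
saillanceFrom M ((c , _) ∷ w@((c′ , _) ∷ _)) = extend (does (c′ ℕ.<? M ⊔ c)) (saillanceFrom (M ⊔ c) w)

-- The head of the current dominated factor is the largest letter read so far, so a new factor
-- starts exactly at a record.
saillanceFrom-dominatedFrom : ∀ M c t w → let v , fs = dominatedFrom (M ⊔ c) (colors w) in
  suc (length v) ∷ map List⁺.length fs ≡ saillanceFrom M ((c , t) ∷ w)
saillanceFrom-dominatedFrom M c t []              = refl
saillanceFrom-dominatedFrom M c t ((c′ , t′) ∷ w) with c′ ℕ.<? M ⊔ c | saillanceFrom-dominatedFrom (M ⊔ c) c′ t′ w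
... | yes lt | ih rewrite ℕ.m≥n⇒m⊔n≡m (ℕ.<⇒≤ lt) | dec-true (c′ ℕ.<? M ⊔ c) lt | sym ih = refl
... | no ≮   | ih rewrite ℕ.m≤n⇒m⊔n≡n (ℕ.≮⇒≥ ≮) | dec-false (c′ ℕ.<? M ⊔ c) ≮ | sym ih = refl

saillance-saillanceFrom : ∀ w → saillance (colors w) ≡ saillanceFrom 0 w
saillance-saillanceFrom []            = refl
saillance-saillanceFrom ((c , t) ∷ w) = saillanceFrom-dominatedFrom 0 c t w

extend-⊨ : ∀ b {K n} → K ⊨ n → extend b K ⊨ suc n
extend-⊨ true      K⊨       = ▷-⊨ {[ 1 ]} (s≤s z≤n ∷ [] , refl) K⊨
extend-⊨ false (ps , refl) = s≤s z≤n ∷ ps , refl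

extend-++ : ∀ b k K L → extend b ((k ∷ K) ++ L) ≡ extend b (k ∷ K) ++ L
extend-++ true  k K L = refl
extend-++ false k K L = refl

extend-▷ : ∀ b k K L → extend b ((k ∷ K) ▷ L) ≡ extend b (k ∷ K) ▷ L
extend-▷ true  k []       []      = refl
extend-▷ true  k []       (l ∷ L) = refl
extend-▷ true  k (k′ ∷ K) L       = refl
extend-▷ false k K        L       = refl

extend-Joins : ∀ b {k K Ks J} → ((k ∷ K) ∷ Ks) Joins J → (extend b (k ∷ K) ∷ Ks) Joins extend b J
extend-Joins b             single            = single
extend-Joins b {k} {K} {Ks} (by-++ {J = J} js) =
  subst ((extend b (k ∷ K) ∷ Ks) Joins_) (sym (extend-++ b k K J)) (by-++ js)
extend-Joins b {k} {K} {Ks} (by-▷ {J = J} js)  =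
  subst ((extend b (k ∷ K) ∷ Ks) Joins_) (sym (extend-▷ b k K J)) (by-▷ js)

long : List ℕ → Bool
long (_ ∷ _ ∷ _) = true
long _           = false

long-extend : ∀ b k K → not b ∨ long (k ∷ K) ≡ long (extend b (k ∷ K))
long-extend true  k []      = refl
long-extend true  k (_ ∷ _) = refl
long-extend false k K       = refl

-- A letter put in front of a block is counted once: by `exponent` if a record follows in the block,
-- otherwise by the last part, which is then the whole block.
lastPart-extend : ∀ b k K →
  lastPart (extend b (k ∷ K)) ℕ.+ (if not b ∨ long (k ∷ K) then 1 else 0) ≡ suc (lastPart (k ∷ K))
lastPart-extend true  k []      = ℕ.+-identityʳ (suc k)
lastPart-extend true  k (_ ∷ _) = ℕ.+-comm _ 1
lastPart-extend false k K       = ℕ.+-comm _ 1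

-- first ∷ rest and others are the terms of saillanceFrom M ((c , t) ∷ w) ↓ (i ∷ I); the first
-- has several parts exactly if a later letter of its block is a record.
record Splitting (i : ℕ) (I : List ℕ) (M c t : ℕ) (w : Biword) : Set where
  field
    first    : ℕ
    rest     : List ℕ
    others   : List (List ℕ)
    isComp   : Pointwise _⊨_ ((first ∷ rest) ∷ others) (i ∷ I)
    isJoin   : ((first ∷ rest) ∷ others) Joins saillanceFrom M ((c , t) ∷ w)
    record?  : hasRecord (i ∷ I) M ((c , t) ∷ w) ≡ not (does (c ℕ.<? M)) ∨ long (first ∷ rest)
    exponent-+ : sum (map lastPart ((first ∷ rest) ∷ others)) ℕ.+ exponent (i ∷ I) M ((c , t) ∷ w)
               ≡ sum (i ∷ I)

-- Built along the scan. Where `I` cuts, the pieces are rejoined by `▷` if the next letter continues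
-- a dominated factor and by concatenation if it starts one.
splitting : ∀ {i I} M c t w → (i ∷ I) ⊨ suc (length w) → Splitting i I M c t w
splitting {1} {[]} M c t [] _ = record
  { first = 1 ; rest = [] ; others = []
  ; isComp = (s≤s z≤n ∷ [] , refl) ∷ [] ; isJoin = single
  ; record? = sym (∨-identityʳ _) ; exponent-+ = refl }
splitting {1} {[]} M c t (_ ∷ _) (_ , ())
splitting {1} {i ∷ I} M c t [] (_ ∷ s≤s _ ∷ _ , ())
splitting {1} {i ∷ I} M c t ((c′ , t′) ∷ w) (_ ∷ ps , e) = record
  { first = 1 ; rest = [] ; others = (S.first ∷ S.rest) ∷ S.others
  ; isComp = (s≤s z≤n ∷ [] , refl) ∷ S.isComp
  ; isJoin = join (does (c′ ℕ.<? M ⊔ c))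
  ; record? = sym (∨-identityʳ _)
  ; exponent-+ = cong suc S.exponent-+ }
  where
  module S = Splitting (splitting {i} {I} (M ⊔ c) c′ t′ w (ps , ℕ.suc-injective e))
  join : ∀ b → ([ 1 ] ∷ (S.first ∷ S.rest) ∷ S.others) Joins extend b (saillanceFrom (M ⊔ c) ((c′ , t′) ∷ w))
  join true  = by-▷ S.isJoin
  join false = by-++ S.isJoin
splitting {suc (suc k)} {I} M c t [] (_ , ())
splitting {suc (suc k)} {I} M c t ((c′ , t′) ∷ w) (_ ∷ ps , e)
  with splitting {suc k} {I} (M ⊔ c) c′ t′ w (s≤s z≤n ∷ ps , ℕ.suc-injective e)
... | record { first = f ; rest = K ; others = Ks ; isComp = K⊨ ∷ Ks⊨ ; isJoin = js ; record? = r ; exponent-+ = ex }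
  with extend (does (c′ ℕ.<? M ⊔ c)) (f ∷ K)
     | extend-⊨ (does (c′ ℕ.<? M ⊔ c)) K⊨
     | extend-Joins (does (c′ ℕ.<? M ⊔ c)) js
     | long-extend (does (c′ ℕ.<? M ⊔ c)) f K
     | lastPart-extend (does (c′ ℕ.<? M ⊔ c)) f K
... | [] | _ , () | _ | _ | _
... | g ∷ G | G⊨ | js′ | l | p = record
  { first = g ; rest = G ; others = Ks
  ; isComp = G⊨ ∷ Ks⊨
  ; isJoin = js′
  ; record? = cong (not (does (c ℕ.<? M)) ∨_) (trans r l)
  ; exponent-+ = begin
      (lastPart (g ∷ G) ℕ.+ S) ℕ.+ ((if hasRecord (suc k ∷ I) (M ⊔ c) ((c′ , t′) ∷ w) then 1 else 0) ℕ.+ E)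
        ≡⟨ cong (λ b → (lastPart (g ∷ G) ℕ.+ S) ℕ.+ ((if b then 1 else 0) ℕ.+ E)) r ⟩
      (lastPart (g ∷ G) ℕ.+ S) ℕ.+ (o ℕ.+ E)
        ≡⟨ swap₂ (lastPart (g ∷ G)) S o E ⟩
      (lastPart (g ∷ G) ℕ.+ o) ℕ.+ (S ℕ.+ E)
        ≡⟨ cong (ℕ._+ (S ℕ.+ E)) p ⟩
      suc (lastPart (f ∷ K)) ℕ.+ (S ℕ.+ E)
        ≡⟨ cong suc (sym (ℕ.+-assoc (lastPart (f ∷ K)) S E)) ⟩
      suc ((lastPart (f ∷ K) ℕ.+ S) ℕ.+ E)
        ≡⟨ cong suc ex ⟩
      suc (suc k ℕ.+ sum I) ∎ }
  where
  open ≡-Reasoning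
  open import Algebra.Properties.CommutativeSemigroup ℕ.+-commutativeSemigroup using () renaming (interchange to swap₂)
  S = sum (map lastPart Ks)
  E = exponent (suc k ∷ I) (M ⊔ c) ((c′ , t′) ∷ w)
  o = if not (does (c′ ℕ.<? M ⊔ c)) ∨ long (f ∷ K) then 1 else 0

saillance-⊨ : ∀ w → saillance (colors w) ⊨ length w
saillance-⊨ []              = [] , refl
saillance-⊨ w@((c , t) ∷ w′) = subst₂ _⊨_ (sym (saillance-saillanceFrom w)) n+0 (Joins-⊨ S.isComp S.isJoin)
  where
  n+0 = cong suc (ℕ.+-identityʳ (length w′))
  module S = Splitting (splitting 0 c t w′ (s≤s z≤n ∷ [] , n+0))

-- Dominated factors start at records, so the last part of a block counts its letters from the last
-- record on, or all of them if its only possible record is the first letter. The pieces found by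
-- `splitting` are those of `↓` by uniqueness.
D-exponent : ∀ I w → I ⊨ length w → D I (saillance (colors w)) ≡ exponent I 0 w
D-exponent []      w  (_ , e)             = refl
D-exponent (i ∷ I) [] (s≤s _ ∷ _ , ())
D-exponent (i ∷ I) w@((c , t) ∷ w′) I⊨ = begin
  D (i ∷ I) (saillance (colors w))                       ≡⟨ cong (D (i ∷ I)) (saillance-saillanceFrom w) ⟩
  sum (i ∷ I) ∸ sum (map lastPart (saillanceFrom 0 w ↓ (i ∷ I))) ≡⟨ cong (λ Ks → sum (i ∷ I) ∸ sum (map lastPart Ks))
                                                                (↓-unique (proj₁ I⊨) S.isComp S.isJoin) ⟩
  sum (i ∷ I) ∸ L                                        ≡⟨ cong (_∸ L) (sym S.exponent-+) ⟩
  L ℕ.+ E ∸ L                                              ≡⟨ ℕ.m+n∸m≡n L E ⟩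
  E                                                      ∎
  where
  open ≡-Reasoning
  module S = Splitting (splitting 0 c t w′ I⊨)
  L = sum (map lastPart ((S.first ∷ S.rest) ∷ S.others))
  E = exponent (i ∷ I) 0 w

-- Descents

increasingFactors-∷ : ∀ x w → ∃₂ λ v fs → increasingFactors (x ∷ w) ≡ (x ∷ v) ∷ fs
increasingFactors-∷ x w with increasingFactors w
... | []             = _ , _ , refl
... | (y ∷ v) ∷ fs with x ℕ.<? y
...   | yes _ = _ , _ , refl
...   | no  _ = _ , _ , refl

descentComposition-∷ : ∀ x y w →
  descentComposition (x ∷ y ∷ w) ≡ extend (does (x ℕ.<? y)) (descentComposition (y ∷ w))
descentComposition-∷ x y w with increasingFactors (y ∷ w) | increasingFactors-∷ y w
... | _ | v , fs , refl with x ℕ.<? y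
...   | yes x<y rewrite dec-true (x ℕ.<? y) x<y = refl
...   | no x≮y  rewrite dec-false (x ℕ.<? y) x≮y = refl

descentComposition-⊨ : ∀ w → descentComposition w ⊨ length w
descentComposition-⊨ []          = [] , refl
descentComposition-⊨ (x ∷ [])    = s≤s z≤n ∷ [] , refl
descentComposition-⊨ (x ∷ y ∷ w) = subst (_⊨ _) (sym (descentComposition-∷ x y w))
  (extend-⊨ (does (x ℕ.<? y)) (descentComposition-⊨ (y ∷ w)))

Des-suc : ∀ i I → Des (suc i ∷ I) ≡ map suc (Des (i ∷ I))
Des-suc i []      = refl
Des-suc i (j ∷ I) = cong (suc i ∷_) (map-∘ (Des (j ∷ I)))

0∉Des : ∀ i I → 0 ∉ Des (suc i ∷ I)
0∉Des i []      ()
0∉Des i (j ∷ I) (there 0∈) with () ← ∈-map⁻ (suc i ℕ.+_) 0∈ .proj₂ .proj₂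

nonDescents : ℕ → List ℕ → List ℕ
nonDescents n I = filter (λ k → ¬? (k ∈? Des I)) [1‥ n ∸ 1 ]

descents : Biword → List ℕ
descents w = Des (descentComposition (numbers w))

descents-∷ : ∀ c t c′ t′ w → descents ((c , t) ∷ (c′ , t′) ∷ w)
  ≡ (if does (t ℕ.<? t′) then map suc (descents ((c′ , t′) ∷ w)) else 1 ∷ map suc (descents ((c′ , t′) ∷ w)))
descents-∷ c t c′ t′ w rewrite descentComposition-∷ t t′ (numbers w)
  with descentComposition (t′ ∷ numbers w) | descentComposition-⊨ (t′ ∷ numbers w) | does (t ℕ.<? t′)
... | []    | _ , () | _
... | k ∷ K | _      | true  = Des-suc k K
... | k ∷ K | _      | false = refl

0∉descents : ∀ w → 0 ∉ descents w
0∉descents []          ()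
0∉descents (_ ∷ [])    ()
0∉descents ((c , t) ∷ (c′ , t′) ∷ w) 0∈ rewrite descents-∷ c t c′ t′ w with does (t ℕ.<? t′)
... | true  with () ← ∈-map⁻ suc 0∈ .proj₂ .proj₂
0∉descents ((c , t) ∷ (c′ , t′) ∷ w) (there 0∈) | false with () ← ∈-map⁻ suc 0∈ .proj₂ .proj₂

suc∈map-suc : ∀ {k xs} → suc k ∈ map suc xs → k ∈ xs
suc∈map-suc k∈ with ∈-map⁻ suc k∈
... | _ , k′∈ , refl = k′∈

-- The inclusion that selects the terms of `Λ`, with positions bounded by inequalities so that it
-- can be shifted by one letter.
NonDescents⊆ : List ℕ → List ℕ → ℕ → Set
NonDescents⊆ I S n = ∀ k → 0 < k → k < n → k ∉ Des I → k ∈ S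

nonDescents-⊆ : ∀ n I S → nonDescents n I ⊆ S ⇔ NonDescents⊆ I S n
nonDescents-⊆ n I S = mk⇔
  (λ sub k 0<k k<n k∉ → sub (∈-filter⁺ (λ k → ¬? (k ∈? Des I)) (in-range 0<k k<n) k∉))
  λ sub {_} k∈ → let
      k∈r , k∉  = ∈-filter⁻ (λ k → ¬? (k ∈? Des I)) {xs = [1‥ n ∸ 1 ]} k∈
      0<k , k<n = range-in {n} k∈r
    in sub _ 0<k k<n k∉
  where
  in-range : ∀ {k} → 0 < k → k < n → k ∈ [1‥ n ∸ 1 ]
  in-range {suc k} (s≤s _) (s≤s k<n) = ∈-map⁺ suc (∈-upTo⁺ k<n)
  range-in : ∀ {n k} → k ∈ [1‥ n ∸ 1 ] → 0 < k × k < n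
  range-in {n = zero}  ()
  range-in {n = suc n} k∈ with ∈-map⁻ suc k∈
  ... | _ , k′∈ , refl = s≤s z≤n , s≤s (∈-upTo⁻ k′∈)

NonDescents⊆-1 : ∀ i I c t c′ t′ w → let w₁ = (c′ , t′) ∷ w ; w₀ = (c , t) ∷ w₁ in
  decreasing (i ∷ I) w₁ ≡ true ⇔ NonDescents⊆ (i ∷ I) (descents w₁) (length w₁) →
  decreasing (1 ∷ i ∷ I) w₀ ≡ true ⇔ NonDescents⊆ (1 ∷ i ∷ I) (descents w₀) (length w₀)
NonDescents⊆-1 i I c t c′ t′ w ih = mk⇔
  (λ d → λ { 1             _ _         k∉ → contradiction (here refl) k∉
           ; (suc (suc k)) _ (s≤s k<n) k∉ → up (Equivalence.to ih d _ (s≤s z≤n) k<n (k∉ ∘ there ∘ ∈-map⁺ suc)) })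
  (λ sub → Equivalence.from ih λ { (suc k) 0<k k<n k∉ → down (sub _ (s≤s z≤n) (s≤s k<n)
     λ { (there k∈) → k∉ (suc∈map-suc k∈) }) })
  where
  up : ∀ {k} → suc k ∈ descents ((c′ , t′) ∷ w) → suc (suc k) ∈ descents ((c , t) ∷ (c′ , t′) ∷ w)
  up k∈ rewrite descents-∷ c t c′ t′ w with does (t ℕ.<? t′)
  ... | true  = ∈-map⁺ suc k∈
  ... | false = there (∈-map⁺ suc k∈)

  down : ∀ {k} → suc (suc k) ∈ descents ((c , t) ∷ (c′ , t′) ∷ w) → suc k ∈ descents ((c′ , t′) ∷ w)
  down k∈ rewrite descents-∷ c t c′ t′ w with does (t ℕ.<? t′)
  ... | true  = suc∈map-suc k∈
  down (there k∈) | false = suc∈map-suc k∈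

NonDescents⊆-suc : ∀ i I c t c′ t′ w → let w₁ = (c′ , t′) ∷ w ; w₀ = (c , t) ∷ w₁ in
  decreasing (suc i ∷ I) w₁ ≡ true ⇔ NonDescents⊆ (suc i ∷ I) (descents w₁) (length w₁) →
  decreasing (suc (suc i) ∷ I) w₀ ≡ true ⇔ NonDescents⊆ (suc (suc i) ∷ I) (descents w₀) (length w₀)
NonDescents⊆-suc i I c t c′ t′ w ih
  rewrite Des-suc (suc i) I | descents-∷ c t c′ t′ w with does (t ℕ.<? t′)
-- At an ascent both sides fail: position 1 lies inside the first block without being a descent.
... | true  = mk⇔ (λ ())
  λ sub → contradiction (suc∈map-suc (sub _ (s≤s z≤n) (s≤s (s≤s z≤n)) (0∉Des i I ∘ suc∈map-suc)))
                        (0∉descents ((c′ , t′) ∷ w))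
... | false = mk⇔
  (λ d → λ { 1             _ _         _  → here refl
           ; (suc (suc k)) _ (s≤s k<n) k∉ → there (∈-map⁺ suc (Equivalence.to ih d _ (s≤s z≤n) k<n (k∉ ∘ ∈-map⁺ suc))) })
  (λ sub → Equivalence.from ih λ { (suc k) 0<k k<n k∉ → down (sub _ (s≤s z≤n) (s≤s k<n) (k∉ ∘ suc∈map-suc)) })
  where
  down : ∀ {k} → suc (suc k) ∈ 1 ∷ map suc (descents ((c′ , t′) ∷ w)) → suc k ∈ descents ((c′ , t′) ∷ w)
  down (there k∈) = suc∈map-suc k∈

-- The positions outside `Des I` are those between neighbours in a common block, and each of them is
-- required to be a descent.
decreasing-NonDescents⊆ : ∀ I w → I ⊨ length w →
  decreasing I w ≡ true ⇔ NonDescents⊆ I (descents w) (length w)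
decreasing-NonDescents⊆ []          []      _        = mk⇔ (λ _ _ _ ()) (λ _ → refl)
decreasing-NonDescents⊆ []          (_ ∷ _) (_ , ())
decreasing-NonDescents⊆ (suc i ∷ I) []      (_ , ())
decreasing-NonDescents⊆ (zero ∷ I)  _       (() ∷ _ , _)
decreasing-NonDescents⊆ (1 ∷ [])    (_ ∷ []) _ =
  mk⇔ (λ { _ _ (s≤s _) (s≤s ()) }) (λ _ → refl)
decreasing-NonDescents⊆ (1 ∷ [])    (_ ∷ _ ∷ _) (_ , ())
decreasing-NonDescents⊆ (1 ∷ _ ∷ _) (_ ∷ [])    (_ ∷ s≤s _ ∷ _ , ())
decreasing-NonDescents⊆ (suc (suc k) ∷ I) (_ ∷ []) (_ , ())
decreasing-NonDescents⊆ (1 ∷ i ∷ I) ((c , t) ∷ (c′ , t′) ∷ w) (_ ∷ ps , e) =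
  NonDescents⊆-1 i I c t c′ t′ w
    (decreasing-NonDescents⊆ (i ∷ I) ((c′ , t′) ∷ w) (ps , ℕ.suc-injective e))
decreasing-NonDescents⊆ (suc (suc i) ∷ I) ((c , t) ∷ (c′ , t′) ∷ w) (_ ∷ ps , e) =
  NonDescents⊆-suc i I c t c′ t′ w
    (decreasing-NonDescents⊆ (suc i ∷ I) ((c′ , t′) ∷ w) (s≤s z≤n ∷ ps , ℕ.suc-injective e))

-- Permutations

wordsOver-complete : ∀ A {w} → All (_∈ A) w → w ∈ wordsOver A (length w)
wordsOver-complete A []       = here refl
wordsOver-complete A (a ∷ as) = ∈-cartesianProductWith⁺ _∷_ a (wordsOver-complete A as)

wordsOver-sound : ∀ A n {w} → w ∈ wordsOver A n → All (_∈ A) w × length w ≡ n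
wordsOver-sound A zero    (here refl) = [] , refl
wordsOver-sound A (suc n) w∈ with ∈-cartesianProductWith⁻ _∷_ A (wordsOver A n) w∈
... | _ , _ , a∈ , w′∈ , refl = let as , e = wordsOver-sound A n w′∈ in a∈ ∷ as , cong suc e

wordsOver-unique : ∀ {A} n → Unique A → Unique (wordsOver A n)
wordsOver-unique zero    uniq = [] ∷ []
wordsOver-unique (suc n) uniq =
  Unique.cartesianProductWith⁺ _∷_ ∷-injective uniq (wordsOver-unique n uniq)

𝔖-unique : ∀ n → Unique (𝔖 n)
𝔖-unique n = Unique.filter⁺ (DecUnique.unique? ℕ._≟_)
  (wordsOver-unique n (Unique.map⁺ ℕ.suc-injective (Unique.upTo⁺ n)))

∈𝔖⁺ : ∀ {n w} → Unique w → All (_∈ [1‥ n ]) w → length w ≡ n → w ∈ 𝔖 n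
∈𝔖⁺ uniq ps refl = ∈-filter⁺ (DecUnique.unique? ℕ._≟_) (wordsOver-complete _ ps) uniq

∈𝔖⁻ : ∀ n {w} → w ∈ 𝔖 n → Unique w × All (_∈ [1‥ n ]) w × length w ≡ n
∈𝔖⁻ n w∈ with ∈-filter⁻ (DecUnique.unique? ℕ._≟_) {xs = wordsOver [1‥ n ] n} w∈
... | w∈′ , uniq = uniq , wordsOver-sound _ n w∈′

∈𝔖-length : ∀ n {w} → w ∈ 𝔖 n → length w ≡ n
∈𝔖-length n w∈ = proj₂ (proj₂ (∈𝔖⁻ n w∈))

Unique-resp-↭ : ∀ {a} {A : Set a} {xs ys : List A} → xs ↭ ys → Unique xs → Unique ys
Unique-resp-↭ p = Permutation.Unique-resp-↭ (≡.setoid _) (↭⇒↭ₛ p)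

∈𝔖-resp-↭ : ∀ n {v w} → v ↭ w → v ∈ 𝔖 n → w ∈ 𝔖 n
∈𝔖-resp-↭ n p v∈ with ∈𝔖⁻ n v∈
... | uniq , ps , e = ∈𝔖⁺ (Unique-resp-↭ p uniq) (All-resp-↭ p ps) (trans (sym (↭-length p)) e)

zip-colors-numbers : ∀ w → zip (colors w) (numbers w) ≡ w
zip-colors-numbers []      = refl
zip-colors-numbers (b ∷ w) = cong (b ∷_) (zip-colors-numbers w)

colors-zip : ∀ u v → length u ≡ length v → colors (zip u v) ≡ u
colors-zip []      []      _ = refl
colors-zip (x ∷ u) (y ∷ v) e = cong (x ∷_) (colors-zip u v (ℕ.suc-injective e))

numbers-zip : ∀ u v → length u ≡ length v → numbers (zip u v) ≡ v
numbers-zip []      []      _ = refl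
numbers-zip (x ∷ u) (y ∷ v) e = cong (y ∷_) (numbers-zip u v (ℕ.suc-injective e))

-- Pigeonhole, by removing the first entry of `xs` from both lists.
Unique-⊆⇒↭ : ∀ {a} {A : Set a} {xs ys : List A} →
             Unique xs → xs ⊆ ys → length ys ≤ length xs → xs ↭ ys
Unique-⊆⇒↭ {xs = []}     {[]} _ _ _ = ↭-refl
Unique-⊆⇒↭ {xs = x ∷ xs} (x∉ ∷ uniq) sub len with ∈-∃++ (sub (here refl))
... | us , vs , refl = ↭-trans (↭-prep x (Unique-⊆⇒↭ uniq sub′ len′)) (↭-sym (shift x us vs))
  where
  sub′ : xs ⊆ us ++ vs
  sub′ y∈ with ∈-resp-↭ (shift x us vs) (sub (there y∈))
  ... | here refl = contradiction refl (All.lookup x∉ y∈)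
  ... | there y∈′ = y∈′
  len′ : length (us ++ vs) ≤ length xs
  len′ = ℕ.≤-pred (subst (_≤ _) (↭-length (shift x us vs)) len)

-- Standardization

rank : Word → ℕ → ℕ
rank w a = length (filter (ℕ._≤? a) w)

rank-mono-≤ : ∀ w {a b} → a ≤ b → rank w a ≤ rank w b
rank-mono-≤ []      a≤b = z≤n
rank-mono-≤ (x ∷ w) {a} {b} a≤b with x ℕ.≤? a | x ℕ.≤? b
... | yes x≤a | yes x≤b rewrite dec-true (x ℕ.≤? a) x≤a | dec-true (x ℕ.≤? b) x≤b = s≤s (rank-mono-≤ w a≤b)
... | yes x≤a | no x≰b  = contradiction (ℕ.≤-trans x≤a a≤b) x≰b
... | no x≰a  | yes x≤b rewrite dec-false (x ℕ.≤? a) x≰a | dec-true (x ℕ.≤? b) x≤b = ℕ.m≤n⇒m≤1+n (rank-mono-≤ w a≤b)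
... | no x≰a  | no x≰b  rewrite dec-false (x ℕ.≤? a) x≰a | dec-false (x ℕ.≤? b) x≰b = rank-mono-≤ w a≤b

rank-mono-< : ∀ {w a b} → b ∈ w → a < b → rank w a < rank w b
rank-mono-< {x ∷ w} {a} {b} (here refl) a<b
  rewrite dec-false (b ℕ.≤? a) (ℕ.<⇒≱ a<b) | dec-true (b ℕ.≤? b) ℕ.≤-refl = s≤s (rank-mono-≤ w (ℕ.<⇒≤ a<b))
rank-mono-< {x ∷ w} {a} {b} (there b∈) a<b with x ℕ.≤? a | x ℕ.≤? b
... | yes x≤a | yes x≤b rewrite dec-true (x ℕ.≤? a) x≤a | dec-true (x ℕ.≤? b) x≤b = s≤s (rank-mono-< b∈ a<b)
... | yes x≤a | no x≰b  = contradiction (ℕ.≤-trans x≤a (ℕ.<⇒≤ a<b)) x≰b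
... | no x≰a  | yes x≤b rewrite dec-false (x ℕ.≤? a) x≰a | dec-true (x ℕ.≤? b) x≤b = ℕ.m≤n⇒m≤1+n (rank-mono-< b∈ a<b)
... | no x≰a  | no x≰b  rewrite dec-false (x ℕ.≤? a) x≰a | dec-false (x ℕ.≤? b) x≰b = rank-mono-< b∈ a<b

MonotoneOn : Word → (ℕ → ℕ) → Set
MonotoneOn w f = ∀ {a b} → a ∈ w → b ∈ w → a < b → f a < f b

MonotoneOn-reflects : ∀ {w f a b} → MonotoneOn w f → a ∈ w → b ∈ w → f a < f b → a < b
MonotoneOn-reflects {f = f} {a} {b} mono a∈ b∈ fa<fb with ℕ.<-cmp a b
... | tri< a<b _ _  = a<b
... | tri≈ _ refl _ = contradiction fa<fb (ℕ.n≮n (f a))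
... | tri> _ _ b<a  = contradiction fa<fb (ℕ.<⇒≯ (mono b∈ a∈ b<a))

MonotoneOn-≤ : ∀ {w f a b} → MonotoneOn w f → a ∈ w → b ∈ w → a ≤ b → f a ≤ f b
MonotoneOn-≤ mono a∈ b∈ a≤b with ℕ.m≤n⇒m<n∨m≡n a≤b
... | inj₁ a<b  = ℕ.<⇒≤ (mono a∈ b∈ a<b)
... | inj₂ refl = ℕ.≤-refl

rank-monotone : ∀ w → MonotoneOn w (rank w)
rank-monotone w _ b∈ = rank-mono-< b∈

rank-map : ∀ {w f a} v → MonotoneOn w f → v ⊆ w → a ∈ w → rank (map f v) (f a) ≡ rank v a
rank-map             []      mono sub a∈ = refl
rank-map {f = f} {a} (x ∷ v) mono sub a∈ with x ℕ.≤? a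
... | yes x≤a rewrite dec-true (f x ℕ.≤? f a) (MonotoneOn-≤ mono (sub (here refl)) a∈ x≤a) | dec-true (x ℕ.≤? a) x≤a =
  cong suc (rank-map v mono (sub ∘ there) a∈)
... | no x≰a rewrite dec-false (f x ℕ.≤? f a) (ℕ.<⇒≱ (mono a∈ (sub (here refl)) (ℕ.≰⇒> x≰a)))
                   | dec-false (x ℕ.≤? a) x≰a =
  rank-map v mono (sub ∘ there) a∈

stdᵇ : Biword → Biword
stdᵇ w = map (map₂ (rank (numbers w))) w

numbers-map₂ : ∀ f (w : Biword) → numbers (map (map₂ f) w) ≡ map f (numbers w)
numbers-map₂ f w = trans (sym (map-∘ w)) (map-∘ w)

numbers-stdᵇ : ∀ w → numbers (stdᵇ w) ≡ std (numbers w)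
numbers-stdᵇ w = numbers-map₂ (rank (numbers w)) w

colors-stdᵇ : ∀ w → colors (stdᵇ w) ≡ colors w
colors-stdᵇ w = sym (map-∘ w)

-- Standardization depends on the relative order of the numbers only.
stdᵇ-map : ∀ {w f} v → MonotoneOn w f → numbers v ⊆ w → stdᵇ (map (map₂ f) v) ≡ stdᵇ v
stdᵇ-map {w} {f} v mono sub = begin
  map (map₂ (rank (numbers (map (map₂ f) v)))) (map (map₂ f) v)
    ≡⟨ sym (map-∘ v) ⟩
  map (λ (c , t) → c , rank (numbers (map (map₂ f) v)) (f t)) v
    ≡⟨ map-cong-local (All.tabulate λ {(c , t)} x∈ → cong (c ,_)
         (trans (cong (λ u → rank u (f t)) (numbers-map₂ f v))
                (rank-map (numbers v) mono sub (sub (∈-map⁺ proj₂ x∈))))) ⟩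
  map (map₂ (rank (numbers v))) v ∎
  where open ≡-Reasoning

numbers-take : ∀ k (w : Biword) → numbers (take k w) ⊆ numbers w
numbers-take (suc k) (b ∷ w) (here refl) = here refl
numbers-take (suc k) (b ∷ w) (there a∈)  = there (numbers-take k w a∈)

numbers-drop : ∀ k (w : Biword) → numbers (drop k w) ⊆ numbers w
numbers-drop zero    w       a∈ = a∈
numbers-drop (suc k) (b ∷ w) a∈ = there (numbers-drop k w a∈)

-- Ranks taken in all of `w` order a prefix as its own numbers do. Thus the nested standardizations
-- of an iterated product collapse to one for each factor.
stdᵇ-take : ∀ k w → stdᵇ (take k (stdᵇ w)) ≡ stdᵇ (take k w)
stdᵇ-take k w = trans (cong stdᵇ (take-map k w))
  (stdᵇ-map (take k w) (rank-monotone (numbers w)) (numbers-take k w))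

stdᵇ-drop : ∀ k w → stdᵇ (drop k (stdᵇ w)) ≡ stdᵇ (drop k w)
stdᵇ-drop k w = trans (cong stdᵇ (drop-map k w))
  (stdᵇ-map (drop k w) (rank-monotone (numbers w)) (numbers-drop k w))

std-∈𝔖 : ∀ {w} → Unique w → std w ∈ 𝔖 (length w)
std-∈𝔖 {w} uniq = ∈𝔖⁺ (go uniq λ a∈ → a∈)
  (All.map⁺ (All.tabulate in-range)) (length-map (rank w) w)
  where
  go : ∀ {v} → Unique v → v ⊆ w → Unique (map (rank w) v)
  go []               sub = []
  go {a ∷ v} (a∉ ∷ uniq) sub = All.map⁺ (All.tabulate λ {b} b∈ e → different b∈ e) ∷ go uniq (sub ∘ there)
    where
    different : ∀ {b} → b ∈ v → rank w a ≢ rank w b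
    different {b} b∈ e with ℕ.<-cmp a b
    ... | tri< a<b _ _ = contradiction e (ℕ.<⇒≢ (rank-mono-< (sub (there b∈)) a<b))
    ... | tri≈ _ a≡b _ = All.lookup a∉ b∈ a≡b
    ... | tri> _ _ b<a = contradiction (sym e) (ℕ.<⇒≢ (rank-mono-< (sub (here refl)) b<a))

  positive : ∀ {w a} → a ∈ w → 0 < rank w a
  positive {x ∷ w} {a} (here refl) rewrite dec-true (a ℕ.≤? a) ℕ.≤-refl = s≤s z≤n
  positive {x ∷ w} {a} (there a∈) with does (x ℕ.≤? a)
  ... | true  = s≤s z≤n
  ... | false = positive a∈

  in-range : ∀ {a} → a ∈ w → rank w a ∈ [1‥ length w ]
  in-range {a} a∈ with rank w a | positive a∈ | length-filter (ℕ._≤? a) w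
  ... | suc r | _ | r<n = ∈-map⁺ suc (∈-upTo⁺ r<n)

-- Valleys

-- Valley L b R s : s is the reverse of L, then b, then R, with numbers decreasing up to b and
-- increasing from there on.
data Valley : Biword → ℕ × ℕ → Biword → Biword → Set where
  up   : ∀ {b R} → Linked _<_ (numbers (b ∷ R)) → Valley [] b R (b ∷ R)
  down : ∀ {L b R x y s} → proj₂ y < proj₂ x → Valley L b R (y ∷ s) → Valley (L ∷ʳ x) b R (x ∷ y ∷ s)

IsValley : Biword → Set
IsValley s = ∃ λ L → ∃ λ b → ∃ λ R → Valley L b R s

isValley? : ∀ {s} → s ≢ [] → Unique (numbers s) → Dec (IsValley s)
isValley? {[]}        ne _ = contradiction refl ne
isValley? {x ∷ []}    ne _ = yes (_ , _ , _ , up [-])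
isValley? {x ∷ y ∷ s} ne ((x≢y ∷ _) ∷ uniq) with ℕ.<-cmp (proj₂ x) (proj₂ y)
... | tri≈ _ x≡y _ = contradiction x≡y x≢y
... | tri> x≮y _ y<x with isValley? (λ ()) uniq
...   | yes (_ , _ , _ , v) = yes (_ , _ , _ , down y<x v)
...   | no ¬v = no λ { (_ , _ , _ , up (x<y ∷ _)) → x≮y x<y ; (_ , _ , _ , down _ v) → ¬v (_ , _ , _ , v) }
isValley? {x ∷ y ∷ s} ne _ | tri< x<y _ y≮x with linked? ℕ._<?_ (numbers (x ∷ y ∷ s))
...   | yes inc = yes (_ , _ , _ , up inc)
...   | no ¬inc = no λ { (_ , _ , _ , up inc) → ¬inc inc ; (_ , _ , _ , down y<x _) → y≮x y<x }

Valley-map : ∀ {w f s L b R} → MonotoneOn w f → numbers s ⊆ w → Valley L b R s →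
  Valley (map (map₂ f) L) (map₂ f b) (map (map₂ f) R) (map (map₂ f) s)
Valley-map {w} {f} {s} mono sub (up inc) = up (go s sub inc)
  where
  go : ∀ s → numbers s ⊆ w → Linked _<_ (numbers s) → Linked _<_ (numbers (map (map₂ f) s))
  go []          sub []          = []
  go (x ∷ [])    sub [-]         = [-]
  go (x ∷ y ∷ s) sub (x<y ∷ inc) =
    mono (sub (here refl)) (sub (there (here refl))) x<y ∷ go (y ∷ s) (sub ∘ there) inc
Valley-map {f = f} mono sub (down {L} {b} {R} {x} {y} {s} y<x v) =
  subst (λ L → Valley L _ _ _) (sym (map-++ (map₂ f) L _))
    (down (mono (sub (there (here refl))) (sub (here refl)) y<x) (Valley-map mono (sub ∘ there) v))

IsValley-unmap : ∀ {w f} s → MonotoneOn w f → numbers s ⊆ w → IsValley (map (map₂ f) s) → IsValley s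
IsValley-unmap []          mono sub (_ , _ , _ , ())
IsValley-unmap (x ∷ [])    mono sub _               = _ , _ , _ , up [-]
IsValley-unmap {w} {f} (x ∷ y ∷ s) mono sub (_ , _ , _ , up inc) = _ , _ , _ , up (go (x ∷ y ∷ s) sub inc)
  where
  go : ∀ s → numbers s ⊆ w → Linked _<_ (numbers (map (map₂ f) s)) → Linked _<_ (numbers s)
  go []          sub []          = []
  go (x ∷ [])    sub [-]         = [-]
  go (x ∷ y ∷ s) sub (x<y ∷ inc) =
    MonotoneOn-reflects mono (sub (here refl)) (sub (there (here refl))) x<y ∷ go (y ∷ s) (sub ∘ there) inc
IsValley-unmap (x ∷ y ∷ s) mono sub (_ , _ , _ , down y<x v)
  with IsValley-unmap (y ∷ s) mono (sub ∘ there) (_ , _ , _ , v)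
... | _ , _ , _ , v′ =
  _ , _ , _ , down (MonotoneOn-reflects mono (sub (there (here refl))) (sub (here refl)) y<x) v′

Valley-ʳ++ : ∀ {L b R s} → Valley L b R s → s ≡ L ʳ++ (b ∷ R)
Valley-ʳ++ (up _) = refl
Valley-ʳ++ (down {L} {b} {R} {x} _ v) = trans (cong (x ∷_) (Valley-ʳ++ v)) (sym (++-ʳ++ L))

Valley-right : ∀ {L b R s} → Valley L b R s → Linked _<_ (numbers (b ∷ R))
Valley-right (up inc)   = inc
Valley-right (down _ v) = Valley-right v

AllPairs-∷ʳ : ∀ {a r} {A : Set a} {R : A → A → Set r} {xs x} →
              AllPairs R xs → All (λ y → R y x) xs → AllPairs R (xs ∷ʳ x)
AllPairs-∷ʳ []           []       = [] ∷ []
AllPairs-∷ʳ (x< ∷ pairs) (p ∷ ps) = All.∷ʳ⁺ x< p ∷ AllPairs-∷ʳ pairs ps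

-- The bound by the first letter `y` is what the induction carries: a letter put in front exceeds
-- `y`, hence everything in `b ∷ L`, and may be appended to `L`.
Valley-left-max : ∀ {L b R y s} → Valley L b R (y ∷ s) →
  AllPairs _<_ (numbers (b ∷ L)) × All (_≤ proj₂ y) (numbers (b ∷ L))
Valley-left-max (up _) = [] ∷ [] , ℕ.≤-refl ∷ []
Valley-left-max (down {L} {x = x} y<x v) with Valley-left-max v
... | pairs , ≤y rewrite map-++ proj₂ L (x ∷ []) =
  let <x = All.map (λ a≤y → ℕ.≤-<-trans a≤y y<x) ≤y
  in AllPairs-∷ʳ pairs <x , All.∷ʳ⁺ (All.map ℕ.<⇒≤ <x) ℕ.≤-refl

Valley-left : ∀ {L b R s} → Valley L b R s → AllPairs _<_ (numbers (b ∷ L))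
Valley-left v@(up _)     = proj₁ (Valley-left-max v)
Valley-left v@(down _ _) = proj₁ (Valley-left-max v)

range : ℕ → ℕ → List ℕ
range i zero    = []
range i (suc m) = i ∷ range (suc i) m

length-range : ∀ i m → length (range i m) ≡ m
length-range i zero    = refl
length-range i (suc m) = cong suc (length-range (suc i) m)

range-≥ : ∀ i m → All (i ≤_) (range i m)
range-≥ i zero    = []
range-≥ i (suc m) = ℕ.≤-refl ∷ All.map ℕ.<⇒≤ (range-≥ (suc i) m)

∈-range : ∀ {i a} m → i ≤ a → a < m ℕ.+ i → a ∈ range i m
∈-range         zero    i≤a a<i = contradiction i≤a (ℕ.<⇒≱ a<i)
∈-range {i} {a} (suc m) i≤a a<  with ℕ.m≤n⇒m<n∨m≡n i≤a
... | inj₁ i<a  = there (∈-range m i<a (subst (a <_) (sym (ℕ.+-suc m i)) a<))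
... | inj₂ refl = here refl

std-↭ : ∀ {w} → Unique w → std w ↭ range 1 (length w)
std-↭ {w} uniq with ∈𝔖⁻ (length w) (std-∈𝔖 uniq)
... | uniq′ , ps , e = Unique-⊆⇒↭ uniq′ (in-range ∘ All.lookup ps)
                         (ℕ.≤-reflexive (trans (length-range 1 (length w)) (sym e)))
  where
  in-range : ∀ {a} → a ∈ [1‥ length w ] → a ∈ range 1 (length w)
  in-range a∈ with ∈-map⁻ suc a∈
  ... | j , j∈ , refl = ∈-range (length w) (s≤s z≤n)
    (subst (suc j <_) (ℕ.+-comm 1 (length w)) (s≤s (∈-upTo⁻ j∈)))

least-first : ∀ {i} L → i ∈ numbers L → AllPairs _<_ (numbers L) → All (i ≤_) (numbers L) →
              ∃₂ λ c L′ → L ≡ (c , i) ∷ L′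
least-first ((c , _) ∷ L) (here refl) _        _       = c , L , refl
least-first ((c , j) ∷ L) (there i∈) (j< ∷ _) (i≤ ∷ _) =
  contradiction i≤ (ℕ.<⇒≱ (All.lookup j< i∈))

Valley-∷ʳ : ∀ {L b R s x} → Valley L b R s → All (_< proj₂ x) (numbers s) → Valley L b (R ∷ʳ x) (s ∷ʳ x)
Valley-∷ʳ {x = x} (up {b} {R} inc) <x = up (go (b ∷ R) inc <x)
  where
  go : ∀ s → Linked _<_ (numbers s) → All (_< proj₂ x) (numbers s) → Linked _<_ (numbers (s ∷ʳ x))
  go []          _           _             = [-]
  go (y ∷ [])    _           (y<x ∷ _)     = y<x ∷ [-]
  go (y ∷ z ∷ s) (y<z ∷ inc) (_ ∷ <x)      = y<z ∷ go (z ∷ s) inc <x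
Valley-∷ʳ (down y<x v) (_ ∷ <x) = down y<x (Valley-∷ʳ v <x)

IsValley-∷ : ∀ {s x} → IsValley s → All (_< proj₂ x) (numbers s) → IsValley (x ∷ s)
IsValley-∷ (_ , _ , _ , v@(up _))     (y<x ∷ _) = _ , _ , _ , down y<x v
IsValley-∷ (_ , _ , _ , v@(down _ _)) (y<x ∷ _) = _ , _ , _ , down y<x v

IsValley-≢[] : ¬ IsValley []
IsValley-≢[] (_ , _ , _ , ())

-- The invariant of successive bracketing: the next biletter has number `i`, above all present ones,
-- so that it can join a valley at either end.
ValleyBelow : ℕ → Biword → Set
ValleyBelow i s = IsValley s × All (_< i) (numbers s)

ValleyBelow-∷ʳ : ∀ {i s x} → ValleyBelow i s → ValleyBelow (suc i) (s ∷ʳ (x , i))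
ValleyBelow-∷ʳ {i} {s} {x} ((_ , _ , _ , v) , <i) = (_ , _ , _ , Valley-∷ʳ v <i) ,
  subst (All (_< suc i)) (sym (map-++ proj₂ s _)) (All.∷ʳ⁺ (All.map ℕ.m≤n⇒m≤1+n <i) ℕ.≤-refl)

ValleyBelow-∷ : ∀ {i s x} → ValleyBelow i s → ValleyBelow (suc i) ((x , i) ∷ s)
ValleyBelow-∷ (v , <i) = IsValley-∷ v <i , ℕ.≤-refl ∷ All.map ℕ.m≤n⇒m≤1+n <i

Valley-↭ : ∀ {L b R s} → Valley L b R s → s ↭ b ∷ L ++ R
Valley-↭ {L} {b} {R} v =
  ↭-trans (↭-reflexive (Valley-ʳ++ v)) (↭-trans (↭-sym (++↭ʳ++ L (b ∷ R))) (shift b L R))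

colors-map₂ : ∀ f (w : Biword) → colors (map (map₂ f) w) ≡ colors w
colors-map₂ f w = sym (map-∘ w)

-- `b` is below both of its sides, hence the least number. What remains is the range of numbers that
-- `Ψ` hands to `bracketFrom 2`.
Valley-least : ∀ {m L b R s} → Valley L b R s → numbers s ↭ range 1 (suc m) →
               proj₂ b ≡ 1 × numbers (L ++ R) ↭ range 2 m
Valley-least {m} {L} {c , t} {R} v p = t≡1 , drop-∷ (subst (λ j → j ∷ numbers (L ++ R) ↭ range 1 (suc m)) t≡1 p′)
  where
  p′ : t ∷ numbers (L ++ R) ↭ range 1 (suc m)
  p′ = ↭-trans (map⁺ proj₂ (↭-sym (Valley-↭ v))) p

  t< : All (t <_) (numbers (L ++ R))
  t< = subst (All (t <_)) (sym (map-++ proj₂ L R))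
    (All.++⁺ (AllPairs.head (Valley-left v)) (AllPairs.head (Linked⇒AllPairs ℕ.<-trans (Valley-right v))))

  t≡1 : t ≡ 1
  t≡1 with ∈-resp-↭ (↭-sym p′) (here refl)
  ... | here 1≡t = sym 1≡t
  ... | there 1∈ = contradiction (All.lookup t< 1∈) (ℕ.≤⇒≯ (All.lookup (range-≥ 1 (suc m)) (∈-resp-↭ p′ (here refl))))

take-++-length : ∀ {a} {A : Set a} (xs ys : List A) → take (length xs) (xs ++ ys) ≡ xs
take-++-length []       ys = refl
take-++-length (x ∷ xs) ys = cong (x ∷_) (take-++-length xs ys)

drop-++-length : ∀ {a} {A : Set a} (xs ys : List A) → drop (length xs) (xs ++ ys) ≡ ys
drop-++-length []       ys = refl
drop-++-length (x ∷ xs) ys = drop-++-length xs ys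

stdᵇ-zip : ∀ w → stdᵇ w ≡ zip (colors w) (std (numbers w))
stdᵇ-zip w = sym (trans (≡.cong₂ zip (sym (colors-stdᵇ w)) (sym (numbers-stdᵇ w))) (zip-colors-numbers (stdᵇ w)))

length-numbers : ∀ (w : Biword) → length (numbers w) ≡ length w
length-numbers = length-map proj₂

length-colors : ∀ (w : Biword) → length (colors w) ≡ length w
length-colors = length-map proj₁

∗-length : ∀ α β {γ} → γ ∈ α ∗ β → length γ ≡ length α ℕ.+ length β
∗-length α β γ∈ = ∈𝔖-length _ (proj₁ (∈-filter⁻
  (λ γ → (std (take (length α) γ) ≟ʷ α) ×-dec (std (drop (length α) γ) ≟ʷ β))
  {xs = 𝔖 (length α ℕ.+ length β)} γ∈))

-- Initially dominated factorizations

_≟⁺_ : DecidableEquality (List⁺ ℕ)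
(x ∷ v) ≟⁺ (y ∷ w) with x ℕ.≟ y | v ≟ʷ w
... | yes refl | yes refl = yes refl
... | no x≢y   | _        = no λ { refl → x≢y refl }
... | _        | no v≢w   = no λ { refl → v≢w refl }

-- `M` bounds the first head from below, so that the condition can be split off factor by factor;
-- `M = 0` demands nothing.
IsDominated : ℕ → List (List⁺ ℕ) → Set
IsDominated M fs = All InitiallyDominated fs × Linked _≤_ (M ∷ map List⁺.head fs)

isDominated? : ∀ M fs → Dec (IsDominated M fs)
isDominated? M fs = All.all? (λ { (x ∷ w) → All.all? (ℕ._<? x) w }) fs
                    ×-dec linked? ℕ._≤?_ (M ∷ map List⁺.head fs)

dominatedFactors-isDominated : ∀ u → IsDominated 0 (dominatedFactors u)
dominatedFactors-isDominated u with dominatedFactors-correct u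
... | _ , dom , inc = dom , from-0 inc
  where
  from-0 : ∀ {xs} → Linked _≤_ xs → Linked _≤_ (0 ∷ xs)
  from-0 []          = [-]
  from-0 [-]         = z≤n ∷ [-]
  from-0 (x≤y ∷ inc) = z≤n ∷ x≤y ∷ inc

length-concat : ∀ (fs : List (List⁺ ℕ)) → length (concatMap List⁺.toList fs) ≡ sum (map List⁺.length fs)
length-concat []             = refl
length-concat ((x ∷ v) ∷ fs) = cong suc (trans (length-++ v) (cong (length v ℕ.+_) (length-concat fs)))

sum-saillance : ∀ u → sum (saillance u) ≡ length u
sum-saillance u = trans (sym (length-concat (dominatedFactors u))) (cong length (proj₁ (dominatedFactors-correct u)))

saillance-∈ : ∀ u → saillance u ∈ compositions (length u)
saillance-∈ u = compositions-complete (length u) (positive (dominatedFactors u) , sum-saillance u)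
  where
  positive : ∀ fs → All (0 <_) (map List⁺.length fs)
  positive []       = []
  positive (_ ∷ fs) = s≤s z≤n ∷ positive fs

Dominates : ℕ × ℕ → Biword → Set
Dominates b = All (λ x → proj₁ x < proj₁ b)

dominates? : ∀ b s → Dec (Dominates b s)
dominates? b = All.all? (λ x → proj₁ x ℕ.<? proj₁ b)

module _ {c ℓ} (K : CommutativeRing c ℓ) (q : CommutativeRing.Carrier K) where

  open CommutativeRing K hiding (zero; refl; sym; trans)
  open CommutativeRing K using () renaming (refl to ≈-refl; sym to ≈-sym; trans to ≈-trans)
  open Combinations K q hiding (Carrier; _≈_; 0#; 1#; -_)
  open import Algebra.Properties.Ring ring using (-1*x≈-x; -‿distribˡ-*; -‿distribʳ-*)
  open import Algebra.Properties.CommutativeSemigroup +-commutativeSemigroup using () renaming (interchange to +-interchange)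
  open import Algebra.Properties.CommutativeSemigroup *-commutativeSemigroup using (x∙yz≈y∙xz; interchange)
  open import Relation.Binary.Reasoning.Setoid setoid

  -- Finite sums

  ∑ : ∀ {a} {X : Set a} → List X → (X → Carrier) → Carrier
  ∑ xs f = foldr (λ x s → f x + s) 0# xs

  infixr 8 𝟙_·_
  𝟙_·_ : Bool → Carrier → Carrier
  𝟙 b · x = if b then x else 0#

  𝟙-cong : ∀ b {x y} → x ≈ y → 𝟙 b · x ≈ 𝟙 b · y
  𝟙-cong true  e = e
  𝟙-cong false e = ≈-refl

  𝟙-0 : ∀ b → 𝟙 b · 0# ≈ 0#
  𝟙-0 true  = ≈-refl
  𝟙-0 false = ≈-refl

  𝟙-* : ∀ b x y → x * 𝟙 b · y ≈ 𝟙 b · (x * y)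
  𝟙-* true  x y = ≈-refl
  𝟙-* false x y = zeroʳ x

  𝟙-+ : ∀ b x y → 𝟙 b · (x + y) ≈ 𝟙 b · x + 𝟙 b · y
  𝟙-+ true  x y = ≈-refl
  𝟙-+ false x y = ≈-sym (+-identityˡ 0#)

  module _ {a} {X : Set a} where

    ∑-cong : ∀ (xs : List X) {f g} → (∀ {x} → x ∈ xs → f x ≈ g x) → ∑ xs f ≈ ∑ xs g
    ∑-cong []       e = ≈-refl
    ∑-cong (x ∷ xs) e = +-cong (e (here refl)) (∑-cong xs (e ∘ there))

    ∑-zero : ∀ (xs : List X) {f} → (∀ {x} → x ∈ xs → f x ≈ 0#) → ∑ xs f ≈ 0#
    ∑-zero []       e = ≈-refl
    ∑-zero (x ∷ xs) e = ≈-trans (+-cong (e (here refl)) (∑-zero xs (e ∘ there))) (+-identityˡ 0#)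

    ∑-++ : ∀ (xs ys : List X) f → ∑ (xs ++ ys) f ≈ ∑ xs f + ∑ ys f
    ∑-++ []       ys f = ≈-sym (+-identityˡ _)
    ∑-++ (x ∷ xs) ys f = ≈-trans (+-congˡ (∑-++ xs ys f)) (≈-sym (+-assoc _ _ _))

    ∑-+ : ∀ (xs : List X) f g → ∑ xs (λ x → f x + g x) ≈ ∑ xs f + ∑ xs g
    ∑-+ []       f g = ≈-sym (+-identityˡ 0#)
    ∑-+ (x ∷ xs) f g = ≈-trans (+-congˡ (∑-+ xs f g)) (+-interchange _ _ _ _)

    ∑-*ˡ : ∀ (xs : List X) k f → ∑ xs (λ x → k * f x) ≈ k * ∑ xs f
    ∑-*ˡ []       k f = ≈-sym (zeroʳ k)
    ∑-*ˡ (x ∷ xs) k f = ≈-trans (+-congˡ (∑-*ˡ xs k f)) (≈-sym (distribˡ k _ _))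

    ∑-*ʳ : ∀ (xs : List X) k f → ∑ xs (λ x → f x * k) ≈ ∑ xs f * k
    ∑-*ʳ []       k f = ≈-sym (zeroˡ k)
    ∑-*ʳ (x ∷ xs) k f = ≈-trans (+-congˡ (∑-*ʳ xs k f)) (≈-sym (distribʳ k _ _))

    ∑-𝟙 : ∀ (xs : List X) b f → ∑ xs (λ x → 𝟙 b · f x) ≈ 𝟙 b · ∑ xs f
    ∑-𝟙 xs true  f = ≈-refl
    ∑-𝟙 xs false f = ∑-zero xs (const ≈-refl)

    ∑-filter : ∀ {p} {P : X → Set p} (P? : Decidable P) xs f →
               ∑ (filter P? xs) f ≈ ∑ xs (λ x → 𝟙 does (P? x) · f x)
    ∑-filter P? []       f = ≈-refl
    ∑-filter P? (x ∷ xs) f with does (P? x)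
    ... | true  = +-congˡ (∑-filter P? xs f)
    ... | false = ≈-trans (∑-filter P? xs f) (≈-sym (+-identityˡ _))

    ∑-single : ∀ {xs : List X} {f x} → Unique xs → x ∈ xs →
               (∀ {y} → y ∈ xs → y ≢ x → f y ≈ 0#) → ∑ xs f ≈ f x
    ∑-single {x ∷ xs} {f} (x∉ ∷ _) (here refl) e =
      ≈-trans (+-congˡ (∑-zero xs λ y∈ → e (there y∈) (All.lookup x∉ y∈ ∘ sym)))
            (+-identityʳ _)
    ∑-single {y ∷ xs} {f} (y∉ ∷ uniq) (there x∈) e =
      ≈-trans (+-cong (e (here refl) (All.lookup y∉ x∈)) (∑-single uniq x∈ (e ∘ there)))
            (+-identityˡ _)

  module _ {a b} {X : Set a} {Y : Set b} where

    ∑-map : ∀ (g : Y → X) ys f → ∑ (map g ys) f ≡ ∑ ys (f ∘ g)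
    ∑-map g []       f = refl
    ∑-map g (y ∷ ys) f = cong (f (g y) +_) (∑-map g ys f)

    ∑-concatMap : ∀ (g : Y → List X) ys f → ∑ (concatMap g ys) f ≈ ∑ ys (λ y → ∑ (g y) f)
    ∑-concatMap g []       f = ≈-refl
    ∑-concatMap g (y ∷ ys) f =
      ≈-trans (∑-++ (g y) (concatMap g ys) f) (+-congˡ (∑-concatMap g ys f))

    ∑-swap : ∀ (xs : List X) (ys : List Y) (f : X → Y → Carrier) →
             ∑ xs (λ x → ∑ ys (f x)) ≈ ∑ ys (λ y → ∑ xs (λ x → f x y))
    ∑-swap []       ys f = ≈-sym (∑-zero ys (const ≈-refl))
    ∑-swap (x ∷ xs) ys f = ≈-trans (+-congˡ (∑-swap xs ys f)) (≈-sym (∑-+ ys (f x) _))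

  -- Coefficients of combinations

  δ : Biword → Biword → Carrier
  δ u w = 𝟙 does (u ≟ᵇ w) · 1#

  δ-refl : ∀ w → δ w w ≈ 1#
  δ-refl w rewrite dec-true (w ≟ᵇ w) refl = ≈-refl

  δ-≢ : ∀ {u w} → u ≢ w → δ u w ≈ 0#
  δ-≢ {u} {w} ne rewrite dec-false (u ≟ᵇ w) ne = ≈-refl

  coefficient-∑ : ∀ x w → coefficient x w ≈ ∑ x (λ (a , u) → a * δ u w)
  coefficient-∑ []            w = ≈-refl
  coefficient-∑ ((a , u) ∷ x) w with does (u ≟ᵇ w)
  ... | true  = +-cong (≈-sym (*-identityʳ a)) (coefficient-∑ x w)
  ... | false = ≈-trans (coefficient-∑ x w) (≈-sym (≈-trans (+-congʳ (zeroʳ a)) (+-identityˡ _)))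

  coefficient-basis : ∀ u w → coefficient (basis u) w ≈ δ u w
  coefficient-basis u w =
    ≈-trans (coefficient-∑ (basis u) w) (≈-trans (+-identityʳ _) (*-identityˡ _))

  coefficient-⊕ : ∀ x y w → coefficient (x ⊕ y) w ≈ coefficient x w + coefficient y w
  coefficient-⊕ x y w =
    ≈-trans (coefficient-∑ (x ⊕ y) w)
          (≈-trans (∑-++ x y _) (≈-sym (+-cong (coefficient-∑ x w) (coefficient-∑ y w))))

  coefficient-• : ∀ k x w → coefficient (k • x) w ≈ k * coefficient x w
  coefficient-• k x w = begin
    coefficient (k • x) w                   ≈⟨ coefficient-∑ (k • x) w ⟩
    ∑ (k • x) (λ (a , u) → a * δ u w)       ≡⟨ ∑-map _ x _ ⟩
    ∑ x (λ (a , u) → (k * a) * δ u w)       ≈⟨ ∑-cong x (λ _ → *-assoc k _ _) ⟩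
    ∑ x (λ (a , u) → k * (a * δ u w))       ≈⟨ ∑-*ˡ x k _ ⟩
    k * ∑ x (λ (a , u) → a * δ u w)         ≈⟨ *-congˡ (≈-sym (coefficient-∑ x w)) ⟩
    k * coefficient x w                     ∎

  coefficient-⨁ : ∀ {a} {X : Set a} (xs : List X) f w →
                  coefficient (⨁ xs f) w ≈ ∑ xs (λ x → coefficient (f x) w)
  coefficient-⨁ xs f w = begin
    coefficient (⨁ xs f) w                           ≈⟨ coefficient-∑ (⨁ xs f) w ⟩
    ∑ (⨁ xs f) (λ (a , u) → a * δ u w)               ≈⟨ ∑-concatMap f xs _ ⟩
    ∑ xs (λ x → ∑ (f x) (λ (a , u) → a * δ u w))     ≈⟨ ∑-cong xs (λ {x} _ → ≈-sym (coefficient-∑ (f x) w)) ⟩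
    ∑ xs (λ x → coefficient (f x) w)                 ∎

  coefficient-bilinear : ∀ f x y w → coefficient (bilinear f x y) w
    ≈ ∑ x (λ (a , u) → ∑ y (λ (b , v) → (a * b) * coefficient (f u v) w))
  coefficient-bilinear f x y w = begin
    coefficient (bilinear f x y) w
      ≈⟨ coefficient-⨁ x _ w ⟩
    ∑ x (λ (a , u) → coefficient (⨁ y λ (b , v) → (a * b) • f u v) w)
      ≈⟨ ∑-cong x (λ _ → coefficient-⨁ y _ w) ⟩
    ∑ x (λ (a , u) → ∑ y (λ (b , v) → coefficient ((a * b) • f u v) w))
      ≈⟨ ∑-cong x (λ _ → ∑-cong y (λ {(b , v)} _ → coefficient-• _ (f _ v) w)) ⟩
    ∑ x (λ (a , u) → ∑ y (λ (b , v) → (a * b) * coefficient (f u v) w)) ∎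

  Supported : ∀ {p} → (Biword → Set p) → Combination → Set _
  Supported P = All (P ∘ proj₂)

  coefficient-zero : ∀ {p} {P : Biword → Set p} {x} → Supported P x → ∀ {w} → ¬ P w →
                     coefficient x w ≈ 0#
  coefficient-zero {x = x} ps {w} ¬p =
    ≈-trans (coefficient-∑ x w) (∑-zero x λ {(a , u)} t∈ →
      ≈-trans (*-congˡ (δ-≢ {u} λ {refl → ¬p (All.lookup ps t∈)})) (zeroʳ a))

  Supported-bilinear : ∀ {p p′ r} {P : Biword → Set p} {P′ : Biword → Set p′} {Q : Biword → Set r}
    {f x y} → (∀ {u v} → P u → P′ v → Supported Q (f u v)) → Supported P x → Supported P′ y →
    Supported Q (bilinear f x y)
  Supported-bilinear {Q = Q} pq ps qs = concatMap⁺ (All.map (λ p → concatMap⁺ (All.map (λ p′ → All.map⁺ (pq p p′)) qs)) ps)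
    where
    concatMap⁺ : ∀ {g : _ → Combination} {ts} → All (Supported Q ∘ g) ts → Supported Q (concatMap g ts)
    concatMap⁺ ps = All.concat⁺ (All.map⁺ ps)

  -- The recursion common to both sides

  -- The weights of I on the left: pre at a letter of a block where the minimum is still to come,
  -- post at the minimum or after it, where c is the color of the minimum and t the last number
  -- read, so that the first part of I still counts the last letter read.
  pre  : List ℕ → ℕ → Biword → Carrier
  post : List ℕ → ℕ → ℕ → Biword → Carrier

  pre []                M []            = 1#
  pre (1 ∷ I)           M ((c , t) ∷ w) = 𝟙 not (does (c ℕ.<? M)) · post (1 ∷ I) c t w
  pre (suc (suc k) ∷ I) M ((c , t) ∷ w) =
    𝟙 not (does (c ℕ.<? M)) · post (suc (suc k) ∷ I) c t w
    + 𝟙 descends t w · (- q * pre (suc k ∷ I) (M ⊔ c) w)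
  pre _                 _ _             = 0#

  post (1 ∷ I)           c t w               = pre I c w
  post (suc (suc k) ∷ I) c t ((c′ , t′) ∷ w) =
    𝟙 does (t ℕ.<? t′) ∧ does (c′ ℕ.<? c) · post (suc k ∷ I) c t′ w
  post _                 _ _ _               = 0#

  -- The totals of `pre` and `post` over all compositions. In `𝔸` the current letter is the minimum
  -- of its block or precedes it; in `𝔹` the block of the record `c` ends here or continues by an
  -- ascent to a smaller color.
  𝔸 : ℕ → Biword → Carrier
  𝔹 : ℕ → ℕ → Biword → Carrier

  𝔸 M []            = 1#
  𝔸 M ((c , t) ∷ w) =
    𝟙 not (does (c ℕ.<? M)) · 𝔹 c t w + 𝟙 descends t w · (- q * 𝔸 (M ⊔ c) w)

  𝔹 c t []              = 1#
  𝔹 c t ((c′ , t′) ∷ w) =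
    𝔸 c ((c′ , t′) ∷ w) + 𝟙 does (t ℕ.<? t′) ∧ does (c′ ℕ.<? c) · 𝔹 c t′ w

  -- The first letter is a block of its own or is joined to the first block of the rest; `g`
  -- collects the second case. With no rest there is nothing to join, whence `g [] ≈ 0#`.
  ∑-compositions : ∀ n f g → g [] ≈ 0# → (∀ k I → f (suc (suc k) ∷ I) ≈ g (suc k ∷ I)) →
    ∑ (compositions (suc n)) f ≈ ∑ (compositions n) (f ∘ (1 ∷_)) + ∑ (compositions n) g
  ∑-compositions n f g g[] fg = begin
    ∑ (compositions (suc n)) f
      ≈⟨ ∑-concatMap refine (compositions n) f ⟩
    ∑ (compositions n) (λ I → ∑ (refine I) f)
      ≈⟨ ∑-cong (compositions n) (λ I∈ → step (proj₁ (compositions-sound n I∈))) ⟩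
    ∑ (compositions n) (λ I → f (1 ∷ I) + g I)
      ≈⟨ ∑-+ (compositions n) _ _ ⟩
    ∑ (compositions n) (f ∘ (1 ∷_)) + ∑ (compositions n) g ∎
    where
    step : ∀ {I} → All (0 <_) I → ∑ (refine I) f ≈ f (1 ∷ I) + g I
    step []                = +-congˡ (≈-sym g[])
    step {suc k ∷ I} (_ ∷ _) = +-congˡ (≈-trans (+-identityʳ _) (fg k I))

  ∑-pre  : ∀ M w → ∑ (compositions (length w)) (λ I → pre I M w) ≈ 𝔸 M w
  ∑-post : ∀ c t w → ∑ (compositions (suc (length w))) (λ I → post I c t w) ≈ 𝔹 c t w

  ∑-pre M []            = +-identityʳ 1#
  ∑-pre M ((c , t) ∷ w) = begin
    ∑ (compositions (suc n)) (λ I → pre I M ((c , t) ∷ w))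
      ≈⟨ ∑-cong (compositions (suc n)) (λ I∈ → split (proj₁ (compositions-sound (suc n) I∈))) ⟩
    ∑ (compositions (suc n)) (λ I → 𝟙 r · post I c t w + later I)
      ≈⟨ ∑-+ (compositions (suc n)) _ _ ⟩
    ∑ (compositions (suc n)) (λ I → 𝟙 r · post I c t w) + ∑ (compositions (suc n)) later
      ≈⟨ +-cong (≈-trans (∑-𝟙 (compositions (suc n)) r _) (𝟙-cong r (∑-post c t w))) ∑-later ⟩
    𝟙 r · 𝔹 c t w + 𝟙 descends t w · (- q * 𝔸 (M ⊔ c) w) ∎
    where
    n = length w
    r = not (does (c ℕ.<? M))

    g : List ℕ → Carrier
    g I = 𝟙 descends t w · (- q * pre I (M ⊔ c) w)

    later : List ℕ → Carrier
    later (suc (suc k) ∷ I) = g (suc k ∷ I)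
    later _                 = 0#

    split : ∀ {I} → All (0 <_) I → pre I M ((c , t) ∷ w) ≈ 𝟙 r · post I c t w + later I
    split []                        = ≈-sym (≈-trans (+-identityʳ _) (𝟙-0 r))
    split {1 ∷ I}           (_ ∷ _) = ≈-sym (+-identityʳ _)
    split {suc (suc k) ∷ I} (_ ∷ _) = ≈-refl

    g[] : ∀ w → 𝟙 descends t w · (- q * pre [] (M ⊔ c) w) ≈ 0#
    g[] []             = ≈-refl
    g[] ((_ , t′) ∷ w) = ≈-trans (𝟙-cong (not (does (t ℕ.<? t′))) (zeroʳ _)) (𝟙-0 (not (does (t ℕ.<? t′))))

    ∑-later : ∑ (compositions (suc n)) later ≈ 𝟙 descends t w · (- q * 𝔸 (M ⊔ c) w)
    ∑-later = begin
      ∑ (compositions (suc n)) later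
        ≈⟨ ∑-compositions n later g (g[] w) (λ _ _ → ≈-refl) ⟩
      ∑ (compositions n) (const 0#) + ∑ (compositions n) g
        ≈⟨ +-congʳ (∑-zero (compositions n) (const ≈-refl)) ⟩
      0# + ∑ (compositions n) g
        ≈⟨ +-identityˡ _ ⟩
      ∑ (compositions n) g
        ≈⟨ ∑-𝟙 (compositions n) (descends t w) _ ⟩
      𝟙 descends t w · ∑ (compositions n) (λ I → - q * pre I (M ⊔ c) w)
        ≈⟨ 𝟙-cong (descends t w) (≈-trans (∑-*ˡ (compositions n) _ _) (*-congˡ (∑-pre (M ⊔ c) w))) ⟩
      𝟙 descends t w · (- q * 𝔸 (M ⊔ c) w) ∎

  ∑-post c t []              = ≈-trans (+-identityʳ _) ≈-refl
  ∑-post c t ((c′ , t′) ∷ w) = begin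
    ∑ (compositions (suc n)) (λ I → post I c t ((c′ , t′) ∷ w))
      ≈⟨ ∑-compositions n _ (λ I → 𝟙 b · post I c t′ w) (𝟙-0 b) (λ _ _ → ≈-refl) ⟩
    ∑ (compositions n) (λ I → pre I c ((c′ , t′) ∷ w)) + ∑ (compositions n) (λ I → 𝟙 b · post I c t′ w)
      ≈⟨ +-cong (∑-pre c ((c′ , t′) ∷ w))
                (≈-trans (∑-𝟙 (compositions n) b _) (𝟙-cong b (∑-post c t′ w))) ⟩
    𝔸 c ((c′ , t′) ∷ w) + 𝟙 b · 𝔹 c t′ w ∎
    where
    n = suc (length w)
    b = does (t ℕ.<? t′) ∧ does (c′ ℕ.<? c)

  -- Summing the signed weights of the right-hand side

  weight : List ℕ → ℕ → Biword → Carrier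
  weight I M w = 𝟙 decreasing I w · ((- 1#) ^ joins I * q ^ exponent I M w)

  -- The value that the sum over compositions whose first block has no record will have. It is the
  -- ascending branch of `𝔹` without the ascent test, with `M` as the color of the last record.
  unmarked : ℕ → Biword → Carrier
  unmarked M []            = 0#
  unmarked M ((c , t) ∷ w) = 𝟙 does (c ℕ.<? M) · 𝔹 M t w

  -- 1 − [descent] = [ascent]
  𝔹-unmarked : ∀ c t w →
    (𝔸 c w + unmarked c w) + 𝟙 descends t w · (- 1# * unmarked c w) ≈ 𝔹 c t w
  𝔹-unmarked c t []              = ≈-trans (+-identityʳ _) (+-identityʳ _)
  𝔹-unmarked c t ((c′ , t′) ∷ w) with does (t ℕ.<? t′)
  ... | true  = +-identityʳ _
  ... | false = begin
    (a + u) + - 1# * u   ≈⟨ +-assoc _ _ _ ⟩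
    a + (u + - 1# * u)   ≈⟨ +-congˡ (+-congˡ (-1*x≈-x u)) ⟩
    a + (u + - u)        ≈⟨ +-congˡ (-‿inverseʳ u) ⟩
    a + 0#               ∎
    where
    a = 𝔸 c ((c′ , t′) ∷ w)
    u = unmarked c ((c′ , t′) ∷ w)

  -- The additional join costs `- 1#`, and the letter counts for `q` exactly if a record follows in
  -- its block.
  weight-suc : ∀ k I M c t w → weight (suc (suc k) ∷ I) M ((c , t) ∷ w) ≈
    𝟙 descends t w · ((if hasRecord (suc k ∷ I) (M ⊔ c) w then - q else - 1#)
                      * weight (suc k ∷ I) (M ⊔ c) w)
  weight-suc k I M c t w with descends t w
  ... | false = ≈-refl
  ... | true  with decreasing (suc k ∷ I) w
  ...   | false = ≈-sym (zeroʳ _)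
  ...   | true  with hasRecord (suc k ∷ I) (M ⊔ c) w
  ...     | false = *-assoc _ _ _
  ...     | true  = begin
    (- 1# * x) * (q * y)   ≈⟨ x∙yz≈y∙xz _ _ _ ⟩
    q * ((- 1# * x) * y)   ≈⟨ *-congˡ (≈-trans (*-assoc _ _ _) (-1*x≈-x _)) ⟩
    q * - (x * y)          ≈⟨ ≈-sym (-‿distribʳ-* q _) ⟩
    - (q * (x * y))        ≈⟨ -‿distribˡ-* q _ ⟩
    - q * (x * y)          ∎
    where
    x = (- 1#) ^ joins (suc k ∷ I)
    y = q ^ exponent (suc k ∷ I) (M ⊔ c) w

  -- The empty composition falls under `marked` because `hasRecord []` is true, in agreement with
  -- `𝔸 M [] = 1#` and `unmarked M [] = 0#`.
  marked unmarkedWeight : List ℕ → ℕ → Biword → Carrier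
  marked         I M w = 𝟙 hasRecord I M w · weight I M w
  unmarkedWeight I M w = 𝟙 not (hasRecord I M w) · weight I M w

  weight-split : ∀ I M w → weight I M w ≈ marked I M w + unmarkedWeight I M w
  weight-split I M w with hasRecord I M w
  ... | true  = ≈-sym (+-identityʳ _)
  ... | false = ≈-sym (+-identityˡ _)

  -- The boundary condition for `∑-compositions`. At the end of the word it rests on `descends t []`
  -- being false, since `weight [] M []` is the empty product.
  weight-[] : ∀ t b k M w → 𝟙 descends t w · (k * 𝟙 b · weight [] M w) ≈ 0#
  weight-[] t b k M []             = ≈-refl
  weight-[] t b k M ((_ , t′) ∷ w) =
    ≈-trans (𝟙-cong d (≈-trans (*-congˡ (𝟙-0 b)) (zeroʳ _))) (𝟙-0 d)
    where d = not (does (t ℕ.<? t′))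

  -- A block has a record if its first letter is one (`r`) or a later one is (`h`). The factor
  -- depends on `h` alone, so the case of `r` without `h` is separated from that of `h`.
  split-marked : ∀ r h d x → 𝟙 r ∨ h · 𝟙 d · ((if h then - q else - 1#) * x) ≈
    𝟙 d · (- q * 𝟙 h · x) + 𝟙 r · 𝟙 d · (- 1# * 𝟙 not h · x)
  split-marked false false false x = ≈-sym (+-identityʳ _)
  split-marked false false true  x = ≈-sym (≈-trans (+-identityʳ _) (zeroʳ _))
  split-marked false true  d     x = ≈-sym (+-identityʳ _)
  split-marked true  false false x = ≈-sym (+-identityʳ _)
  split-marked true  false true  x = ≈-sym (≈-trans (+-congʳ (zeroʳ _)) (+-identityˡ _))
  split-marked true  true  false x = ≈-sym (+-identityʳ _)
  split-marked true  true  true  x = ≈-sym (≈-trans (+-congˡ (zeroʳ _)) (+-identityʳ _))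

  split-unmarked : ∀ b h d x → 𝟙 not (not b ∨ h) · 𝟙 d · ((if h then - q else - 1#) * x) ≈
    𝟙 b · 𝟙 d · (- 1# * 𝟙 not h · x)
  split-unmarked false h     d     x = ≈-refl
  split-unmarked true  false d     x = ≈-refl
  split-unmarked true  true  false x = ≈-refl
  split-unmarked true  true  true  x = ≈-sym (zeroʳ _)

  -- Simultaneous recursion: a cut after the first letter leaves the next block unrestricted, while
  -- a join needs the sums with and without a record separately.
  ∑-weight   : ∀ M w → ∑ (compositions (length w)) (λ I → weight I M w) ≈ 𝔸 M w + unmarked M w
  ∑-marked   : ∀ M w → ∑ (compositions (length w)) (λ I → marked I M w) ≈ 𝔸 M w
  ∑-unmarked : ∀ M w → ∑ (compositions (length w)) (λ I → unmarkedWeight I M w) ≈ unmarked M w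

  ∑-weight M w =
    ≈-trans (∑-cong (compositions (length w)) (λ {I} _ → weight-split I M w))
          (≈-trans (∑-+ (compositions (length w)) _ _) (+-cong (∑-marked M w) (∑-unmarked M w)))

  ∑-marked M []            = ≈-trans (+-identityʳ _) (*-identityˡ 1#)
  ∑-marked M ((c , t) ∷ w) = begin
    ∑ (compositions (suc n)) (λ I → marked I M ((c , t) ∷ w))
      ≈⟨ ∑-compositions n _ (λ I → 𝟙 d · (- q * marked I (M ⊔ c) w) + 𝟙 r · 𝟙 d · (- 1# * unmarkedWeight I (M ⊔ c) w))
           (≈-trans (+-cong (weight-[] t true _ (M ⊔ c) w)
                          (≈-trans (𝟙-cong r (weight-[] t false _ (M ⊔ c) w)) (𝟙-0 r)))
                  (+-identityʳ 0#))
           step ⟩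
    ∑ (compositions n) (λ I → 𝟙 r · weight I (M ⊔ c) w)
      + ∑ (compositions n) (λ I → 𝟙 d · (- q * marked I (M ⊔ c) w) + 𝟙 r · 𝟙 d · (- 1# * unmarkedWeight I (M ⊔ c) w))
      ≈⟨ +-cong (≈-trans (∑-𝟙 (compositions n) r _) (𝟙-cong r (∑-weight (M ⊔ c) w)))
           (≈-trans (∑-+ (compositions n) _ _) (+-cong
             (≈-trans (∑-𝟙 (compositions n) d _) (𝟙-cong d
               (≈-trans (∑-*ˡ (compositions n) _ _) (*-congˡ (∑-marked (M ⊔ c) w)))))
             (≈-trans (∑-𝟙 (compositions n) r _) (𝟙-cong r
               (≈-trans (∑-𝟙 (compositions n) d _) (𝟙-cong d
                 (≈-trans (∑-*ˡ (compositions n) _ _) (*-congˡ (∑-unmarked (M ⊔ c) w))))))))) ⟩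
    𝟙 r · (𝔸 (M ⊔ c) w + u) + (later + 𝟙 r · 𝟙 d · (- 1# * u))
      ≈⟨ +-congˡ (+-comm _ _) ⟩
    𝟙 r · (𝔸 (M ⊔ c) w + u) + (𝟙 r · 𝟙 d · (- 1# * u) + later)
      ≈⟨ ≈-sym (+-assoc _ _ _) ⟩
    (𝟙 r · (𝔸 (M ⊔ c) w + u) + 𝟙 r · 𝟙 d · (- 1# * u)) + later
      ≈⟨ +-congʳ (≈-sym (𝟙-+ r _ _)) ⟩
    𝟙 r · ((𝔸 (M ⊔ c) w + u) + 𝟙 d · (- 1# * u)) + later
      ≈⟨ +-congʳ record-head ⟩
    𝟙 r · 𝔹 c t w + later ∎
    where
    n = length w
    r = not (does (c ℕ.<? M))
    d = descends t w
    u = unmarked (M ⊔ c) w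
    later = 𝟙 d · (- q * 𝔸 (M ⊔ c) w)

    step : ∀ k I → marked (suc (suc k) ∷ I) M ((c , t) ∷ w) ≈
      𝟙 d · (- q * marked (suc k ∷ I) (M ⊔ c) w) + 𝟙 r · 𝟙 d · (- 1# * unmarkedWeight (suc k ∷ I) (M ⊔ c) w)
    step k I = ≈-trans (𝟙-cong (r ∨ hasRecord (suc k ∷ I) (M ⊔ c) w) (weight-suc k I M c t w))
                     (split-marked r (hasRecord (suc k ∷ I) (M ⊔ c) w) d _)

    -- If the first letter is a record, then `M ⊔ c` is `c`, and the cut after it together with the
    -- joins to a rest without record gives `𝔹 c t w`.
    record-head : 𝟙 r · ((𝔸 (M ⊔ c) w + u) + 𝟙 d · (- 1# * u)) ≈ 𝟙 r · 𝔹 c t w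
    record-head with c ℕ.<? M
    ... | yes c<M rewrite dec-true (c ℕ.<? M) c<M = ≈-refl
    ... | no c≮M  rewrite dec-false (c ℕ.<? M) c≮M | ℕ.m≤n⇒m⊔n≡n (ℕ.≮⇒≥ c≮M) = 𝔹-unmarked c t w

  ∑-unmarked M []            = +-identityʳ _
  ∑-unmarked M ((c , t) ∷ w) = begin
    ∑ (compositions (suc n)) (λ I → unmarkedWeight I M ((c , t) ∷ w))
      ≈⟨ ∑-compositions n _ (λ I → 𝟙 b · 𝟙 d · (- 1# * unmarkedWeight I (M ⊔ c) w))
           (≈-trans (𝟙-cong b (weight-[] t false _ (M ⊔ c) w)) (𝟙-0 b))
           step ⟩
    ∑ (compositions n) (λ I → 𝟙 not (not b) · weight I (M ⊔ c) w)
      + ∑ (compositions n) (λ I → 𝟙 b · 𝟙 d · (- 1# * unmarkedWeight I (M ⊔ c) w))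
      ≈⟨ +-cong (≈-trans (∑-𝟙 (compositions n) (not (not b)) _) (𝟙-cong (not (not b)) (∑-weight (M ⊔ c) w)))
             (≈-trans (∑-𝟙 (compositions n) b _) (𝟙-cong b
               (≈-trans (∑-𝟙 (compositions n) d _) (𝟙-cong d
                 (≈-trans (∑-*ˡ (compositions n) _ _) (*-congˡ (∑-unmarked (M ⊔ c) w))))))) ⟩
    𝟙 not (not b) · (𝔸 (M ⊔ c) w + u) + 𝟙 b · 𝟙 d · (- 1# * u)
      ≈⟨ below-head ⟩
    𝟙 b · 𝔹 M t w ∎
    where
    n = length w
    b = does (c ℕ.<? M)
    d = descends t w
    u = unmarked (M ⊔ c) w

    step : ∀ k I → unmarkedWeight (suc (suc k) ∷ I) M ((c , t) ∷ w) ≈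
      𝟙 b · 𝟙 d · (- 1# * unmarkedWeight (suc k ∷ I) (M ⊔ c) w)
    step k I = ≈-trans (𝟙-cong (not (not b ∨ hasRecord (suc k ∷ I) (M ⊔ c) w)) (weight-suc k I M c t w))
                     (split-unmarked b (hasRecord (suc k ∷ I) (M ⊔ c) w) d _)

    -- A letter below `M` leaves the maximum alone, so the same cancellation applies with `M` still
    -- as the color of the last record.
    below-head : 𝟙 not (not b) · (𝔸 (M ⊔ c) w + u) + 𝟙 b · 𝟙 d · (- 1# * u) ≈ 𝟙 b · 𝔹 M t w
    below-head with c ℕ.<? M
    ... | no c≮M  rewrite dec-false (c ℕ.<? M) c≮M = +-identityʳ _
    ... | yes c<M rewrite dec-true (c ℕ.<? M) c<M | ℕ.m≥n⇒m⊔n≡m (ℕ.<⇒≤ c<M) = 𝔹-unmarked M t w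

  -- At the start `M` is 0 and no color lies below it, so no first block is without a record.
  ∑-weight≈∑-pre : ∀ w → ∑ (compositions (length w)) (λ I → weight I 0 w)
                       ≈ ∑ (compositions (length w)) (λ I → pre I 0 w)
  ∑-weight≈∑-pre w = ≈-trans (∑-weight 0 w) (≈-trans (≈-trans (+-congˡ (none w)) (+-identityʳ _)) (≈-sym (∑-pre 0 w)))
    where
    none : ∀ w → unmarked 0 w ≈ 0#
    none []      = ≈-refl
    none (_ ∷ _) = ≈-refl

  -- The right-hand side

  coefficient-R : ∀ n I J w → coefficient (R n I J) w ≈
    ∑ (𝔖 n) (λ τ → 𝟙 does (descentComposition τ ≟ʷ I) ·
      ∑ (𝔖 n) (λ σ → 𝟙 does (saillance σ ≟ʷ J) · δ (zip σ τ) w))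
  coefficient-R n I J w = begin
    coefficient (R n I J) w
      ≈⟨ coefficient-⨁ (filter D? (𝔖 n)) _ w ⟩
    ∑ (filter D? (𝔖 n)) (λ τ → coefficient (⨁[ σ ∈ filter S? (𝔖 n) ] basis (zip σ τ)) w)
      ≈⟨ ∑-filter D? (𝔖 n) _ ⟩
    ∑ (𝔖 n) (λ τ → 𝟙 does (D? τ) · coefficient (⨁[ σ ∈ filter S? (𝔖 n) ] basis (zip σ τ)) w)
      ≈⟨ ∑-cong (𝔖 n) (λ {τ} _ → 𝟙-cong (does (D? τ)) (inner τ)) ⟩
    ∑ (𝔖 n) (λ τ → 𝟙 does (D? τ) · ∑ (𝔖 n) (λ σ → 𝟙 does (S? σ) · δ (zip σ τ) w)) ∎
    where
    D? = λ τ → descentComposition τ ≟ʷ I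
    S? = λ σ → saillance σ ≟ʷ J
    inner : ∀ τ → coefficient (⨁[ σ ∈ filter S? (𝔖 n) ] basis (zip σ τ)) w ≈ _
    inner τ = begin
      coefficient (⨁[ σ ∈ filter S? (𝔖 n) ] basis (zip σ τ)) w
        ≈⟨ coefficient-⨁ (filter S? (𝔖 n)) _ w ⟩
      ∑ (filter S? (𝔖 n)) (λ σ → coefficient (basis (zip σ τ)) w)
        ≈⟨ ∑-cong (filter S? (𝔖 n)) (λ {σ} _ → coefficient-basis (zip σ τ) w) ⟩
      ∑ (filter S? (𝔖 n)) (λ σ → δ (zip σ τ) w)
        ≈⟨ ∑-filter S? (𝔖 n) _ ⟩
      ∑ (𝔖 n) (λ σ → 𝟙 does (S? σ) · δ (zip σ τ) w) ∎

  module _ {n w} (σ∈ : colors w ∈ 𝔖 n) (τ∈ : numbers w ∈ 𝔖 n) where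

    coefficient-R-single : ∀ I J → coefficient (R n I J) w ≈
      𝟙 does (descentComposition (numbers w) ≟ʷ I) · 𝟙 does (saillance (colors w) ≟ʷ J) · 1#
    coefficient-R-single I J = ≈-trans (coefficient-R n I J w) (≈-trans
      (∑-single (𝔖-unique n) τ∈ λ {τ} τ∈′ τ≢ →
        ≈-trans (𝟙-cong (does (descentComposition τ ≟ʷ I)) (∑-zero (𝔖 n) λ {σ} σ∈′ →
          ≈-trans (𝟙-cong (does (saillance σ ≟ʷ J))
                    (δ-≢ λ e → τ≢ (trans (sym (numbers-zip σ τ (trans (∈𝔖-length n σ∈′) (sym (∈𝔖-length n τ∈′)))))
                                         (cong numbers e))))
                  (𝟙-0 (does (saillance σ ≟ʷ J)))))
          (𝟙-0 (does (descentComposition τ ≟ʷ I))))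
      (𝟙-cong (does (descentComposition (numbers w) ≟ʷ I)) (≈-trans
        (∑-single (𝔖-unique n) σ∈ λ {σ} σ∈′ σ≢ →
          ≈-trans (𝟙-cong (does (saillance σ ≟ʷ J))
                    (δ-≢ λ e → σ≢ (trans (sym (colors-zip σ (numbers w) (trans (∈𝔖-length n σ∈′) (sym (∈𝔖-length n τ∈)))))
                                         (cong colors e))))
                  (𝟙-0 (does (saillance σ ≟ʷ J))))
        (𝟙-cong (does (saillance (colors w) ≟ʷ J))
          (≡.subst (λ v → δ v w ≈ 1#) (sym (zip-colors-numbers w)) (δ-refl w))))))

    private
      length-w : length w ≡ n
      length-w = trans (sym (length-map proj₁ w)) (∈𝔖-length n σ∈)

    D∈ : descentComposition (numbers w) ∈ compositions n
    D∈ = compositions-complete n (subst (descentComposition (numbers w) ⊨_)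
           (∈𝔖-length n τ∈) (descentComposition-⊨ (numbers w)))

    S∈ : saillance (colors w) ∈ compositions n
    S∈ = compositions-complete n (subst (saillance (colors w) ⊨_) length-w (saillance-⊨ w))

    open DecSubset ℕ._≟_ using (_⊆?_)

    -- Only the descent composition of the numbers contributes as `I′`, and for it the inclusion of
    -- descent sets says that every block of `I` decreases.
    coefficient-Λ : ∀ {I} J → I ∈ compositions n → coefficient (Λ n I J) w ≈
      𝟙 decreasing I w · 𝟙 does (saillance (colors w) ≟ʷ J) · 1#
    coefficient-Λ {I} J I∈ = begin
      coefficient (Λ n I J) w
        ≈⟨ coefficient-⨁ (filter (λ I′ → nonDescents n I ⊆? Des I′) (compositions n)) _ w ⟩
      ∑ (filter (λ I′ → nonDescents n I ⊆? Des I′) (compositions n)) (λ I′ → coefficient (R n I′ J) w)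
        ≈⟨ ∑-filter (λ I′ → nonDescents n I ⊆? Des I′) (compositions n) _ ⟩
      ∑ (compositions n) (λ I′ → 𝟙 does (nonDescents n I ⊆? Des I′) · coefficient (R n I′ J) w)
        ≈⟨ ∑-cong (compositions n) (λ {I′} _ → 𝟙-cong (does (nonDescents n I ⊆? Des I′)) (coefficient-R-single I′ J)) ⟩
      ∑ (compositions n) (λ I′ → 𝟙 does (nonDescents n I ⊆? Des I′) · 𝟙 does (D₀ ≟ʷ I′) · s)
        ≈⟨ ∑-single (compositions-unique n) D∈ (λ {I′} _ ne → ≈-trans
             (𝟙-cong (does (nonDescents n I ⊆? Des I′))
               (reflexive (cong (𝟙_· s) (dec-false (D₀ ≟ʷ I′) (ne ∘ sym)))))
             (𝟙-0 (does (nonDescents n I ⊆? Des I′)))) ⟩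
      𝟙 does (nonDescents n I ⊆? Des D₀) · 𝟙 does (D₀ ≟ʷ D₀) · s
        ≈⟨ 𝟙-cong (does (nonDescents n I ⊆? Des D₀)) (reflexive (cong (𝟙_· s) (dec-true (D₀ ≟ʷ D₀) refl))) ⟩
      𝟙 does (nonDescents n I ⊆? Des D₀) · s
        ≡⟨ cong (𝟙_· s) does≡ ⟩
      𝟙 decreasing I w · s ∎
      where
      D₀ = descentComposition (numbers w)
      s = 𝟙 does (saillance (colors w) ≟ʷ J) · 1#

      I⊨ : I ⊨ length w
      I⊨ = subst (I ⊨_) (sym length-w) (compositions-sound n I∈)

      module D = Equivalence (decreasing-NonDescents⊆ I w I⊨)
      module N = Equivalence (nonDescents-⊆ n I (descents w))

      does≡ : does (nonDescents n I ⊆? Des D₀) ≡ decreasing I w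
      does≡ with decreasing I w in eq
      ... | true  = dec-true (nonDescents n I ⊆? Des D₀)
        (N.from (subst (NonDescents⊆ I (descents w)) length-w (D.to eq)))
      ... | false = dec-false (nonDescents n I ⊆? Des D₀) λ sub →
        contradiction (trans (sym eq) (D.from (subst (NonDescents⊆ I (descents w)) (sym length-w) (N.to sub)))) λ ()

    coefficient-right : coefficient (⨁[ I ∈ compositions n ] ⨁[ J ∈ compositions n ]
             ((- 1#) ^ (n ∸ length I) * q ^ D I J) • Λ n I J) w
      ≈ ∑ (compositions n) (λ I → weight I 0 w)
    coefficient-right = ≈-trans (coefficient-⨁ (compositions n) _ w) (∑-cong (compositions n) step)
      where
      S₀ = saillance (colors w)
      step : ∀ {I} → I ∈ compositions n →
        coefficient (⨁[ J ∈ compositions n ] ((- 1#) ^ (n ∸ length I) * q ^ D I J) • Λ n I J) w ≈ weight I 0 w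
      step {I} I∈ = begin
        coefficient (⨁[ J ∈ compositions n ] k J • Λ n I J) w
          ≈⟨ coefficient-⨁ (compositions n) _ w ⟩
        ∑ (compositions n) (λ J → coefficient (k J • Λ n I J) w)
          ≈⟨ ∑-cong (compositions n) (λ {J} _ → ≈-trans (coefficient-• (k J) (Λ n I J) w)
               (≈-trans (*-congˡ (coefficient-Λ J I∈)) (𝟙-* d _ _))) ⟩
        ∑ (compositions n) (λ J → 𝟙 d · (k J * 𝟙 does (S₀ ≟ʷ J) · 1#))
          ≈⟨ ∑-𝟙 (compositions n) d _ ⟩
        𝟙 d · ∑ (compositions n) (λ J → k J * 𝟙 does (S₀ ≟ʷ J) · 1#)
          ≈⟨ 𝟙-cong d (∑-single (compositions-unique n) S∈ λ {J} _ ne → ≈-trans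
               (*-congˡ (reflexive (cong (𝟙_· 1#) (dec-false (S₀ ≟ʷ J) (ne ∘ sym))))) (zeroʳ _)) ⟩
        𝟙 d · (k S₀ * 𝟙 does (S₀ ≟ʷ S₀) · 1#)
          ≈⟨ 𝟙-cong d (≈-trans (*-congˡ (reflexive (cong (𝟙_· 1#) (dec-true (S₀ ≟ʷ S₀) refl)))) (*-identityʳ _)) ⟩
        𝟙 d · k S₀
          ≡⟨ cong (λ e → 𝟙 d · ((- 1#) ^ e * q ^ D I S₀)) (sym (joins-∸ I⊨)) ⟩
        𝟙 d · ((- 1#) ^ joins I * q ^ D I S₀)
          ≡⟨ cong (λ e → 𝟙 d · ((- 1#) ^ joins I * q ^ e)) (D-exponent I w (subst (I ⊨_) (sym length-w) I⊨)) ⟩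
        weight I 0 w ∎
        where
        d = decreasing I w
        k : List ℕ → Carrier
        k J = (- 1#) ^ (n ∸ length I) * q ^ D I J
        I⊨ = compositions-sound n I∈

  coefficient-right-zero : ∀ {n w} → ¬ (colors w ∈ 𝔖 n × numbers w ∈ 𝔖 n) →
    coefficient (⨁[ I ∈ compositions n ] ⨁[ J ∈ compositions n ]
             ((- 1#) ^ (n ∸ length I) * q ^ D I J) • Λ n I J) w ≈ 0#
  coefficient-right-zero {n} {w} ∉ =
    ≈-trans (coefficient-⨁ (compositions n) _ w) (∑-zero (compositions n) λ {I} _ →
    ≈-trans (coefficient-⨁ (compositions n) _ w) (∑-zero (compositions n) λ {J} _ →
    ≈-trans (coefficient-• _ (Λ n I J) w) (≈-trans (*-congˡ
      (≈-trans (coefficient-⨁ (filter (λ I′ → nonDescents n I ⊆? Des I′) (compositions n)) _ w)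
        (∑-zero (filter (λ I′ → nonDescents n I ⊆? Des I′) (compositions n)) λ {I′} _ → R-zero I′ J)))
    (zeroʳ _))))
    where
    open DecSubset ℕ._≟_ using (_⊆?_)
    R-zero : ∀ I J → coefficient (R n I J) w ≈ 0#
    R-zero I J = ≈-trans (coefficient-R n I J w) (∑-zero (𝔖 n) λ {τ} τ∈ → ≈-trans
      (𝟙-cong (does (descentComposition τ ≟ʷ I)) (∑-zero (𝔖 n) λ {σ} σ∈ → ≈-trans
        (𝟙-cong (does (saillance σ ≟ʷ J)) (δ-≢ λ e →
          let l = trans (∈𝔖-length n σ∈) (sym (∈𝔖-length n τ∈)) in
          ∉ ( subst (_∈ 𝔖 n) (trans (sym (colors-zip σ τ l)) (cong colors e)) σ∈
            , subst (_∈ 𝔖 n) (trans (sym (numbers-zip σ τ l)) (cong numbers e)) τ∈)))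
        (𝟙-0 (does (saillance σ ≟ʷ J)))))
      (𝟙-0 (does (descentComposition τ ≟ʷ I))))

  -- q-brackets

  coefficient-·ʳ : ∀ B z v → coefficient (B · basis [ z ]) v ≈ ∑ B (λ (a , u) → a * δ (u ∷ʳ z) v)
  coefficient-·ʳ B z v = ≈-trans (coefficient-bilinear (λ u v → basis (u ++ v)) B (basis [ z ]) v)
    (∑-cong B λ {(a , u)} _ → ≈-trans (+-identityʳ _)
      (*-cong (*-identityʳ a) (coefficient-basis (u ∷ʳ z) v)))

  coefficient-·ˡ : ∀ B z v → coefficient (basis [ z ] · B) v ≈ ∑ B (λ (a , u) → a * δ (z ∷ u) v)
  coefficient-·ˡ B z v = ≈-trans (coefficient-bilinear (λ u v → basis (u ++ v)) (basis [ z ]) B v)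
    (≈-trans (+-identityʳ _)
      (∑-cong B λ {(a , u)} _ → *-cong (*-identityˡ a) (coefficient-basis (z ∷ u) v)))

  coefficient-bracket : ∀ B z v → coefficient [ B , basis [ z ] ]q v ≈
    ∑ B (λ (a , u) → a * δ (u ∷ʳ z) v) + - q * ∑ B (λ (a , u) → a * δ (z ∷ u) v)
  coefficient-bracket B z v = ≈-trans (coefficient-⊕ (B · basis [ z ]) _ v)
    (+-cong (coefficient-·ʳ B z v)
      (≈-trans (coefficient-• (- q) (basis [ z ] · B) v) (*-congˡ (coefficient-·ˡ B z v))))

  ∑-δ-zero : ∀ B (f : Biword → Biword) v → (∀ {t} → t ∈ B → f (proj₂ t) ≢ v) →
             ∑ B (λ (a , u) → a * δ (f u) v) ≈ 0#
  ∑-δ-zero B f v ne = ∑-zero B λ t∈ → ≈-trans (*-congˡ (δ-≢ (ne t∈))) (zeroʳ _)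

  ∑-δ-injective : ∀ B (f : Biword → Biword) v → (∀ {u} → f u ≡ f v → u ≡ v) →
                  ∑ B (λ (a , u) → a * δ (f u) (f v)) ≈ coefficient B v
  ∑-δ-injective B f v inj = ≈-trans (∑-cong B λ {(a , u)} _ → *-congˡ (δ-f u)) (≈-sym (coefficient-∑ B v))
    where
    δ-f : ∀ u → δ (f u) (f v) ≈ δ u v
    δ-f u with u ≟ᵇ v
    ... | yes refl = δ-refl (f u)
    ... | no u≢v   = δ-≢ (u≢v ∘ inj)

  -- The largest number `i` occurs once, and `u` is not empty, so the two halves of a q-bracket have
  -- no biword in common.
  ∷ʳ≢∷ : ∀ {i x y b} u → ValleyBelow i u → u ∷ʳ (x , i) ≢ (y , i) ∷ b
  ∷ʳ≢∷ []      (v , _)      _ = IsValley-≢[] v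
  ∷ʳ≢∷ (_ ∷ _) (_ , i< ∷ _) e = ℕ.<⇒≢ i< (cong proj₂ (∷-injectiveˡ e))

  ∷≢∷ʳ : ∀ {i x y u} b → ValleyBelow i u → All (_< i) (numbers b) → (x , i) ∷ u ≢ b ∷ʳ (y , i)
  ∷≢∷ʳ []      (v , _) _          e = IsValley-≢[] (subst IsValley (∷-injectiveʳ e) v)
  ∷≢∷ʳ (_ ∷ _) _       (b<i ∷ _) e = ℕ.<⇒≢ b<i (sym (cong proj₂ (∷-injectiveˡ e)))

  module _ {i B b} (B-valley : Supported (ValleyBelow i) B) (b<i : All (_< i) (numbers b)) where

    bracket-∷ʳ : ∀ x → coefficient [ B , basis [ (x , i) ] ]q (b ∷ʳ (x , i)) ≈ coefficient B b
    bracket-∷ʳ x = begin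
      coefficient [ B , basis [ (x , i) ] ]q (b ∷ʳ (x , i))
        ≈⟨ coefficient-bracket B (x , i) _ ⟩
      _ + _
        ≈⟨ +-cong (∑-δ-injective B (_∷ʳ (x , i)) b (∷ʳ-injectiveˡ _ _))
                  (≈-trans (*-congˡ (∑-δ-zero B ((x , i) ∷_) _ λ t∈ → ∷≢∷ʳ b (All.lookup B-valley t∈) b<i)) (zeroʳ _)) ⟩
      coefficient B b + 0#
        ≈⟨ +-identityʳ _ ⟩
      coefficient B b ∎

    bracket-∷ʳ-≢ : ∀ {x y} → x ≢ y → coefficient [ B , basis [ (x , i) ] ]q (b ∷ʳ (y , i)) ≈ 0#
    bracket-∷ʳ-≢ {x} {y} x≢y = begin
      coefficient [ B , basis [ (x , i) ] ]q (b ∷ʳ (y , i))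
        ≈⟨ coefficient-bracket B (x , i) _ ⟩
      _ + _
        ≈⟨ +-cong (∑-δ-zero B (_∷ʳ (x , i)) _ λ {(_ , u)} _ e → x≢y (cong proj₁ (∷ʳ-injectiveʳ u b e)))
                  (≈-trans (*-congˡ (∑-δ-zero B ((x , i) ∷_) _ λ t∈ → ∷≢∷ʳ b (All.lookup B-valley t∈) b<i)) (zeroʳ _)) ⟩
      0# + 0#
        ≈⟨ +-identityʳ _ ⟩
      0# ∎

    bracket-∷ : ∀ x → coefficient [ B , basis [ (x , i) ] ]q ((x , i) ∷ b) ≈ - q * coefficient B b
    bracket-∷ x = begin
      coefficient [ B , basis [ (x , i) ] ]q ((x , i) ∷ b)
        ≈⟨ coefficient-bracket B (x , i) _ ⟩
      _ + _
        ≈⟨ +-cong (∑-δ-zero B (_∷ʳ (x , i)) _ λ {(_ , u)} t∈ → ∷ʳ≢∷ u (All.lookup B-valley t∈))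
                  (*-congˡ (∑-δ-injective B ((x , i) ∷_) b ∷-injectiveʳ)) ⟩
      0# + - q * coefficient B b
        ≈⟨ +-identityˡ _ ⟩
      - q * coefficient B b ∎

    bracket-∷-≢ : ∀ {x y} → x ≢ y → coefficient [ B , basis [ (x , i) ] ]q ((y , i) ∷ b) ≈ 0#
    bracket-∷-≢ {x} {y} x≢y = begin
      coefficient [ B , basis [ (x , i) ] ]q ((y , i) ∷ b)
        ≈⟨ coefficient-bracket B (x , i) _ ⟩
      _ + _
        ≈⟨ +-cong (∑-δ-zero B (_∷ʳ (x , i)) _ λ {(_ , u)} t∈ → ∷ʳ≢∷ u (All.lookup B-valley t∈))
                  (≈-trans (*-congˡ (∑-δ-zero B ((x , i) ∷_) _ λ _ e → x≢y (cong proj₁ (∷-injectiveˡ e)))) (zeroʳ _)) ⟩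
      0# + 0#
        ≈⟨ +-identityʳ _ ⟩
      0# ∎

  Supported-bracket : ∀ {p p′} {P : Biword → Set p} {P′ : Biword → Set p′} {B z} →
    (∀ {u} → P u → P′ (u ∷ʳ z)) → (∀ {u} → P u → P′ (z ∷ u)) →
    Supported P B → Supported P′ [ B , basis [ z ] ]q
  Supported-bracket {P = P} {P′} {B} {z} ∷ʳ⁺ ∷⁺ ps = All.++⁺
    (Supported-bilinear {P = P} {P′ = _≡ [ z ]} {Q = P′} {f = λ u v → basis (u ++ v)} (λ { p refl → ∷ʳ⁺ p ∷ [] }) ps (refl ∷ []))
    (All.map⁺ (Supported-bilinear {P = _≡ [ z ]} {P′ = P} {Q = P′} {f = λ u v → basis (u ++ v)} (λ { refl p → ∷⁺ p ∷ [] }) (refl ∷ []) ps))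

  Supported-bracketFrom-valley : ∀ {i B} w → Supported (ValleyBelow i) B → Supported IsValley (bracketFrom i B w)
  Supported-bracketFrom-valley []      vs = All.map proj₁ vs
  Supported-bracketFrom-valley (x ∷ w) vs =
    Supported-bracketFrom-valley w (Supported-bracket ValleyBelow-∷ʳ ValleyBelow-∷ vs)

  Supported-bracketFrom-length : ∀ {i k B} w → Supported (λ s → length s ≡ k) B →
    Supported (λ s → length s ≡ length w ℕ.+ k) (bracketFrom i B w)
  Supported-bracketFrom-length         []      ls = ls
  Supported-bracketFrom-length {k = k} (x ∷ w) ls =
    All.map (λ e → trans e (ℕ.+-suc (length w) k))
      (Supported-bracketFrom-length w (Supported-bracket
        (λ {u} e → trans (length-++ u) (trans (ℕ.+-comm (length u) 1) (cong suc e))) (cong suc) ls))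

  Ψ-valley : ∀ u → Supported IsValley (Ψ u)
  Ψ-valley (x ∷ w) = Supported-bracketFrom-valley w (((_ , _ , _ , up [-]) , ℕ.≤-refl ∷ []) ∷ [])

  Ψ-length : ∀ u → Supported (λ s → length s ≡ List⁺.length u) (Ψ u)
  Ψ-length (x ∷ w) = All.map (λ e → trans e (ℕ.+-comm (length w) 1)) (Supported-bracketFrom-length w (refl ∷ []))

  -- The biletters outside b are added to b one by one in increasing order of their numbers, so
  -- that each of them determines a letter of word and a side.
  record Spread (i m : ℕ) (L R : Biword) : Set (c Level.⊔ ℓ) where
    field
      word      : Word
      word-↭    : word ↭ colors (L ++ R)
      at-word   : ∀ {B b} → Supported (ValleyBelow i) B → All (_< i) (numbers b) →
                  coefficient (bracketFrom i B word) (L ʳ++ (b ++ R)) ≈ (- q) ^ length L * coefficient B b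
      elsewhere : ∀ {B b w} → Supported (ValleyBelow i) B → All (_< i) (numbers b) →
                  length w ≡ m → w ≢ word → coefficient (bracketFrom i B w) (L ʳ++ (b ++ R)) ≈ 0#

  -- Both `L` and `R` list their letters from the middle outwards with increasing numbers, so the
  -- least number `i` heads one of them. Its color must be the next letter of the word, and its side
  -- decides between `- q` and 1.
  spread : ∀ i m L R → AllPairs _<_ (numbers L) → AllPairs _<_ (numbers R) →
           numbers (L ++ R) ↭ range i m → Spread i m L R
  spread i zero L R _ _ p with L ++ R in e | ++-conicalˡ L R | ++-conicalʳ L R
  spread i zero L R _ _ p | _ ∷ _ | _ | _ = contradiction (↭-empty-inv p) λ ()
  spread i zero L R _ _ p | []    | l | r with refl ← l refl | refl ← r refl = record
    { word      = []
    ; word-↭    = ↭-refl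
    ; at-word   = λ {B} {b} _ _ → ≈-trans (reflexive (cong (coefficient B) (++-identityʳ b))) (≈-sym (*-identityˡ _))
    ; elsewhere = λ { {w = []} _ _ _ w≢ → contradiction refl w≢ ; {w = _ ∷ _} _ _ () _ }
    }
  spread i (suc m) L R L-inc R-inc p
    with ∈-++⁻ (numbers L) (subst (i ∈_) (map-++ proj₂ L R) (∈-resp-↭ (↭-sym p) (here refl)))
       | All.++⁻ (numbers L) (subst (All (i ≤_)) (map-++ proj₂ L R) (All-resp-↭ (↭-sym p) (range-≥ i (suc m))))
  ... | inj₁ i∈L | ≥L , _ with least-first L i∈L L-inc ≥L
  ...   | y , L′ , refl = record
    { word      = y ∷ S.word
    ; word-↭    = ↭-prep y S.word-↭
    ; at-word   = λ {B} {b} vs b<i → begin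
        coefficient (bracketFrom (suc i) [ B , basis [ (y , i) ] ]q S.word) (L′ ʳ++ ((y , i) ∷ b ++ R))
          ≈⟨ S.at-word (grow vs) (widen b<i) ⟩
        (- q) ^ length L′ * coefficient [ B , basis [ (y , i) ] ]q ((y , i) ∷ b)
          ≈⟨ *-congˡ (bracket-∷ vs b<i y) ⟩
        (- q) ^ length L′ * (- q * coefficient B b)
          ≈⟨ ≈-trans (x∙yz≈y∙xz _ _ _) (≈-sym (*-assoc _ _ _)) ⟩
        (- q) ^ suc (length L′) * coefficient B b ∎
    ; elsewhere = λ { {w = []} _ _ () ; {w = _ ∷ w} vs b<i e w≢ → other {w = w} vs b<i e w≢ }
    }
    where
    module S = Spread (spread (suc i) m L′ R (AllPairs.tail L-inc) R-inc (drop-∷ p))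
    grow : ∀ {B x} → Supported (ValleyBelow i) B → Supported (ValleyBelow (suc i)) [ B , basis [ (x , i) ] ]q
    grow = Supported-bracket ValleyBelow-∷ʳ ValleyBelow-∷
    widen : ∀ {b} → All (_< i) (numbers b) → All (_< suc i) (i ∷ numbers b)
    widen b<i = ℕ.≤-refl ∷ All.map ℕ.m≤n⇒m≤1+n b<i
    other : ∀ {B b x w} → Supported (ValleyBelow i) B → All (_< i) (numbers b) → suc (length w) ≡ suc m →
            _≢_ {A = Word} (x ∷ w) (y ∷ S.word) →
            coefficient (bracketFrom (suc i) [ B , basis [ (x , i) ] ]q w) (L′ ʳ++ ((y , i) ∷ b ++ R)) ≈ 0#
    other {x = x} {w} vs b<i e w≢ with w ≟ʷ S.word
    ... | no w≢′   = S.elsewhere (grow vs) (widen b<i) (ℕ.suc-injective e) w≢′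
    ... | yes refl = ≈-trans (S.at-word (grow vs) (widen b<i))
      (≈-trans (*-congˡ (bracket-∷-≢ vs b<i (λ { refl → w≢ refl }))) (zeroʳ _))
  spread i (suc m) L R L-inc R-inc p | inj₂ i∈R | _ , ≥R with least-first R i∈R R-inc ≥R
  ...   | y , R′ , refl = record
    { word      = y ∷ S.word
    ; word-↭    = ↭-trans (↭-prep y S.word-↭) (map⁺ proj₁ (↭-sym (shift (y , i) L R′)))
    ; at-word   = λ {B} {b} vs b<i → begin
        coefficient (bracketFrom (suc i) [ B , basis [ (y , i) ] ]q S.word) (L ʳ++ (b ++ (y , i) ∷ R′))
          ≡⟨ cong (λ s → coefficient (bracketFrom (suc i) [ B , basis [ (y , i) ] ]q S.word) (L ʳ++ s)) (sym (∷ʳ-++ b (y , i) R′)) ⟩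
        coefficient (bracketFrom (suc i) [ B , basis [ (y , i) ] ]q S.word) (L ʳ++ (b ∷ʳ (y , i) ++ R′))
          ≈⟨ S.at-word (grow vs) (widen b b<i) ⟩
        (- q) ^ length L * coefficient [ B , basis [ (y , i) ] ]q (b ∷ʳ (y , i))
          ≈⟨ *-congˡ (bracket-∷ʳ vs b<i y) ⟩
        (- q) ^ length L * coefficient B b ∎
    ; elsewhere = λ { {w = []} _ _ () ; {w = _ ∷ w} vs b<i e w≢ → other {w = w} vs b<i e w≢ }
    }
    where
    module S = Spread (spread (suc i) m L R′ L-inc (AllPairs.tail R-inc)
                 (drop-∷ (↭-trans (map⁺ proj₂ (↭-sym (shift (y , i) L R′))) p)))
    grow : ∀ {B x} → Supported (ValleyBelow i) B → Supported (ValleyBelow (suc i)) [ B , basis [ (x , i) ] ]q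
    grow = Supported-bracket ValleyBelow-∷ʳ ValleyBelow-∷
    widen : ∀ b → All (_< i) (numbers b) → All (_< suc i) (numbers (b ∷ʳ (y , i)))
    widen b b<i = subst (All (_< suc i)) (sym (map-++ proj₂ b _))
      (All.∷ʳ⁺ (All.map ℕ.m≤n⇒m≤1+n b<i) ℕ.≤-refl)
    other : ∀ {B b x w} → Supported (ValleyBelow i) B → All (_< i) (numbers b) → suc (length w) ≡ suc m →
            _≢_ {A = Word} (x ∷ w) (y ∷ S.word) →
            coefficient (bracketFrom (suc i) [ B , basis [ (x , i) ] ]q w) (L ʳ++ (b ++ (y , i) ∷ R′)) ≈ 0#
    other {B} {b} {x} {w} vs b<i e w≢ rewrite sym (∷ʳ-++ b (y , i) R′) with w ≟ʷ S.word
    ... | no w≢′   = S.elsewhere (grow vs) (widen b b<i) (ℕ.suc-injective e) w≢′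
    ... | yes refl = ≈-trans (S.at-word (grow vs) (widen b b<i))
      (≈-trans (*-congˡ (bracket-∷ʳ-≢ vs b<i (λ { refl → w≢ refl }))) (zeroʳ _))

  -- The coefficients of `Ψ`

  Ψ-nonvalley : ∀ u {s} → ¬ IsValley s → coefficient (Ψ u) (stdᵇ s) ≈ 0#
  Ψ-nonvalley u {s} ¬v = coefficient-zero {P = IsValley} (Ψ-valley u)
    (¬v ∘ IsValley-unmap s (rank-monotone (numbers s)) id)

  -- Inversion of `Ψ` on words of a given length: only one of them contains the standardization of
  -- `s`, namely the color of the minimum followed by the other colors in the order of their
  -- numbers.
  record Preimage (L : Biword) (b : ℕ × ℕ) (R s : Biword) : Set (c Level.⊔ ℓ) where
    field
      tail      : Word
      tail-↭    : tail ↭ colors (L ++ R)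
      at-tail   : coefficient (Ψ (proj₁ b ∷ tail)) (stdᵇ s) ≈ (- q) ^ length L
      elsewhere : ∀ u → List⁺.length u ≡ length s → u ≢ proj₁ b ∷ tail → coefficient (Ψ u) (stdᵇ s) ≈ 0#

  preimage : ∀ {L b R s} → Unique (numbers s) → Valley L b R s → Preimage L b R s
  preimage {s = []} _ ()
  preimage {L} {b@(c , t)} {R} {s@(_ ∷ s′)} uniq v with Valley-least v′ perm
    where
    f = rank (numbers s)
    v′ = Valley-map (rank-monotone (numbers s)) id v
    perm : numbers (stdᵇ s) ↭ range 1 (suc (length s′))
    perm = subst₂ (λ u k → u ↭ range 1 k) (sym (numbers-stdᵇ s)) (length-numbers s) (std-↭ uniq)
  ... | ft≡1 , perm′ = record
    { tail      = S.word
    ; tail-↭    = subst (S.word ↭_) (trans (cong colors (sym (map-++ (map₂ f) L R))) (colors-map₂ f (L ++ R))) S.word-↭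
    ; at-tail   = begin
        coefficient (Ψ (c ∷ S.word)) (stdᵇ s)
          ≡⟨ cong (coefficient (Ψ (c ∷ S.word))) std≡ ⟩
        coefficient (Ψ (c ∷ S.word)) (L′ ʳ++ ((c , 1) ∷ R′))
          ≈⟨ S.at-word (single-valley c) (ℕ.≤-refl ∷ []) ⟩
        (- q) ^ length L′ * coefficient (basis [ (c , 1) ]) [ (c , 1) ]
          ≈⟨ *-cong (reflexive (cong ((- q) ^_) (length-map (map₂ f) L)))
                    (≈-trans (coefficient-basis [ (c , 1) ] [ (c , 1) ]) (δ-refl [ (c , 1) ])) ⟩
        (- q) ^ length L * 1#
          ≈⟨ *-identityʳ _ ⟩
        (- q) ^ length L ∎
    ; elsewhere = λ { (x ∷ w) e u≢ → ≈-trans (reflexive (cong (coefficient (Ψ (x ∷ w))) std≡)) (other x w e u≢) }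
    }
    where
    f  = rank (numbers s)
    L′ = map (map₂ f) L
    R′ = map (map₂ f) R
    v′ : Valley L′ (map₂ f b) R′ (stdᵇ s)
    v′ = Valley-map (rank-monotone (numbers s)) id v

    -- Standardization gives the minimum the number 1, that of the biletter with which `Ψ` starts.
    std≡ : stdᵇ s ≡ L′ ʳ++ ((c , 1) ∷ R′)
    std≡ = trans (Valley-ʳ++ v′) (cong (λ j → L′ ʳ++ ((c , j) ∷ R′)) ft≡1)

    module S = Spread (spread 2 (length s′) L′ R′ (AllPairs.tail (Valley-left v′))
                         (AllPairs.tail (Linked⇒AllPairs ℕ.<-trans (Valley-right v′))) perm′)

    single-valley : ∀ x → Supported (ValleyBelow 2) (basis [ (x , 1) ])
    single-valley x = ((_ , _ , _ , up [-]) , ℕ.≤-refl ∷ []) ∷ []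

    other : ∀ x w → suc (length w) ≡ suc (length s′) → (x List⁺.∷ w) ≢ (c List⁺.∷ S.word) →
            coefficient (Ψ (x ∷ w)) (L′ ʳ++ ((c , 1) ∷ R′)) ≈ 0#
    other x w e u≢ with w ≟ʷ S.word
    ... | no w≢    = S.elsewhere (single-valley x) (ℕ.≤-refl ∷ []) (ℕ.suc-injective e) w≢
    ... | yes refl = ≈-trans (S.at-word (single-valley x) (ℕ.≤-refl ∷ [])) (≈-trans
      (*-congˡ (≈-trans (coefficient-basis [ (x , 1) ] [ (c , 1) ]) (δ-≢ {[ (x , 1) ]} {[ (c , 1) ]} λ { refl → u≢ refl }))) (zeroʳ _))

  -- Products

  -- A term of a product determines both factors: their colors by position, their numbers by
  -- standardizing prefix and suffix.
  product-factors : ∀ u v w {γ} → γ ∈ numbers u ∗ numbers v → zip (colors u ++ colors v) γ ≡ w →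
    numbers w ∈ 𝔖 (length u ℕ.+ length v) × u ≡ stdᵇ (take (length u) w) × v ≡ stdᵇ (drop (length u) w)
  product-factors u v w {γ} γ∈ e
    with ∈-filter⁻ (λ γ → (std (take (length (numbers u)) γ) ≟ʷ numbers u)
                          ×-dec (std (drop (length (numbers u)) γ) ≟ʷ numbers v))
                   {xs = 𝔖 (length (numbers u) ℕ.+ length (numbers v))} γ∈
  ... | γ∈𝔖 , std-take , std-drop rewrite length-numbers u | length-numbers v =
    subst (λ γ → γ ∈ 𝔖 (length u ℕ.+ length v)) γ≡ γ∈𝔖 ,
    factor u (take (length u) w)
      (trans (sym (take-++-length (colors u) (colors v)))
        (trans (cong₂ take (length-colors u) colors≡) (take-map (length u) w)))
      (trans (sym std-take) (cong std (trans (cong (take (length u)) γ≡) (take-map (length u) w)))) ,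
    factor v (drop (length u) w)
      (trans (sym (drop-++-length (colors u) (colors v)))
        (trans (cong₂ drop (length-colors u) colors≡) (drop-map (length u) w)))
      (trans (sym std-drop) (cong std (trans (cong (drop (length u)) γ≡) (drop-map (length u) w))))
    where
    lengths : length (colors u ++ colors v) ≡ length γ
    lengths = trans (length-++ (colors u))
      (trans (cong₂ ℕ._+_ (length-colors u) (length-colors v)) (sym (∈𝔖-length _ γ∈𝔖)))
    γ≡ : γ ≡ numbers w
    γ≡ = trans (sym (numbers-zip _ γ lengths)) (cong numbers e)
    colors≡ : colors u ++ colors v ≡ colors w
    colors≡ = trans (sym (colors-zip _ γ lengths)) (cong colors e)
    factor : ∀ u w → colors u ≡ colors w → numbers u ≡ std (numbers w) → u ≡ stdᵇ w
    factor u w ec en = trans (sym (zip-colors-numbers u)) (trans (cong₂ zip ec en) (sym (stdᵇ-zip w)))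

  product : Biword → Biword → Combination
  product u v = ⨁[ γ ∈ numbers u ∗ numbers v ] basis (zip (colors u ++ colors v) γ)

  coefficient-product : ∀ u v w → coefficient (product u v) w
    ≈ ∑ (numbers u ∗ numbers v) (λ γ → δ (zip (colors u ++ colors v) γ) w)
  coefficient-product u v w = ≈-trans (coefficient-⨁ (numbers u ∗ numbers v) _ w)
    (∑-cong (numbers u ∗ numbers v) λ {γ} _ → coefficient-basis (zip (colors u ++ colors v) γ) w)

  coefficient-product-zero : ∀ u v w → ¬ (numbers w ∈ 𝔖 (length u ℕ.+ length v)
      × u ≡ stdᵇ (take (length u) w) × v ≡ stdᵇ (drop (length u) w)) →
    coefficient (product u v) w ≈ 0#
  coefficient-product-zero u v w ¬f = ≈-trans (coefficient-product u v w)
    (∑-zero (numbers u ∗ numbers v) λ γ∈ → δ-≢ (¬f ∘ product-factors u v w γ∈))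

  coefficient-product-one : ∀ a w → length (take a w) ≡ a → numbers w ∈ 𝔖 (length w) →
    coefficient (product (stdᵇ (take a w)) (stdᵇ (drop a w))) w ≈ 1#
  coefficient-product-one a w len w∈ = begin
    coefficient (product u v) w
      ≈⟨ coefficient-product u v w ⟩
    ∑ (numbers u ∗ numbers v) (λ γ → δ (zip (colors u ++ colors v) γ) w)
      ≈⟨ ∑-single {f = λ γ → δ (zip (colors u ++ colors v) γ) w}
           (Unique.filter⁺ P? (𝔖-unique (length (numbers u) ℕ.+ length (numbers v)))) γ∈
           (λ {γ} γ∈′ γ≢ → δ-≢ λ e →
           γ≢ (trans (sym (numbers-zip (colors u ++ colors v) γ (lengths γ γ∈′))) (cong numbers e))) ⟩
    δ (zip (colors u ++ colors v) (numbers w)) w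
      ≡⟨ cong (λ x → δ x w) (trans (cong (λ x → zip x (numbers w)) colors≡) (zip-colors-numbers w)) ⟩
    δ w w
      ≈⟨ δ-refl w ⟩
    1# ∎
    where
    u = stdᵇ (take a w)
    v = stdᵇ (drop a w)

    P? = λ γ → (std (take (length (numbers u)) γ) ≟ʷ numbers u)
               ×-dec (std (drop (length (numbers u)) γ) ≟ʷ numbers v)

    length-u : length (numbers u) ≡ a
    length-u = trans (length-numbers u) (trans (length-map _ (take a w)) len)

    total : length (numbers u) ℕ.+ length (numbers v) ≡ length w
    total = trans (sym (length-++ (numbers u))) (trans (cong length (sym (map-++ proj₂ u v)))
      (trans (length-numbers (u ++ v)) (trans (length-++ u) (trans
        (cong₂ ℕ._+_ (length-map _ (take a w)) (length-map _ (drop a w)))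
        (trans (sym (length-++ (take a w))) (cong length (take++drop≡id a w)))))))

    γ∈ : numbers w ∈ numbers u ∗ numbers v
    γ∈ = ∈-filter⁺ P? (subst (λ n → numbers w ∈ 𝔖 n) (sym total) w∈)
      ( trans (cong std (trans (cong (λ k → take k (numbers w)) length-u) (take-map a w))) (sym (numbers-stdᵇ (take a w)))
      , trans (cong std (trans (cong (λ k → drop k (numbers w)) length-u) (drop-map a w))) (sym (numbers-stdᵇ (drop a w))))

    colors≡ : colors u ++ colors v ≡ colors w
    colors≡ = trans (cong₂ _++_ (colors-stdᵇ (take a w)) (colors-stdᵇ (drop a w)))
      (trans (sym (map-++ proj₁ (take a w) (drop a w))) (cong colors (take++drop≡id a w)))

    lengths : ∀ γ → γ ∈ numbers u ∗ numbers v → length (colors u ++ colors v) ≡ length γ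
    lengths γ γ∈′ = trans (cong length colors≡) (trans (length-colors w)
      (trans (sym total) (sym (∗-length (numbers u) (numbers v) γ∈′))))

  OfLength : ℕ → Biword → Set
  OfLength n s = length s ≡ n

  module _ {a b X Y} (X-len : Supported (OfLength a) X) (Y-len : Supported (OfLength b) Y) where

    coefficient-⊛-zero : ∀ w → numbers w ∉ 𝔖 (a ℕ.+ b) → coefficient (X ⊛ Y) w ≈ 0#
    coefficient-⊛-zero w w∉ = ≈-trans (coefficient-bilinear product X Y w)
      (∑-zero X λ {(_ , u)} u∈ → ∑-zero Y λ {(_ , v)} v∈ → ≈-trans
        (*-congˡ (coefficient-product-zero u v w λ (w∈ , _) →
          w∉ (subst₂ (λ a b → numbers w ∈ 𝔖 (a ℕ.+ b)) (All.lookup X-len u∈) (All.lookup Y-len v∈) w∈)))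
        (zeroʳ _))

    -- The product is dual to cutting: a biword arises from exactly one pair of factors of lengths
    -- `a` and `b`, with coefficient 1, so the double sum has a single term.
    coefficient-⊛ : ∀ w → numbers w ∈ 𝔖 (a ℕ.+ b) → coefficient (X ⊛ Y) w ≈
      coefficient X (stdᵇ (take a w)) * coefficient Y (stdᵇ (drop a w))
    coefficient-⊛ w w∈ = begin
      coefficient (X ⊛ Y) w
        ≈⟨ coefficient-bilinear product X Y w ⟩
      ∑ X (λ (k , u) → ∑ Y (λ (l , v) → (k * l) * coefficient (product u v) w))
        ≈⟨ ∑-cong X (λ {(k , u)} u∈ → ∑-cong Y (λ {(l , v)} v∈ →
             ≈-trans (*-congˡ (factor u v (All.lookup X-len u∈))) (interchange k l _ _))) ⟩
      ∑ X (λ (k , u) → ∑ Y (λ (l , v) → (k * δ u s) * (l * δ v t)))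
        ≈⟨ ∑-cong X (λ {(k , u)} _ → ≈-trans (∑-*ˡ Y _ _) (*-congˡ (≈-sym (coefficient-∑ Y t)))) ⟩
      ∑ X (λ (k , u) → (k * δ u s) * coefficient Y t)
        ≈⟨ ≈-trans (∑-*ʳ X _ _) (*-congʳ (≈-sym (coefficient-∑ X s))) ⟩
      coefficient X s * coefficient Y t ∎
      where
      s = stdᵇ (take a w)
      t = stdᵇ (drop a w)

      length-w : length w ≡ a ℕ.+ b
      length-w = trans (sym (length-numbers w)) (∈𝔖-length _ w∈)

      take-length : length (take a w) ≡ a
      take-length = trans (length-take a w) (trans (cong (a ℕ.⊓_) length-w) (ℕ.m≤n⇒m⊓n≡m (ℕ.m≤m+n a b)))

      factor : ∀ u v → length u ≡ a → coefficient (product u v) w ≈ δ u s * δ v t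
      factor u v refl with u ≟ᵇ s | v ≟ᵇ t
      ... | no u≢  | _      = ≈-trans (coefficient-product-zero u v w λ (_ , e , _) → u≢ e) (≈-sym (zeroˡ _))
      ... | yes _  | no v≢  = ≈-trans (coefficient-product-zero u v w λ (_ , _ , e) → v≢ e) (≈-sym (zeroʳ _))
      ... | yes u≡ | yes v≡ = ≈-trans
        (reflexive (cong₂ (λ x y → coefficient (product x y) w) u≡ v≡))
        (≈-trans (coefficient-product-one a w take-length (subst (λ n → numbers w ∈ 𝔖 n) (sym length-w) w∈))
                 (≈-sym (*-identityˡ 1#)))

    Supported-⊛ : Supported (OfLength (a ℕ.+ b)) (X ⊛ Y)
    Supported-⊛ = Supported-bilinear {Q = OfLength (a ℕ.+ b)} {f = product}
      (λ {u} {v} eu ev → All.concat⁺ (All.map⁺ (All.tabulate λ {γ} γ∈ → zip-length u v γ γ∈ eu ev ∷ []))) X-len Y-len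
      where
      zip-length : ∀ u v γ → γ ∈ numbers u ∗ numbers v → length u ≡ a → length v ≡ b →
                   length (zip (colors u ++ colors v) γ) ≡ a ℕ.+ b
      zip-length u v γ γ∈ refl refl =
        trans (sym (length-numbers (zip (colors u ++ colors v) γ)))
          (trans (cong length (numbers-zip (colors u ++ colors v) γ
            (trans (length-++ (colors u)) (trans (cong₂ ℕ._+_ (length-colors u) (length-colors v)) (sym e)))))
            e)
        where
        e : length γ ≡ length u ℕ.+ length v
        e = trans (∗-length (numbers u) (numbers v) γ∈) (cong₂ ℕ._+_ (length-numbers u) (length-numbers v))

  Ψs : List (List⁺ ℕ) → Combination
  Ψs = foldr (λ u x → Ψ u ⊛ x) (basis [])

  size : List (List⁺ ℕ) → ℕ
  size fs = sum (map List⁺.length fs)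

  Ψs-length : ∀ fs → Supported (OfLength (size fs)) (Ψs fs)
  Ψs-length []       = refl ∷ []
  Ψs-length (u ∷ fs) = Supported-⊛ (Ψ-length u) (Ψs-length fs)

  -- The coefficient of `w` in the product of the `Ψ` of the words, written block by block. It makes
  -- sense for suffixes of a permutation too, which is what the induction on blocks needs.
  Φ : List (List⁺ ℕ) → Biword → Carrier
  Φ []       w = 1#
  Φ (u ∷ fs) w = coefficient (Ψ u) (stdᵇ (take (List⁺.length u) w)) * Φ fs (drop (List⁺.length u) w)

  drop-size : ∀ u fs (w : Biword) → length w ≡ size (u ∷ fs) → length (drop (List⁺.length u) w) ≡ size fs
  drop-size u fs w e = trans (length-drop (List⁺.length u) w) (trans (cong (_∸ List⁺.length u) e) (ℕ.m+n∸m≡n (List⁺.length u) (size fs)))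

  coefficient-Ψs-std : ∀ fs w → Unique (numbers w) → length w ≡ size fs → coefficient (Ψs fs) (stdᵇ w) ≈ Φ fs w
  coefficient-Ψs-std []       []      _    _ = ≈-trans (coefficient-basis [] []) (δ-refl [])
  coefficient-Ψs-std []       (_ ∷ _) _    ()
  coefficient-Ψs-std (u ∷ fs) w       uniq e = begin
    coefficient (Ψ u ⊛ Ψs fs) (stdᵇ w)
      ≈⟨ coefficient-⊛ (Ψ-length u) (Ψs-length fs) (stdᵇ w) (subst₂ (λ x n → x ∈ 𝔖 n) (sym (numbers-stdᵇ w))
           (trans (length-numbers w) e) (std-∈𝔖 uniq)) ⟩
    coefficient (Ψ u) (stdᵇ (take k (stdᵇ w))) * coefficient (Ψs fs) (stdᵇ (drop k (stdᵇ w)))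
      ≡⟨ cong₂ (λ x y → coefficient (Ψ u) x * coefficient (Ψs fs) y) (stdᵇ-take k w) (stdᵇ-drop k w) ⟩
    coefficient (Ψ u) (stdᵇ (take k w)) * coefficient (Ψs fs) (stdᵇ (drop k w))
      ≈⟨ *-congˡ (coefficient-Ψs-std fs (drop k w) (subst Unique (drop-map k w) (Unique.drop⁺ k uniq)) (drop-size u fs w e)) ⟩
    Φ (u ∷ fs) w ∎
    where k = List⁺.length u

  coefficient-Ψs : ∀ u fs w → numbers w ∈ 𝔖 (size (u ∷ fs)) → coefficient (Ψs (u ∷ fs)) w ≈ Φ (u ∷ fs) w
  coefficient-Ψs u fs w w∈ = ≈-trans (coefficient-⊛ (Ψ-length u) (Ψs-length fs) w w∈)
    (*-congˡ (coefficient-Ψs-std fs (drop k w)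
      (subst Unique (drop-map k w) (Unique.drop⁺ k (proj₁ (∈𝔖⁻ (size (u ∷ fs)) w∈))))
      (drop-size u fs w (trans (sym (length-numbers w)) (∈𝔖-length (size (u ∷ fs)) w∈)))))
    where k = List⁺.length u

  -- The left-hand side

  post-increasing : ∀ I c t R w → Linked _<_ (t ∷ numbers R) → All (λ x → proj₁ x < c) R →
                    post (suc (length R) ∷ I) c t (R ++ w) ≡ pre I c w
  post-increasing I c t []              w _           _           = refl
  post-increasing I c t ((c′ , t′) ∷ R) w (t<t′ ∷ inc) (c′<c ∷ <c)
    rewrite dec-true (t ℕ.<? t′) t<t′ | dec-true (c′ ℕ.<? c) c′<c = post-increasing I c t′ R w inc <c

  post-zero : ∀ I c t R w → ¬ (Linked _<_ (t ∷ numbers R) × All (λ x → proj₁ x < c) R) →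
              post (suc (length R) ∷ I) c t (R ++ w) ≡ 0#
  post-zero I c t []              w no-inc = contradiction ([-] , []) no-inc
  post-zero I c t ((c′ , t′) ∷ R) w no-inc with t ℕ.<? t′ | c′ ℕ.<? c
  ... | no t≮  | _      rewrite dec-false (t ℕ.<? t′) t≮ = refl
  ... | yes t< | no c≮  rewrite dec-false (c′ ℕ.<? c) c≮ | ∧-zeroʳ (does (t ℕ.<? t′)) = refl
  ... | yes t< | yes c< rewrite dec-true (t ℕ.<? t′) t< | dec-true (c′ ℕ.<? c) c< =
    post-zero I c t′ R w λ (inc , <c) → no-inc (t< ∷ inc , c< ∷ <c)

  -- `x` cannot be the minimum, since the block would have to ascend after it; only the summand
  -- where the minimum is still to come survives.
  pre-descent : ∀ I M x y s w → proj₂ y < proj₂ x → let k = length s in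
    pre (suc (suc k) ∷ I) M (x ∷ y ∷ s ++ w) ≈ - q * pre (suc k ∷ I) (M ⊔ proj₁ x) (y ∷ s ++ w)
  pre-descent I M x@(c , t) y@(c′ , t′) s w t′<t
    rewrite dec-false (t ℕ.<? t′) (ℕ.<⇒≯ t′<t) =
    ≈-trans (+-congʳ (𝟙-0 (not (does (c ℕ.<? M))))) (+-identityˡ _)

  pre-ascent : ∀ I M x y s w → proj₂ x < proj₂ y → let k = length s in
    pre (suc (suc k) ∷ I) M (x ∷ y ∷ s ++ w) ≈
    𝟙 not (does (proj₁ x ℕ.<? M)) · post (suc (suc k) ∷ I) (proj₁ x) (proj₂ x) (y ∷ s ++ w)
  pre-ascent I M x@(c , t) y@(c′ , t′) s w t<t′
    rewrite dec-true (t ℕ.<? t′) t<t′ = +-identityʳ _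

  pre-up : ∀ I M b R w → Linked _<_ (numbers (b ∷ R)) →
    pre (suc (length R) ∷ I) M (b ∷ R ++ w) ≈
    𝟙 not (does (proj₁ b ℕ.<? M)) · post (suc (length R) ∷ I) (proj₁ b) (proj₂ b) (R ++ w)
  pre-up I M b []      w _         = ≈-refl
  pre-up I M b (y ∷ R) w (t<t′ ∷ _) = pre-ascent I M b y R w t<t′

  pre-nonvalley : ∀ I M s w → s ≢ [] → Unique (numbers s) → ¬ IsValley s →
                  pre (length s ∷ I) M (s ++ w) ≈ 0#
  pre-nonvalley I M []                   w ne _ _  = contradiction refl ne
  pre-nonvalley I M (x ∷ [])             w _  _ ¬v = contradiction (_ , _ , _ , up [-]) ¬v
  pre-nonvalley I M (x ∷ y ∷ s) w _ ((x≢y ∷ _) ∷ uniq) ¬v with ℕ.<-cmp (proj₂ x) (proj₂ y)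
  ... | tri≈ _ x≡y _ = contradiction x≡y x≢y
  ... | tri> _ _ y<x = ≈-trans (pre-descent I M x y s w y<x) (≈-trans
    (*-congˡ (pre-nonvalley I (M ⊔ proj₁ x) (y ∷ s) w (λ ()) uniq
      λ (_ , _ , _ , v) → ¬v (_ , _ , _ , down y<x v)))
    (zeroʳ _))
  ... | tri< x<y _ _ = ≈-trans (pre-ascent I M x y s w x<y) (≈-trans
    (𝟙-cong (not (does (proj₁ x ℕ.<? M))) (reflexive
      (post-zero I (proj₁ x) (proj₂ x) (y ∷ s) w λ (inc , _) → ¬v (_ , _ , _ , up inc))))
    (𝟙-0 (not (does (proj₁ x ℕ.<? M)))))

  -- As the color of the minimum exceeds the rest of the block and is at least `M`, it is the
  -- maximum handed on to the next block.
  pre-valley : ∀ I M w {L b R s} → Valley L b R s → M ≤ proj₁ b → Dominates b L → Dominates b R →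
    pre (length s ∷ I) M (s ++ w) ≈ (- q) ^ length L * pre I (proj₁ b) w
  pre-valley I M w (up {b} {R} inc) M≤b _ domR = ≈-trans (pre-up I M b R w inc) (begin
    𝟙 not (does (proj₁ b ℕ.<? M)) · post (suc (length R) ∷ I) (proj₁ b) (proj₂ b) (R ++ w)
      ≡⟨ cong₂ 𝟙_·_ (cong not (dec-false (proj₁ b ℕ.<? M) (ℕ.≤⇒≯ M≤b)))
                    (post-increasing I (proj₁ b) (proj₂ b) R w inc domR) ⟩
    pre I (proj₁ b) w
      ≈⟨ ≈-sym (*-identityˡ _) ⟩
    1# * pre I (proj₁ b) w ∎)
  pre-valley I M w (down {L} {b} {R} {x} {y} {s} y<x v) M≤b domL domR with All.∷ʳ⁻ domL
  ... | domL′ , x<b = begin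
    pre (length (x ∷ y ∷ s) ∷ I) M (x ∷ y ∷ s ++ w)
      ≈⟨ pre-descent I M x y s w y<x ⟩
    - q * pre (length (y ∷ s) ∷ I) (M ⊔ proj₁ x) (y ∷ s ++ w)
      ≈⟨ *-congˡ (pre-valley I (M ⊔ proj₁ x) w v (ℕ.⊔-lub M≤b (ℕ.<⇒≤ x<b)) domL′ domR) ⟩
    - q * ((- q) ^ length L * pre I (proj₁ b) w)
      ≈⟨ ≈-sym (*-assoc _ _ _) ⟩
    (- q) ^ suc (length L) * pre I (proj₁ b) w
      ≡⟨ cong (λ k → (- q) ^ k * pre I (proj₁ b) w) (sym (trans (length-++ L) (ℕ.+-comm (length L) 1))) ⟩
    (- q) ^ length (L ∷ʳ x) * pre I (proj₁ b) w ∎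

  pre-valley-zero : ∀ I M w {L b R s} → Valley L b R s → Unique (colors s) →
    ¬ (M ≤ proj₁ b × Dominates b L × Dominates b R) → pre (length s ∷ I) M (s ++ w) ≈ 0#
  pre-valley-zero I M w (up {b} {R} inc) _ ¬dom = ≈-trans (pre-up I M b R w inc) go
    where
    go : 𝟙 not (does (proj₁ b ℕ.<? M)) · post (suc (length R) ∷ I) (proj₁ b) (proj₂ b) (R ++ w) ≈ 0#
    go with proj₁ b ℕ.<? M
    ... | yes b<M rewrite dec-true (proj₁ b ℕ.<? M) b<M = ≈-refl
    ... | no b≮M  rewrite dec-false (proj₁ b ℕ.<? M) b≮M = reflexive
      (post-zero I (proj₁ b) (proj₂ b) R w λ (_ , domR) → ¬dom (ℕ.≮⇒≥ b≮M , [] , domR))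
  pre-valley-zero I M w (down {L} {b} {R} {x} {y} {s} y<x v) (x∉ ∷ uniq) ¬dom =
    ≈-trans (pre-descent I M x y s w y<x) (≈-trans (*-congˡ
      (pre-valley-zero I (M ⊔ proj₁ x) w v uniq λ (M⊔x≤b , domL , domR) →
        ¬dom (ℕ.m⊔n≤o⇒m≤o M (proj₁ x) M⊔x≤b
             -- The recursion yields only that the color of `x` is at most that of `b`; distinct
             -- colors make the inequality strict, as domination requires.
             , All.∷ʳ⁺ domL (ℕ.≤∧≢⇒< (ℕ.m⊔n≤o⇒n≤o M (proj₁ x) M⊔x≤b) x≢b)
             , domR)))
      (zeroʳ _))
    where
    x≢b : proj₁ x ≢ proj₁ b
    x≢b = All.head (All-resp-↭ (map⁺ proj₁ (Valley-↭ v)) x∉)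

  Φ-++ : ∀ u fs s w → List⁺.length u ≡ length s → Φ (u ∷ fs) (s ++ w) ≡ coefficient (Ψ u) (stdᵇ s) * Φ fs w
  Φ-++ u fs s w e rewrite e = cong₂ (λ x y → coefficient (Ψ u) (stdᵇ x) * Φ fs y) (take-++-length s w) (drop-++-length s w)

  lengths : List (List⁺ ℕ) → List ℕ
  lengths = map List⁺.length

  -- For given I, at most one sequence of words of these lengths contributes to w.
  data Analysis (I : List ℕ) (w : Biword) : Set (c Level.⊔ ℓ) where
    dead : (∀ fs → lengths fs ≡ I → Φ fs w ≈ 0#) →
           (Unique (colors w) → ∀ M → pre I M w ≈ 0#) → Analysis I w
    live : ∀ fs₀ k → lengths fs₀ ≡ I → concatMap List⁺.toList fs₀ ↭ colors w →
           Φ fs₀ w ≈ k → (∀ fs → lengths fs ≡ I → fs ≢ fs₀ → Φ fs w ≈ 0#) →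
           (∀ M → IsDominated M fs₀ → pre I M w ≈ k) →
           (Unique (colors w) → ∀ M → ¬ IsDominated M fs₀ → pre I M w ≈ 0#) → Analysis I w

  unique-++ : ∀ (s w : Biword) → Unique (colors (s ++ w)) → Unique (colors s) × Unique (colors w)
  unique-++ s w uniq =
    subst Unique (trans (take-map (length s) (s ++ w)) (cong colors (take-++-length s w)))
      (Unique.take⁺ (length s) uniq) ,
    subst Unique (trans (drop-map (length s) (s ++ w)) (cong colors (drop-++-length s w)))
      (Unique.drop⁺ (length s) uniq)

  -- A block that is not a valley annihilates both `Φ` and `pre`. A valley fixes its word `u₀`, and
  -- what `pre` then tests on the block is that `u₀` is initially dominated with head at least `M`.
  analyse-∷ : ∀ I s w → s ≢ [] → Unique (numbers s) → Analysis I w → Analysis (length s ∷ I) (s ++ w)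
  analyse-∷ I s w s≢[] uniq rest with isValley? s≢[] uniq
  ... | no ¬v = dead
    (λ { (u ∷ fs) e → ≈-trans (reflexive (Φ-++ u fs s w (∷-injectiveˡ e)))
           (≈-trans (*-congʳ (Ψ-nonvalley u ¬v)) (zeroˡ _)) })
    (λ _ M → pre-nonvalley I M s w s≢[] uniq ¬v)
  ... | yes (L , b , R , v) = with-rest rest
    where
    module P = Preimage (preimage uniq v)
    u₀ : List⁺ ℕ
    u₀ = proj₁ b ∷ P.tail

    Dominated : ℕ → Set
    Dominated M = M ≤ proj₁ b × Dominates b L × Dominates b R

    dominated? : ∀ M → Dec (Dominated M)
    dominated? M = (M ℕ.≤? proj₁ b) ×-dec dominates? b L ×-dec dominates? b R

    Φ-elsewhere : ∀ u fs → List⁺.length u ≡ length s → u ≢ u₀ → Φ (u ∷ fs) (s ++ w) ≈ 0#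
    Φ-elsewhere u fs e u≢ = ≈-trans (reflexive (Φ-++ u fs s w e))
      (≈-trans (*-congʳ (P.elsewhere u e u≢)) (zeroˡ _))

    length-u₀ : List⁺.length u₀ ≡ length s
    length-u₀ = trans (cong suc (trans (↭-length P.tail-↭) (length-map proj₁ (L ++ R))))
                      (sym (↭-length (Valley-↭ v)))

    u₀-↭ : proj₁ b ∷ P.tail ↭ colors s
    u₀-↭ = ↭-trans (↭-prep (proj₁ b) P.tail-↭) (map⁺ proj₁ (↭-sym (Valley-↭ v)))

    Φ-zero : ∀ fs → Φ fs w ≈ 0# → ∀ u → List⁺.length u ≡ length s → Φ (u ∷ fs) (s ++ w) ≈ 0#
    Φ-zero fs z u e = ≈-trans (reflexive (Φ-++ u fs s w e)) (≈-trans (*-congˡ z) (zeroʳ _))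

    with-rest : Analysis I w → Analysis (length s ∷ I) (s ++ w)
    with-rest (dead Φ-dead pre-dead) = dead
      (λ { (u ∷ fs) e → Φ-zero fs (Φ-dead fs (∷-injectiveʳ e)) u (∷-injectiveˡ e) })
      pre-zero
      where
      pre-zero : Unique (colors (s ++ w)) → ∀ M → pre (length s ∷ I) M (s ++ w) ≈ 0#
      pre-zero uniqᶜ M with unique-++ s w uniqᶜ | dominated? M
      ... | uniqˢ , _     | no ¬dom             = pre-valley-zero I M w v uniqˢ ¬dom
      ... | _     , uniqʷ | yes (M≤ , dL , dR) = ≈-trans (pre-valley I M w v M≤ dL dR)
        (≈-trans (*-congˡ (pre-dead uniqʷ (proj₁ b))) (zeroʳ _))
    with-rest (live fs₀ k e₀ p Φ₀ Φ-else pre-good pre-bad) = live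
      (u₀ ∷ fs₀) ((- q) ^ length L * k)
      (cong₂ _∷_ length-u₀ e₀)
      (↭-trans (++⁺ u₀-↭ p) (↭-reflexive (sym (map-++ proj₁ s w))))
      (≈-trans (reflexive (Φ-++ u₀ fs₀ s w length-u₀)) (*-cong P.at-tail Φ₀))
      elsewhere good bad
      where
      elsewhere : ∀ fs → lengths fs ≡ length s ∷ I → fs ≢ u₀ ∷ fs₀ → Φ fs (s ++ w) ≈ 0#
      elsewhere (u ∷ fs) e ne with u ≟⁺ u₀
      ... | no u≢    = Φ-elsewhere u fs (∷-injectiveˡ e) u≢
      ... | yes refl = Φ-zero fs (Φ-else fs (∷-injectiveʳ e) λ { refl → ne refl }) u (∷-injectiveˡ e)

      good : ∀ M → IsDominated M (u₀ ∷ fs₀) → pre (length s ∷ I) M (s ++ w) ≈ (- q) ^ length L * k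
      -- Being dominated does not depend on the order of the later letters, so it passes from the
      -- tail of `u₀` to the colors around the minimum.
      good M (d ∷ ds , M≤ ∷ inc) with All.++⁻ L (All.map⁻ (All-resp-↭ P.tail-↭ d))
      ... | dL , dR = ≈-trans (pre-valley I M w v M≤ dL dR) (*-congˡ (pre-good (proj₁ b) (ds , inc)))

      bad : Unique (colors (s ++ w)) → ∀ M → ¬ IsDominated M (u₀ ∷ fs₀) → pre (length s ∷ I) M (s ++ w) ≈ 0#
      bad uniqᶜ M ¬dom₀ with unique-++ s w uniqᶜ | dominated? M
      ... | uniqˢ , _     | no ¬dom             = pre-valley-zero I M w v uniqˢ ¬dom
      ... | _     , uniqʷ | yes (M≤ , dL , dR) = ≈-trans (pre-valley I M w v M≤ dL dR)
        (≈-trans (*-congˡ (pre-bad uniqʷ (proj₁ b) λ (ds , inc) →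
          ¬dom₀ (All-resp-↭ (↭-sym P.tail-↭) (All.map⁺ (All.++⁺ dL dR)) ∷ ds , M≤ ∷ inc))) (zeroʳ _))

  analyse : ∀ I w → I ⊨ length w → Unique (numbers w) → Analysis I w
  analyse []      []      _        _    = live [] 1# refl ↭-refl ≈-refl
    (λ { [] _ ne → contradiction refl ne }) (λ _ _ → ≈-refl) (λ _ _ ¬dom → contradiction ([] , [-]) ¬dom)
  analyse []      (_ ∷ _) (_ , ())
  analyse (i ∷ I) w       (0<i ∷ I-pos , e) uniq =
    subst₂ (λ j v → Analysis (j ∷ I) v) length-s (take++drop≡id i w)
      (analyse-∷ I (take i w) (drop i w) s≢[]
        (subst Unique (take-map i w) (Unique.take⁺ i uniq))
        (analyse I (drop i w) (I-pos , length-rest) (subst Unique (drop-map i w) (Unique.drop⁺ i uniq))))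
    where
    length-s : length (take i w) ≡ i
    length-s = trans (length-take i w) (ℕ.m≤n⇒m⊓n≡m (subst (i ≤_) e (ℕ.m≤m+n i (sum I))))
    length-rest : sum I ≡ length (drop i w)
    length-rest = sym (trans (length-drop i w) (trans (cong (_∸ i) (sym e)) (ℕ.m+n∸m≡n i (sum I))))
    s≢[] : take i w ≢ []
    s≢[] e′ = ℕ.<⇒≢ 0<i (trans (sym (cong length e′)) length-s)

  module _ {n} (1≤n : 1 ≤ n) where

    dominatedFactors-∷ : ∀ {σ} → σ ∈ 𝔖 n → ∃₂ λ u fs → dominatedFactors σ ≡ u ∷ fs × size (u ∷ fs) ≡ n
    dominatedFactors-∷ {[]}    σ∈ = contradiction (∈𝔖-length n σ∈) (ℕ.<⇒≢ 1≤n)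
    dominatedFactors-∷ {x ∷ σ} σ∈ = _ , _ , refl , trans (sum-saillance (x ∷ σ)) (∈𝔖-length n σ∈)

    𝚿-Φ : ∀ {σ} w → σ ∈ 𝔖 n → numbers w ∈ 𝔖 n → coefficient (𝚿 σ) w ≈ Φ (dominatedFactors σ) w
    𝚿-Φ {σ} w σ∈ w∈ with dominatedFactors σ | dominatedFactors-∷ σ∈
    ... | _ | u , fs , refl , e = coefficient-Ψs u fs w (subst (λ n → numbers w ∈ 𝔖 n) (sym e) w∈)

    𝚿-zero : ∀ {σ} w → σ ∈ 𝔖 n → numbers w ∉ 𝔖 n → coefficient (𝚿 σ) w ≈ 0#
    𝚿-zero {σ} w σ∈ w∉ with dominatedFactors σ | dominatedFactors-∷ σ∈
    ... | _ | u , fs , refl , e = coefficient-⊛-zero (Ψ-length u) (Ψs-length fs) w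
      (w∉ ∘ subst (λ n → numbers w ∈ 𝔖 n) e)

    -- The only factor sequence that can contribute rearranges the colors of `w`; were it the one of
    -- `σ`, those colors would form a permutation.
    Φ-nonpermutation : ∀ {σ} w → σ ∈ 𝔖 n → numbers w ∈ 𝔖 n → colors w ∉ 𝔖 n → Φ (dominatedFactors σ) w ≈ 0#
    Φ-nonpermutation {σ} w σ∈ τ∈ ∉ with analyse (saillance σ) w
      (compositions-sound _ (subst (λ k → saillance σ ∈ compositions k)
        (trans (∈𝔖-length n σ∈) (trans (sym (∈𝔖-length n τ∈)) (length-numbers w))) (saillance-∈ σ)))
      (proj₁ (∈𝔖⁻ n τ∈))
    ... | dead Φ-dead _ = Φ-dead _ refl
    ... | live fs₀ _ _ p _ Φ-else _ _ = Φ-else _ refl λ e →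
      ∉ (∈𝔖-resp-↭ n p (subst (_∈ 𝔖 n)
        (trans (sym (proj₁ (dominatedFactors-correct σ))) (cong (concatMap List⁺.toList) e)) σ∈))

    -- The permutations are grouped by saillance. For each `I` at most one can contribute, and it
    -- exists exactly if the sequence found by `analyse` is dominated, which is also when `pre` does
    -- not vanish by the domination test.
    coefficient-left : ∀ w → colors w ∈ 𝔖 n → numbers w ∈ 𝔖 n →
      coefficient (⨁[ σ ∈ 𝔖 n ] 𝚿 σ) w ≈ ∑ (compositions n) (λ I → pre I 0 w)
    coefficient-left w σ∈ τ∈ = begin
      coefficient (⨁[ σ ∈ 𝔖 n ] 𝚿 σ) w
        ≈⟨ coefficient-⨁ (𝔖 n) 𝚿 w ⟩
      ∑ (𝔖 n) (λ σ → coefficient (𝚿 σ) w)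
        ≈⟨ ∑-cong (𝔖 n) (λ σ∈ → ≈-trans (𝚿-Φ w σ∈ τ∈) (≈-sym (expand σ∈))) ⟩
      ∑ (𝔖 n) (λ σ → ∑ (compositions n) (λ I → 𝟙 does (saillance σ ≟ʷ I) · Φ (dominatedFactors σ) w))
        ≈⟨ ∑-swap (𝔖 n) (compositions n) _ ⟩
      ∑ (compositions n) (λ I → ∑ (𝔖 n) (λ σ → 𝟙 does (saillance σ ≟ʷ I) · Φ (dominatedFactors σ) w))
        ≈⟨ ∑-cong (compositions n) (λ I∈ → collect I∈) ⟩
      ∑ (compositions n) (λ I → pre I 0 w) ∎
      where
      expand : ∀ {σ} → σ ∈ 𝔖 n →
        ∑ (compositions n) (λ I → 𝟙 does (saillance σ ≟ʷ I) · Φ (dominatedFactors σ) w) ≈ Φ (dominatedFactors σ) w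
      expand {σ} σ∈ = ≈-trans
        (∑-single (compositions-unique n)
          (subst (λ k → saillance σ ∈ compositions k) (∈𝔖-length n σ∈) (saillance-∈ σ))
          (λ {I} _ ne → reflexive (cong (λ b → 𝟙 b · Φ (dominatedFactors σ) w) (dec-false (saillance σ ≟ʷ I) (ne ∘ sym)))))
        (reflexive (cong (λ b → 𝟙 b · Φ (dominatedFactors σ) w) (dec-true (saillance σ ≟ʷ saillance σ) refl)))

      term-zero : ∀ I σ → (saillance σ ≡ I → Φ (dominatedFactors σ) w ≈ 0#) →
                  𝟙 does (saillance σ ≟ʷ I) · Φ (dominatedFactors σ) w ≈ 0#
      term-zero I σ z with saillance σ ≟ʷ I
      ... | yes e = z e
      ... | no _  = ≈-refl

      length-w : length w ≡ n
      length-w = trans (sym (length-numbers w)) (∈𝔖-length n τ∈)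

      collect : ∀ {I} → I ∈ compositions n →
        ∑ (𝔖 n) (λ σ → 𝟙 does (saillance σ ≟ʷ I) · Φ (dominatedFactors σ) w) ≈ pre I 0 w
      collect {I} I∈ with analyse I w (subst (I ⊨_) (sym length-w) (compositions-sound n I∈)) (proj₁ (∈𝔖⁻ n τ∈))
      ... | dead Φ-dead pre-dead = ≈-trans
        (∑-zero (𝔖 n) λ {σ} _ → term-zero I σ (Φ-dead (dominatedFactors σ)))
        (≈-sym (pre-dead (proj₁ (∈𝔖⁻ n σ∈)) 0))
      ... | live fs₀ k refl p Φ₀ Φ-else good bad with isDominated? 0 fs₀
      ...   | no ¬dom = ≈-trans
        (∑-zero (𝔖 n) λ {σ} _ → term-zero (lengths fs₀) σ λ e → Φ-else (dominatedFactors σ) e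
          λ e′ → ¬dom (subst (IsDominated 0) e′ (dominatedFactors-isDominated σ)))
        (≈-sym (bad (proj₁ (∈𝔖⁻ n σ∈)) 0 ¬dom))
      ...   | yes dom = ≈-trans
        -- The concatenation of the words rearranges the colors of `w`, so it is again a
        -- permutation, and by domination the given words are its factors.
        (∑-single (𝔖-unique n) (∈𝔖-resp-↭ n (↭-sym p) σ∈) λ {σ} _ σ≢ →
          term-zero (lengths fs₀) σ λ e → Φ-else (dominatedFactors σ) e λ e′ →
            σ≢ (trans (sym (proj₁ (dominatedFactors-correct σ))) (cong (concatMap List⁺.toList) e′)))
        (≈-trans (reflexive at-σ₀) (≈-trans Φ₀ (≈-sym (good 0 dom))))
        where
        σ₀ = concatMap List⁺.toList fs₀
        factors : dominatedFactors σ₀ ≡ fs₀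
        factors = dominatedFactors-unique fs₀ (refl , proj₁ dom , Linked.tail (proj₂ dom))
        at-σ₀ : 𝟙 does (saillance σ₀ ≟ʷ lengths fs₀) · Φ (dominatedFactors σ₀) w ≡ Φ fs₀ w
        at-σ₀ = cong₂ 𝟙_·_ (dec-true (saillance σ₀ ≟ʷ lengths fs₀) (cong lengths factors))
                           (cong (λ fs → Φ fs w) factors)

    coefficient-left-zero : ∀ w → ¬ (colors w ∈ 𝔖 n × numbers w ∈ 𝔖 n) →
      coefficient (⨁[ σ ∈ 𝔖 n ] 𝚿 σ) w ≈ 0#
    coefficient-left-zero w ∉ = ≈-trans (coefficient-⨁ (𝔖 n) 𝚿 w) (∑-zero (𝔖 n) zero-term)
      where
      zero-term : ∀ {σ} → σ ∈ 𝔖 n → coefficient (𝚿 σ) w ≈ 0#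
      zero-term σ∈ with numbers w ∈ʷ? 𝔖 n
      ... | no τ∉  = 𝚿-zero w σ∈ τ∉
      ... | yes τ∈ = ≈-trans (𝚿-Φ w σ∈ τ∈) (Φ-nonpermutation w σ∈ τ∈ λ c∈ → ∉ (c∈ , τ∈))

  coefficients-agree : ∀ n → 1 ≤ n → (⨁[ σ ∈ 𝔖 n ] 𝚿 σ)
    ≋ (⨁[ I ∈ compositions n ] ⨁[ J ∈ compositions n ] ((- 1#) ^ (n ∸ length I) * q ^ D I J) • Λ n I J)
  coefficients-agree n 1≤n w with (colors w ∈ʷ? 𝔖 n) ×-dec (numbers w ∈ʷ? 𝔖 n)
  ... | no ∉          = ≈-trans (coefficient-left-zero 1≤n w ∉) (≈-sym (coefficient-right-zero {n} ∉))
  ... | yes (σ∈ , τ∈) = begin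
    _                                     ≈⟨ coefficient-left 1≤n w σ∈ τ∈ ⟩
    ∑ (compositions n) (λ I → pre I 0 w)  ≈⟨ ≈-sym weights ⟩
    ∑ (compositions n) (λ I → weight I 0 w) ≈⟨ ≈-sym (coefficient-right {n} σ∈ τ∈) ⟩
    _                                     ∎
    where
    weights : ∑ (compositions n) (λ I → weight I 0 w) ≈ ∑ (compositions n) (λ I → pre I 0 w)
    weights = subst (λ n → ∑ (compositions n) (λ I → weight I 0 w) ≈ ∑ (compositions n) (λ I → pre I 0 w))
      (trans (sym (length-numbers w)) (∈𝔖-length n τ∈)) (∑-weight≈∑-pre w)

theorem3p3 : ∀ {c ℓ} (K : CommutativeRing c ℓ) (q : CommutativeRing.Carrier K) →
    let open Combinations K q in
    (n : ℕ) → 1 ≤ n →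
    (⨁[ σ ∈ 𝔖 n ] 𝚿 σ)
    ≋ (⨁[ I ∈ compositions n ] ⨁[ J ∈ compositions n ]
    ((- 1#) ^ (n ∸ length I) *ᴷ q ^ D I J) • Λ n I J)
theorem3p3 K q = coefficients-agree K q
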